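{- For every integer $k\ge 3$ there exists $\epsilon_k>0$ such that $$\frac{1}{2k(k-1)}-o(1)\le \frac{{\rm inv}_k(n)}{n^2}\le \frac{1}{2\lfloor k^2/2\rfloor}-\epsilon_k+o(1).$$ Moreover, there exists $k_0$ such that for every $k\ge k_0$ there exists $\delta_k>0$ with $$\frac{{\rm inv}_k(n)}{n^2}\ge \frac{1}{2k(k-1)}+\delta_k-o(1).$$ Here $o(1)\to 0$ as $n\to\infty$ with $k$ fixed.
   Context: For an oriented graph $D$ and $X\subseteq V(D)$, inverting $X$ means reversing the direction of every edge of $D$ with both endpoints in $X$. A set $\{X_1,\dots,X_t\}$ of vertex subsets is $k$-decycling for $D$ if every $X_i$ has size at most $k$ and inverting $X_1,\dots,X_t$ yields an acyclic digraph. ${\rm inv}_k(D)$ is the minimum size of a $k$-decycling set of $D$, and ${\rm inv}_k(n)$ is the maximum of ${\rm inv}_k(D)$ over all oriented graphs (equivalently, all tournaments) $D$ on $n$ vertices. -}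

module Defs where

open import Data.Nat using (ℕ; zero; suc; _*_; _≤_; ⌊_/2⌋)
open import Data.Integer using (+_)
open import Data.Rational using (ℚ; _/_; 0ℚ) renaming (_≤_ to _≤ℚ_)
open import Data.Bool using (Bool; true; false; _∧_; if_then_else_)
open import Data.Fin using (Fin)
open import Data.Fin.Subset using (Subset; ∣_∣)
open import Data.Vec using (lookup)
open import Data.List using (List; []; _∷_; length; foldr)
open import Data.List.Relation.Unary.All using (All)
open import Data.Product using (Σ; _×_)
open import Relation.Binary.PropositionalEquality using (_≡_)
open import Relation.Nullary using (¬_)

Digraph : ℕ → Set
Digraph n = Fin n → Fin n → Bool

-- Oriented graph: no loops, no 2-cycles (a loop i→i would violate this too).
Oriented : {n : ℕ} → Digraph n → Set
Oriented {n} A = (i j : Fin n) → A i j ≡ true → A j i ≡ false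

invert : {n : ℕ} → Subset n → Digraph n → Digraph n
invert X A i j = if (lookup X i ∧ lookup X j) then A j i else A i j

-- Inverting a family X₁,…,X_t (in list order; the result is order independent).
invertAll : {n : ℕ} → List (Subset n) → Digraph n → Digraph n
invertAll Xs A = foldr invert A Xs

data Walk {n : ℕ} (A : Digraph n) : Fin n → Fin n → Set where
  arc  : ∀ {u v} → A u v ≡ true → Walk A u v
  _∷ʷ_ : ∀ {u v w} → A u v ≡ true → Walk A v w → Walk A u w

Acyclic : {n : ℕ} → Digraph n → Set
Acyclic {n} A = (v : Fin n) → ¬ Walk A v v

Decycling : {n : ℕ} → ℕ → Digraph n → List (Subset n) → Set
Decycling k A Xs = All (λ X → ∣ X ∣ ≤ k) Xs × Acyclic (invertAll Xs A)

fromℕ : ℕ → ℚ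
fromℕ m = + m / 1

-- inv_k(n) ≤ x   (max over oriented D of min over k-decycling families)
InvLe : ℕ → ℕ → ℚ → Set
InvLe k n x = (A : Digraph n) → Oriented A →
  Σ (List (Subset n)) λ Xs → Decycling k A Xs × (fromℕ (length Xs) ≤ℚ x)

InvGe : ℕ → ℕ → ℚ → Set
InvGe k n x = Σ (Digraph n) λ A → Oriented A ×
  ((Xs : List (Subset n)) → Decycling k A Xs → x ≤ℚ fromℕ (length Xs))

-- 1/d as a rational (only used with d > 0; recip 0 = 0 is a junk value).
recip : ℕ → ℚ
recip zero = 0ℚ
recip (suc d) = + 1 / suc d

lowerC : ℕ → ℚ
lowerC k = recip (2 * k * (k Data.Nat.∸ 1))

upperC : ℕ → ℚ
upperC k = recip (2 * ⌊ k * k /2⌋)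

sq : ℕ → ℚ
sq n = fromℕ (n * n)

{-# OPTIONS --safe #-}
module Submission where

-- Lower bounds. In a suitable tournament T on m vertices every linear order has about m²/4 backward arcs.
-- Blow up T into parts of size q. The final acyclic digraph induces a linear order on every transversal, so
-- averaging over transversals shows that about (mq)²/4 pairs in different parts are reversed, while each set
-- accounts for at most C(k,2) of them. A set accounting for all C(k,2) would be a transitive subtournament of T
-- of order k. For large k a tournament of size polynomial in k without such subtournaments still has loss
-- below 1/C(k,2), and this gives δ. Both properties of T come from one weighted count over all tournaments.
--
-- Upper bound. Fix a linear order and its reverse; their sets of backward pairs are complementary. By Ramsey's
-- theorem and averaging over transversals a positive fraction of all pairs is covered by edge-disjoint
-- k-cliques that are monochromatic for this 2-colouring, each of which is reversed by a single set. The
-- remaining backward pairs between constant-size clusters are decomposed into bicliques K(⌊k/2⌋,⌈k/2⌉) by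
-- the Kővári–Sós–Turán theorem, up to o(n²) pairs; the pairs inside clusters are only O(n) many. All leftover
-- pairs are reversed one at a time. The better of the two orders does at least as well as the average.

open import Defs
open import Data.Nat as ℕ using (ℕ; zero; suc; z≤n; s≤s; _≤_; _+_; _*_; _∸_; _^_; _<ᵇ_; ⌊_/2⌋; NonZero)
import Data.Nat.Properties as ℕₚ
import Data.Nat.DivMod as DivMod
import Data.Nat.ListAction as ListAction
open import Data.Nat.Tactic.RingSolver using (solve-∀)
import Data.Integer as ℤ
import Data.Integer.Properties as ℤₚ
import Data.Rational as ℚ
import Data.Rational.Properties as ℚₚ
import Data.Rational.Unnormalised as ℚᵘ
import Data.Rational.Unnormalised.Properties as ℚᵘₚ
open import Data.Rational.Solver using (module +-*-Solver)
open import Data.Rational using (ℚ; 0ℚ)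
open import Data.Bool using (Bool; true; false; _∧_; _∨_; not; _xor_; if_then_else_)
import Data.Bool.Properties as Boolₚ
open import Data.Fin as Fin using (Fin; zero; suc; toℕ; combine; _↑ˡ_; _↑ʳ_)
import Data.Fin.Properties as Finₚ
open import Data.Fin.Subset using (Subset; ∣_∣)
open import Data.Vec as Vec using (Vec; lookup; []; _∷_)
import Data.Vec.Properties as Vecₚ
open import Data.List as List using (List; []; _∷_; _++_; length; allFin)
import Data.List.Properties as Listₚ
open import Data.List.Relation.Unary.All as All using (All; []; _∷_)
import Data.List.Relation.Unary.All.Properties as Allₚ
open import Data.List.Relation.Unary.AllPairs as AllPairs using (AllPairs; []; _∷_)
import Data.List.Relation.Unary.AllPairs.Properties as AllPairsₚ
open import Data.List.Relation.Unary.Any using (here; there)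
open import Data.List.Relation.Binary.Sublist.Propositional as Sublist using (_⊆_; []; _∷_; _∷ʳ_; ⊆-trans)
open import Data.List.Relation.Binary.Sublist.Propositional.Properties using (All-resp-⊆)
open import Data.List.Membership.Propositional using (_∈_)
import Data.List.Membership.Propositional.Properties as ∈ₚ
open import Data.Product using (Σ; ∃; _×_; _,_; proj₁; proj₂)
open import Data.Sum using (_⊎_; inj₁; inj₂; [_,_]′)
open import Data.Empty using (⊥-elim)
open import Data.Unit using (⊤; tt)
open import Function using (_∘_; id)
open import Relation.Nullary using (¬_; yes; no)
open import Relation.Binary using (tri<; tri≈; tri>)
open import Relation.Binary.PropositionalEquality using (_≡_; _≢_; refl; sym; trans; cong; cong₂; subst; subst₂)

-- The coefficients 2k(k-1) and 2⌊k²/2⌋ are 4 C(k,2) and 4ab with a = ⌊k/2⌋, b = ⌈k/2⌉: about n²/4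
-- pairs have to be reversed, and a set handles C(k,2) of them at best, ab if it is a biclique.
--
-- A random tournament on all n vertices cannot yield δ, because every large tournament contains
-- transitive subtournaments of order k. Blowing up a tournament of fixed order m avoids this, and
-- since m does not grow with n, the loss of one pair per set survives as a positive constant. The
-- order m is caught between two demands: a relative error small against 1/C(k,2) needs m to be a
-- power of k (about the eighth), while at most (mk)^k patterns must remain rare against 2^C(k,2).
-- Both hold for large k because k log k is small against k².
--
-- On the other side, C(k,2) ≥ ab + 1 for k ≥ 3, so a clique does the work of a biclique with at
-- least one pair to spare. The resulting ε is tiny because the packing is as sparse as the Ramsey
-- number dictates.
--
-- All estimates stay in ℕ, multiplied by their denominators; o(1) becomes an arbitrary η > 0 only
-- at the end.

⟦_⟧ : Bool → ℕ
⟦ true ⟧ = 1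
⟦ false ⟧ = 0

⟦⟧≤1 : ∀ b → ⟦ b ⟧ ≤ 1
⟦⟧≤1 true = ℕₚ.≤-refl
⟦⟧≤1 false = z≤n

⟦∧⟧ : ∀ a b → ⟦ a ∧ b ⟧ ≡ ⟦ a ⟧ * ⟦ b ⟧
⟦∧⟧ true b = sym (ℕₚ.*-identityˡ _)
⟦∧⟧ false b = refl

true≢false : true ≢ false
true≢false ()

<ᵇ-true : ∀ {m n} → m ℕ.< n → (m <ᵇ n) ≡ true
<ᵇ-true {zero} {suc n} _ = refl
<ᵇ-true {suc m} {suc n} (s≤s p) = <ᵇ-true p

<ᵇ-true⁻¹ : ∀ {m n} → (m <ᵇ n) ≡ true → m ℕ.< n
<ᵇ-true⁻¹ {zero} {suc n} _ = s≤s z≤n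
<ᵇ-true⁻¹ {suc m} {suc n} eq = s≤s (<ᵇ-true⁻¹ eq)

<ᵇ-false : ∀ {m n} → n ≤ m → (m <ᵇ n) ≡ false
<ᵇ-false {m} {zero} _ = refl
<ᵇ-false {suc m} {suc n} (s≤s p) = <ᵇ-false p

_<?ᶠ_ : ∀ {n} → Fin n → Fin n → Bool
i <?ᶠ j = toℕ i <ᵇ toℕ j

_==_ : ∀ {n} → Fin n → Fin n → Bool
zero == zero = true
zero == suc j = false
suc i == zero = false
suc i == suc j = i == j

==-refl : ∀ {n} (i : Fin n) → (i == i) ≡ true
==-refl zero = refl
==-refl (suc i) = ==-refl i

==⇒≡ : ∀ {n} {i j : Fin n} → (i == j) ≡ true → i ≡ j
==⇒≡ {i = zero} {zero} _ = refl
==⇒≡ {i = suc i} {suc j} eq = cong suc (==⇒≡ eq)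

-- Finite sums

sum : ∀ {n} → (Fin n → ℕ) → ℕ
sum {zero} f = 0
sum {suc n} f = f zero + sum (f ∘ suc)

sum-cong : ∀ {n} {f g : Fin n → ℕ} → (∀ i → f i ≡ g i) → sum f ≡ sum g
sum-cong {zero} eq = refl
sum-cong {suc n} eq = cong₂ _+_ (eq zero) (sum-cong (eq ∘ suc))

+-interchange : ∀ a b c d → a + b + (c + d) ≡ a + c + (b + d)
+-interchange = solve-∀

sum-+ : ∀ {n} (f g : Fin n → ℕ) → sum (λ i → f i + g i) ≡ sum f + sum g
sum-+ {zero} f g = refl
sum-+ {suc n} f g = trans (cong (f zero + g zero +_) (sum-+ (f ∘ suc) (g ∘ suc))) (+-interchange (f zero) (g zero) _ _)

sum-*ˡ : ∀ {n} c (f : Fin n → ℕ) → sum (λ i → c * f i) ≡ c * sum f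
sum-*ˡ {zero} c f = sym (ℕₚ.*-zeroʳ c)
sum-*ˡ {suc n} c f = trans (cong (c * f zero +_) (sum-*ˡ c (f ∘ suc))) (sym (ℕₚ.*-distribˡ-+ c (f zero) _))

sum-mono : ∀ {n} {f g : Fin n → ℕ} → (∀ i → f i ≤ g i) → sum f ≤ sum g
sum-mono {zero} _ = z≤n
sum-mono {suc n} le = ℕₚ.+-mono-≤ (le zero) (sum-mono (le ∘ suc))

sum-const : ∀ n (c : ℕ) → sum {n} (λ _ → c) ≡ n * c
sum-const zero c = refl
sum-const (suc n) c = cong (c +_) (sum-const n c)

sum-zero : ∀ n {f : Fin n → ℕ} → (∀ i → f i ≡ 0) → sum f ≡ 0
sum-zero n eq = trans (sum-cong eq) (trans (sum-const n 0) (ℕₚ.*-zeroʳ n))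

sum≡0⇒ : ∀ {n} (f : Fin n → ℕ) → sum f ≡ 0 → ∀ i → f i ≡ 0
sum≡0⇒ f eq zero = ℕₚ.m+n≡0⇒m≡0 (f zero) eq
sum≡0⇒ f eq (suc i) = sum≡0⇒ (f ∘ suc) (ℕₚ.m+n≡0⇒n≡0 (f zero) eq) i

sum-δ : ∀ {n} (i : Fin n) (F : Fin n → ℕ) → sum (λ j → ⟦ i == j ⟧ * F j) ≡ F i
sum-δ {suc n} zero F = trans (cong₂ _+_ (ℕₚ.*-identityˡ _) (sum-zero n λ _ → refl)) (ℕₚ.+-identityʳ _)
sum-δ (suc i) F = sum-δ i (F ∘ suc)

sum-swap : ∀ {m n} (f : Fin m → Fin n → ℕ) → sum (λ i → sum (f i)) ≡ sum (λ j → sum (λ i → f i j))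
sum-swap {zero} {n} f = sym (sum-zero n λ _ → refl)
sum-swap {suc m} f = trans (cong (sum (f zero) +_) (sum-swap (f ∘ suc))) (sym (sum-+ (f zero) _))

sum-split : ∀ a {b} (f : Fin (a + b) → ℕ) → sum f ≡ sum (λ i → f (i ↑ˡ b)) + sum (λ j → f (a ↑ʳ j))
sum-split zero f = refl
sum-split (suc a) f = trans (cong (f zero +_) (sum-split a (f ∘ suc))) (sym (ℕₚ.+-assoc (f zero) _ _))

sum-combine : ∀ a {b} (f : Fin (a * b) → ℕ) → sum f ≡ sum (λ i → sum (λ j → f (combine {a} {b} i j)))
sum-combine zero f = refl
sum-combine (suc a) {b} f = trans (sum-split b f) (cong (sum (λ j → f (j ↑ˡ (a * b))) +_) (sum-combine a (λ i → f (b ↑ʳ i))))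

sum< : ∀ {n} → (Fin n → Fin n → ℕ) → ℕ
sum< {zero} D = 0
sum< {suc n} D = sum (D zero ∘ suc) + sum< (λ i j → D (suc i) (suc j))

sum<-mono : ∀ {n} {D E : Fin n → Fin n → ℕ} → (∀ i j → toℕ i ℕ.< toℕ j → D i j ≤ E i j) → sum< D ≤ sum< E
sum<-mono {zero} _ = z≤n
sum<-mono {suc n} le = ℕₚ.+-mono-≤ (sum-mono λ j → le zero (suc j) (s≤s z≤n)) (sum<-mono λ i j p → le (suc i) (suc j) (s≤s p))

sum<-cong : ∀ {n} {D E : Fin n → Fin n → ℕ} → (∀ i j → toℕ i ℕ.< toℕ j → D i j ≡ E i j) → sum< D ≡ sum< E
sum<-cong eq = ℕₚ.≤-antisym (sum<-mono λ i j p → ℕₚ.≤-reflexive (eq i j p)) (sum<-mono λ i j p → ℕₚ.≤-reflexive (sym (eq i j p)))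

sum<≡sum : ∀ {n} (D : Fin n → Fin n → ℕ) → sum< D ≡ sum (λ i → sum (λ j → ⟦ i <?ᶠ j ⟧ * D i j))
sum<≡sum {zero} D = refl
sum<≡sum {suc n} D = cong₂ _+_ (sum-cong (λ j → sym (ℕₚ.*-identityˡ (D zero (suc j))))) (sum<≡sum (λ i j → D (suc i) (suc j)))

sum<≡0⇒ : ∀ {n} (D : Fin n → Fin n → ℕ) → sum< D ≡ 0 → ∀ i j → toℕ i ℕ.< toℕ j → D i j ≡ 0
sum<≡0⇒ {suc n} D eq zero (suc j) _ = sum≡0⇒ (D zero ∘ suc) (ℕₚ.m+n≡0⇒m≡0 _ eq) j
sum<≡0⇒ {suc n} D eq (suc i) (suc j) (s≤s p) = sum<≡0⇒ _ (ℕₚ.m+n≡0⇒n≡0 (sum (D zero ∘ suc)) eq) i j p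

tri : ℕ → ℕ
tri zero = 0
tri (suc n) = n + tri n

tri-double : ∀ n → tri n + tri n + n ≡ n * n
tri-double zero = refl
tri-double (suc n) = trans (lem n (tri n)) (trans (cong (λ z → suc (n + (n + z))) (tri-double n)) (cong (λ z → suc (n + z)) (sym (ℕₚ.*-suc n n))))
  where
  lem : ∀ n t → (n + t) + (n + t) + suc n ≡ suc (n + (n + (t + t + n)))
  lem = solve-∀

sum<-const : ∀ n → sum< {n} (λ _ _ → 1) ≡ tri n
sum<-const zero = refl
sum<-const (suc n) = cong₂ _+_ (trans (sum-const n 1) (ℕₚ.*-identityʳ n)) (sum<-const n)

sumₗ : {A : Set} → List A → (A → ℕ) → ℕ
sumₗ L F = ListAction.sum (List.map F L)

sumₗ-mono : {A : Set} (L : List A) {F G : A → ℕ} → (∀ {x} → x ∈ L → F x ≤ G x) → sumₗ L F ≤ sumₗ L G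
sumₗ-mono [] le = z≤n
sumₗ-mono (x ∷ L) le = ℕₚ.+-mono-≤ (le (here refl)) (sumₗ-mono L (le ∘ there))

sumₗ-cong : {A : Set} (L : List A) {F G : A → ℕ} → (∀ x → F x ≡ G x) → sumₗ L F ≡ sumₗ L G
sumₗ-cong [] eq = refl
sumₗ-cong (x ∷ L) eq = cong₂ _+_ (eq x) (sumₗ-cong L eq)

sumₗ-const : {A : Set} (L : List A) (c : ℕ) → sumₗ L (λ _ → c) ≡ length L * c
sumₗ-const [] c = refl
sumₗ-const (x ∷ L) c = cong (c +_) (sumₗ-const L c)

sumₗ-+ : {A : Set} (L : List A) (F G : A → ℕ) → sumₗ L (λ x → F x + G x) ≡ sumₗ L F + sumₗ L G
sumₗ-+ [] F G = refl
sumₗ-+ (x ∷ L) F G = trans (cong (F x + G x +_) (sumₗ-+ L F G)) (+-interchange (F x) (G x) _ _)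

sumₗ-*ˡ : {A : Set} (L : List A) (c : ℕ) (F : A → ℕ) → sumₗ L (λ x → c * F x) ≡ c * sumₗ L F
sumₗ-*ˡ [] c F = sym (ℕₚ.*-zeroʳ c)
sumₗ-*ˡ (x ∷ L) c F = trans (cong (c * F x +_) (sumₗ-*ˡ L c F)) (sym (ℕₚ.*-distribˡ-+ c (F x) _))

sumₗ-++ : {A : Set} (L M : List A) (F : A → ℕ) → sumₗ (L ++ M) F ≡ sumₗ L F + sumₗ M F
sumₗ-++ [] M F = refl
sumₗ-++ (x ∷ L) M F = trans (cong (F x +_) (sumₗ-++ L M F)) (sym (ℕₚ.+-assoc (F x) _ _))

sumₗ-swap : {A : Set} {n : ℕ} (L : List A) (F : A → Fin n → ℕ) → sumₗ L (λ x → sum (F x)) ≡ sum (λ u → sumₗ L (λ x → F x u))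
sumₗ-swap {n = n} [] F = sym (sum-zero n λ _ → refl)
sumₗ-swap (x ∷ L) F = trans (cong (sum (F x) +_) (sumₗ-swap L F)) (sym (sum-+ (F x) _))

term≤sumₗ : {A : Set} {L : List A} (F : A → ℕ) {x : A} → x ∈ L → F x ≤ sumₗ L F
term≤sumₗ F (here refl) = ℕₚ.m≤m+n _ _
term≤sumₗ {L = y ∷ L} F (there p) = ℕₚ.≤-trans (term≤sumₗ F p) (ℕₚ.m≤n+m _ (F y))

sumₗ-tabulate : ∀ {A : Set} n (g : Fin n → A) (F : A → ℕ) → sumₗ (List.tabulate g) F ≡ sum (λ i → F (g i))
sumₗ-tabulate zero g F = refl
sumₗ-tabulate (suc n) g F = cong (F (g zero) +_) (sumₗ-tabulate n (g ∘ suc) F)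

-- Averaging over transversals

argmin : ∀ {q} (g : Fin (suc q) → ℕ) → ∃ λ a → ∀ b → g a ≤ g b
argmin {zero} g = zero , λ { zero → ℕₚ.≤-refl }
argmin {suc q} g with argmin (g ∘ suc)
... | a , le with ℕₚ.≤-total (g zero) (g (suc a))
... | inj₁ p = zero , λ { zero → ℕₚ.≤-refl ; (suc b) → ℕₚ.≤-trans p (le b) }
... | inj₂ p = suc a , λ { zero → p ; (suc b) → le b }

below-average : ∀ {q} (g : Fin (suc q) → ℕ) → ∃ λ a → suc q * g a ≤ sum g
below-average {q} g with argmin g
... | a , le = a , ℕₚ.≤-trans (ℕₚ.≤-reflexive (sym (sum-const (suc q) (g a)))) (sum-mono le)

-- The linear terms L collect the interactions with the parts where f has already been chosen.
transversal⁺ : ∀ {q m} (D : Fin m → Fin m → Fin (suc q) → Fin (suc q) → ℕ) (L : Fin m → Fin (suc q) → ℕ) →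
  ∃ λ (f : Fin m → Fin (suc q)) →
    suc q * suc q * sum< (λ i j → D i j (f i) (f j)) + suc q * suc q * sum (λ i → L i (f i))
    ≤ sum< (λ i j → sum (λ a → sum (D i j a))) + suc q * sum (λ i → sum (L i))
transversal⁺ {q} {zero} D L = (λ ()) , ℕₚ.≤-reflexive (lem (suc q))
  where
  lem : ∀ Q → Q * Q * 0 + Q * Q * 0 ≡ 0 + Q * 0
  lem = solve-∀
transversal⁺ {q} {suc m} D L = f , bound
  where
  Q = suc q
  -- Up to the factor `Q`, the expected cost of everything that involves the first part when its
  -- vertex is `a` and the other vertices are uniform.
  G : Fin Q → ℕ
  G a = Q * L zero a + sum (λ j → sum (D zero (suc j) a))
  a = proj₁ (below-average G)
  L' : Fin m → Fin Q → ℕ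
  L' j b = L (suc j) b + D zero (suc j) a b
  rest = transversal⁺ (λ i j → D (suc i) (suc j)) L'
  f : Fin (suc m) → Fin Q
  f zero = a
  f (suc j) = proj₁ rest j
  P = sum< (λ i j → D (suc i) (suc j) (f (suc i)) (f (suc j)))
  P* = sum< (λ i j → sum (λ a → sum (D (suc i) (suc j) a)))
  X = sum (λ j → L (suc j) (f (suc j)))
  Y = sum (λ j → D zero (suc j) a (f (suc j)))
  U = sum (λ j → sum (L (suc j)))
  V = sum (λ j → sum (D zero (suc j) a))
  S₀ = sum (L zero)
  C = sum (λ j → sum (λ a → sum (D zero (suc j) a)))
  first : Q * (Q * L zero a + V) ≤ Q * S₀ + C
  first = ℕₚ.≤-trans (proj₂ (below-average G)) (ℕₚ.≤-reflexive (trans (sum-+ (λ a → Q * L zero a) (λ a → sum (λ j → sum (D zero (suc j) a))))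
    (cong₂ _+_ (sum-*ˡ Q (L zero)) (sum-swap (λ a j → sum (D zero (suc j) a))))))
  later : Q * Q * P + Q * Q * (X + Y) ≤ P* + Q * (U + V)
  later = subst₂ (λ s t → Q * Q * P + Q * Q * s ≤ P* + Q * t)
    (sum-+ (λ j → L (suc j) (f (suc j))) _)
    (trans (sum-cong λ j → sum-+ (L (suc j)) (D zero (suc j) a)) (sum-+ (λ j → sum (L (suc j))) _))
    (proj₂ rest)
  lhs : ∀ Q P X Y l → Q * Q * P + Q * Q * (X + Y) + Q * Q * l ≡ Q * Q * (Y + P) + Q * Q * (l + X)
  lhs = solve-∀
  mid : ∀ Q P* U V l → P* + Q * (U + V) + Q * Q * l ≡ P* + Q * U + Q * (Q * l + V)
  mid = solve-∀
  rhs : ∀ Q P* U S C → P* + Q * U + (Q * S + C) ≡ C + P* + Q * (S + U)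
  rhs = solve-∀
  bound : Q * Q * (Y + P) + Q * Q * (L zero a + X) ≤ C + P* + Q * (S₀ + U)
  bound = begin
    Q * Q * (Y + P) + Q * Q * (L zero a + X)        ≡⟨ lhs Q P X Y (L zero a) ⟨
    Q * Q * P + Q * Q * (X + Y) + Q * Q * L zero a  ≤⟨ ℕₚ.+-monoˡ-≤ (Q * Q * L zero a) later ⟩
    P* + Q * (U + V) + Q * Q * L zero a             ≡⟨ mid Q P* U V (L zero a) ⟩
    P* + Q * U + Q * (Q * L zero a + V)             ≤⟨ ℕₚ.+-monoʳ-≤ (P* + Q * U) first ⟩
    P* + Q * U + (Q * S₀ + C)                       ≡⟨ rhs Q P* U S₀ C ⟩
    C + P* + Q * (S₀ + U)                           ∎
    where open ℕₚ.≤-Reasoning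

transversal : ∀ {q m} (D : Fin m → Fin m → Fin (suc q) → Fin (suc q) → ℕ) →
  ∃ λ (f : Fin m → Fin (suc q)) →
    suc q * suc q * sum< (λ i j → D i j (f i) (f j)) ≤ sum< (λ i j → sum (λ a → sum (D i j a)))
transversal {q} {m} D with transversal⁺ D (λ _ _ → 0)
... | f , le = f , (begin
  suc q * suc q * P                                      ≤⟨ ℕₚ.m≤m+n _ _ ⟩
  suc q * suc q * P + suc q * suc q * sum {m} (λ _ → 0)  ≤⟨ le ⟩
  P* + suc q * sum {m} (λ i → sum {suc q} (λ _ → 0))     ≡⟨ cong (λ z → P* + suc q * z) (sum-zero m λ _ → sum-zero (suc q) λ _ → refl) ⟩
  P* + suc q * 0                                         ≡⟨ cong (P* +_) (ℕₚ.*-zeroʳ (suc q)) ⟩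
  P* + 0                                                 ≡⟨ ℕₚ.+-identityʳ P* ⟩
  P*                                                     ∎)
  where
  open ℕₚ.≤-Reasoning
  P = sum< (λ i j → D i j (f i) (f j))
  P* = sum< (λ i j → sum (λ a → sum (D i j a)))

-- Inversions and padding

-- Parity of the number of sets that contain both vertices. Inversions act on a pair by toggling, so
-- this parity is all that matters about a family.
flip : ∀ {n} → List (Subset n) → Fin n → Fin n → Bool
flip [] u v = false
flip (X ∷ Xs) u v = (lookup X u ∧ lookup X v) xor flip Xs u v

flip-sym : ∀ {n} (Xs : List (Subset n)) u v → flip Xs u v ≡ flip Xs v u
flip-sym [] u v = refl
flip-sym (X ∷ Xs) u v = cong₂ _xor_ (Boolₚ.∧-comm (lookup X u) _) (flip-sym Xs u v)

flip-++ : ∀ {n} (Xs Ys : List (Subset n)) u v → flip (Xs ++ Ys) u v ≡ flip Xs u v xor flip Ys u v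
flip-++ [] Ys u v = refl
flip-++ (X ∷ Xs) Ys u v = trans (cong ((lookup X u ∧ lookup X v) xor_) (flip-++ Xs Ys u v))
  (sym (Boolₚ.xor-assoc (lookup X u ∧ lookup X v) _ _))

invertAll-flip : ∀ {n} (Xs : List (Subset n)) (A : Digraph n) u v →
  invertAll Xs A u v ≡ (if flip Xs u v then A v u else A u v)
invertAll-flip [] A u v = refl
invertAll-flip (X ∷ Xs) A u v with lookup X u ∧ lookup X v
... | false = invertAll-flip Xs A u v
... | true rewrite invertAll-flip Xs A v u | flip-sym Xs v u with flip Xs u v
... | true = refl
... | false = refl

flip≤ : ∀ {n} (Xs : List (Subset n)) u v → ⟦ flip Xs u v ⟧ ≤ sumₗ Xs (λ X → ⟦ lookup X u ⟧ * ⟦ lookup X v ⟧)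
flip≤ [] u v = z≤n
flip≤ (X ∷ Xs) u v rewrite sym (⟦∧⟧ (lookup X u) (lookup X v)) with lookup X u ∧ lookup X v
... | false = flip≤ Xs u v
... | true = ℕₚ.≤-trans (⟦⟧≤1 (not (flip Xs u v))) (s≤s z≤n)

∣∣≡sum : ∀ {n} (X : Subset n) → ∣ X ∣ ≡ sum (λ u → ⟦ lookup X u ⟧)
∣∣≡sum [] = refl
∣∣≡sum (true ∷ X) = cong suc (∣∣≡sum X)
∣∣≡sum (false ∷ X) = ∣∣≡sum X

restrict : ∀ {n} r → Subset (n + r) → Subset n
restrict r X = Vec.tabulate (λ i → lookup X (i ↑ˡ r))

∣restrict∣≤ : ∀ {n} r (X : Subset (n + r)) → ∣ restrict r X ∣ ≤ ∣ X ∣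
∣restrict∣≤ {n} r X = begin
  ∣ restrict r X ∣                       ≡⟨ ∣∣≡sum (restrict r X) ⟩
  sum (λ u → ⟦ lookup (restrict r X) u ⟧) ≡⟨ sum-cong (λ u → cong ⟦_⟧ (Vecₚ.lookup∘tabulate (λ i → lookup X (i ↑ˡ r)) u)) ⟩
  sum (λ u → ⟦ lookup X (u ↑ˡ r) ⟧)       ≤⟨ ℕₚ.m≤m+n _ _ ⟩
  sum (λ u → ⟦ lookup X (u ↑ˡ r) ⟧) + sum (λ u → ⟦ lookup X (n ↑ʳ u) ⟧) ≡⟨ sum-split n (λ u → ⟦ lookup X u ⟧) ⟨
  sum (λ u → ⟦ lookup X u ⟧)             ≡⟨ ∣∣≡sum X ⟨
  ∣ X ∣                                  ∎
  where open ℕₚ.≤-Reasoning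

flip-restrict : ∀ {n} r (Xs : List (Subset (n + r))) u v → flip (List.map (restrict r) Xs) u v ≡ flip Xs (u ↑ˡ r) (v ↑ˡ r)
flip-restrict r [] u v = refl
flip-restrict r (X ∷ Xs) u v = cong₂ _xor_
  (cong₂ _∧_ (Vecₚ.lookup∘tabulate _ u) (Vecₚ.lookup∘tabulate _ v)) (flip-restrict r Xs u v)

-- Acyclicity passes to induced subdigraphs, with every set cut down to the remaining vertices. This
-- monotonicity in n serves both bounds: lower bounds are padded with isolated vertices, upper
-- bounds are restricted from an order with convenient divisibility.
decycling-restrict : ∀ {n} r k (A : Digraph (n + r)) (B : Digraph n) → (∀ u v → B u v ≡ A (u ↑ˡ r) (v ↑ˡ r)) →
  ∀ Xs → Decycling k A Xs → Decycling k B (List.map (restrict r) Xs)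
decycling-restrict {n} r k A B eq Xs (small , acyclic) =
  Allₚ.map⁺ (All.map (λ {X} → ℕₚ.≤-trans (∣restrict∣≤ r X)) small) , λ v w → acyclic (v ↑ˡ r) (walk w)
  where
  arcs : ∀ u v → invertAll (List.map (restrict r) Xs) B u v ≡ invertAll Xs A (u ↑ˡ r) (v ↑ˡ r)
  arcs u v rewrite invertAll-flip (List.map (restrict r) Xs) B u v | invertAll-flip Xs A (u ↑ˡ r) (v ↑ˡ r)
    | flip-restrict r Xs u v | eq u v | eq v u = refl
  walk : ∀ {u v} → Walk (invertAll (List.map (restrict r) Xs) B) u v → Walk (invertAll Xs A) (u ↑ˡ r) (v ↑ˡ r)
  walk (arc e) = arc (trans (sym (arcs _ _)) e)
  walk (e ∷ʷ w) = trans (sym (arcs _ _)) e ∷ʷ walk w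

pad : ∀ {n} r → Digraph n → Digraph (n + r)
pad {n} r A u v with Fin.splitAt n u | Fin.splitAt n v
... | inj₁ i | inj₁ j = A i j
... | inj₁ _ | inj₂ _ = false
... | inj₂ _ | _ = false

pad-oriented : ∀ {n} r {A : Digraph n} → Oriented A → Oriented (pad r A)
pad-oriented {n} r or u v e with Fin.splitAt n u | Fin.splitAt n v
... | inj₁ i | inj₁ j = or i j e
... | inj₂ _ | inj₁ _ = refl
... | inj₂ _ | inj₂ _ = refl

pad-↑ˡ : ∀ {n} r (A : Digraph n) u v → A u v ≡ pad r A (u ↑ˡ r) (v ↑ˡ r)
pad-↑ˡ {n} r A u v rewrite Finₚ.splitAt-↑ˡ n u r | Finₚ.splitAt-↑ˡ n v r = refl

-- The predicate on the number of sets is left open so that the combinatorics can work with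
-- inequalities over ℕ; the rational forms `InvLe` and `InvGe` are reached only at the end.
Achieves : ℕ → ℕ → (ℕ → Set) → Set
Achieves k n P = (A : Digraph n) → Oriented A → Σ (List (Subset n)) λ Xs → Decycling k A Xs × P (length Xs)

Forces : ℕ → ℕ → (ℕ → Set) → Set
Forces k n P = Σ (Digraph n) λ A → Oriented A × ((Xs : List (Subset n)) → Decycling k A Xs → P (length Xs))

Achieves-restrict : ∀ {k n} r P → Achieves k (n + r) P → Achieves k n P
Achieves-restrict {k} r P ub A or with ub (pad r A) (pad-oriented r or)
... | Xs , dec , p = List.map (restrict r) Xs , decycling-restrict r k (pad r A) A (pad-↑ˡ r A) Xs dec ,
  subst P (sym (Listₚ.length-map _ Xs)) p

Forces-pad : ∀ {k n} r P → Forces k n P → Forces k (n + r) P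
Forces-pad {k} r P (A , or , lb) = pad r A , pad-oriented r or , λ Xs dec →
  subst P (Listₚ.length-map _ Xs) (lb (List.map (restrict r) Xs) (decycling-restrict r k (pad r A) A (pad-↑ˡ r A) Xs dec))

-- Scores in acyclic digraphs

sumₗ-strict : {A : Set} {L : List A} {F G : A → ℕ} → (∀ {x} → x ∈ L → F x ≤ G x) →
  ∀ {x} → x ∈ L → F x ℕ.< G x → sumₗ L F ℕ.< sumₗ L G
sumₗ-strict {L = x ∷ L} le (here refl) lt = ℕₚ.+-mono-<-≤ lt (sumₗ-mono L (le ∘ there))
sumₗ-strict {L = x ∷ L} le (there p) lt = ℕₚ.+-mono-≤-< (le (here refl)) (sumₗ-strict (le ∘ there) p lt)

score : ∀ {n} → Digraph n → List (Fin n) → Fin n → ℕ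
score R L x = sumₗ L (λ y → ⟦ R x y ⟧)

TotalOn : ∀ {n} → Digraph n → List (Fin n) → Set
TotalOn R L = ∀ {x y} → x ∈ L → y ∈ L → x ≢ y → R x y ≡ true ⊎ R y x ≡ true

-- Totality and acyclicity make `R` transitive on `L`, so every out-neighbour of `y` is one of `x`;
-- `y` itself makes the inclusion strict.
score-decreasing : ∀ {n} (R : Digraph n) (L : List (Fin n)) → Acyclic R → TotalOn R L →
  ∀ {x y} → x ∈ L → y ∈ L → R x y ≡ true → score R L y ℕ.< score R L x
score-decreasing R L ac tot {x} {y} x∈ y∈ xy = sumₗ-strict pointwise y∈ strict
  where
  pointwise : ∀ {z} → z ∈ L → ⟦ R y z ⟧ ≤ ⟦ R x z ⟧
  pointwise {z} z∈ with R y z in yz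
  ... | false = z≤n
  ... | true with tot x∈ z∈ (λ { refl → ac x (xy ∷ʷ arc yz) })
  ... | inj₁ xz rewrite xz = ℕₚ.≤-refl
  ... | inj₂ zx = ⊥-elim (ac x (xy ∷ʷ (yz ∷ʷ arc zx)))
  strict : ⟦ R y y ⟧ ℕ.< ⟦ R x y ⟧
  strict rewrite xy with R y y in yy
  ... | true = ⊥-elim (ac y (arc yy))
  ... | false = s≤s z≤n

score<length : ∀ {n} (R : Digraph n) (L : List (Fin n)) → Acyclic R → ∀ {x} → x ∈ L → score R L x ℕ.< length L
score<length R L ac {x} x∈ = subst (score R L x ℕ.<_) (trans (sumₗ-const L 1) (ℕₚ.*-identityʳ _))
  (sumₗ-strict (λ {y} _ → ⟦⟧≤1 (R x y)) x∈ strict)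
  where
  strict : ⟦ R x x ⟧ ℕ.< 1
  strict with R x x in xx
  ... | true = ⊥-elim (ac x (arc xx))
  ... | false = s≤s z≤n

-- An acyclic tournament is a linear order, and out-degrees recover it. As scores are below
-- `length L`, the order becomes one of finitely many rankings, which permits a union bound.
score-represents : ∀ {n} (R : Digraph n) (L : List (Fin n)) → Acyclic R → TotalOn R L →
  ∀ {x y} → x ∈ L → y ∈ L → x ≢ y → R x y ≡ (score R L y <ᵇ score R L x)
score-represents R L ac tot {x} {y} x∈ y∈ x≢y with R x y in xy
... | true = sym (<ᵇ-true (score-decreasing R L ac tot x∈ y∈ xy))
... | false with tot x∈ y∈ x≢y
... | inj₁ xy' = ⊥-elim (true≢false (trans (sym xy') xy))
... | inj₂ yx = sym (<ᵇ-false (ℕₚ.<⇒≤ (score-decreasing R L ac tot y∈ x∈ yx)))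

-- Blow-ups of tournaments

elems : ∀ {n} → Subset n → List (Fin n)
elems [] = []
elems (true ∷ X) = zero ∷ List.map suc (elems X)
elems (false ∷ X) = List.map suc (elems X)

sumₗ-map : {A B : Set} (g : A → B) (L : List A) (F : B → ℕ) → sumₗ (List.map g L) F ≡ sumₗ L (F ∘ g)
sumₗ-map g [] F = refl
sumₗ-map g (x ∷ L) F = cong (F (g x) +_) (sumₗ-map g L F)

sum-elems : ∀ {n} (X : Subset n) (F : Fin n → ℕ) → sum (λ u → ⟦ lookup X u ⟧ * F u) ≡ sumₗ (elems X) F
sum-elems [] F = refl
sum-elems (true ∷ X) F = cong₂ _+_ (ℕₚ.*-identityˡ _) (trans (sum-elems X (F ∘ suc)) (sym (sumₗ-map suc (elems X) F)))
sum-elems (false ∷ X) F = trans (sum-elems X (F ∘ suc)) (sym (sumₗ-map suc (elems X) F))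

length-elems : ∀ {n} (X : Subset n) → length (elems X) ≡ ∣ X ∣
length-elems [] = refl
length-elems (true ∷ X) = cong suc (trans (Listₚ.length-map suc (elems X)) (length-elems X))
length-elems (false ∷ X) = trans (Listₚ.length-map suc (elems X)) (length-elems X)

sum₂-elems : ∀ {n} (X : Subset n) (w : Fin n → Fin n → ℕ) →
  sum (λ u → sum (λ v → ⟦ lookup X u ⟧ * ⟦ lookup X v ⟧ * w u v)) ≡ sumₗ (elems X) (λ u → sumₗ (elems X) (w u))
sum₂-elems X w = trans
  (sum-cong λ u → trans (sum-cong λ v → ℕₚ.*-assoc ⟦ lookup X u ⟧ ⟦ lookup X v ⟧ (w u v))
    (trans (sum-*ˡ ⟦ lookup X u ⟧ (λ v → ⟦ lookup X v ⟧ * w u v)) (cong (⟦ lookup X u ⟧ *_) (sum-elems X (w u)))))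
  (sum-elems X (λ u → sumₗ (elems X) (w u)))

sumₗ≤length : {A : Set} (L : List A) {F : A → ℕ} → (∀ x → F x ≤ 1) → sumₗ L F ≤ length L
sumₗ≤length [] le = z≤n
sumₗ≤length (x ∷ L) le = ℕₚ.+-mono-≤ (le x) (sumₗ≤length L le)

+-tight : ∀ {a b c d} → a ≤ b → c ≤ d → b + d ≤ a + c → b ≤ a × d ≤ c
+-tight {a} {b} {c} {d} a≤b c≤d le =
  ℕₚ.+-cancelʳ-≤ d b a (ℕₚ.≤-trans le (ℕₚ.+-monoʳ-≤ a c≤d)) , ℕₚ.+-cancelˡ-≤ b d c (ℕₚ.≤-trans le (ℕₚ.+-monoˡ-≤ c a≤b))

sumₗ-tight : {A : Set} (L : List A) {F : A → ℕ} → (∀ x → F x ≤ 1) → length L ≤ sumₗ L F → All (λ x → 1 ≤ F x) L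
sumₗ-tight [] le t = []
sumₗ-tight (x ∷ L) le t with +-tight (le x) (sumₗ≤length L le) t
... | p , q = p ∷ sumₗ-tight L le q

Antisymmetric : {A : Set} → (A → A → Bool) → Set
Antisymmetric w = ∀ x y → ⟦ w x y ⟧ + ⟦ w y x ⟧ ≤ 1

arcs-within : {A : Set} → (A → A → Bool) → List A → ℕ
arcs-within w L = sumₗ L (λ x → sumₗ L (λ y → ⟦ w x y ⟧))

-- Antisymmetry at `x x` excludes a loop, so no diagonal term appears.
arcs-within-∷ : {A : Set} (w : A → A → Bool) → Antisymmetric w → ∀ x L →
  arcs-within w (x ∷ L) ≡ sumₗ L (λ y → ⟦ w x y ⟧ + ⟦ w y x ⟧) + arcs-within w L
arcs-within-∷ w anti x L rewrite sumₗ-+ L (λ y → ⟦ w y x ⟧) (λ y → sumₗ L (λ z → ⟦ w y z ⟧))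
  | sumₗ-+ L (λ y → ⟦ w x y ⟧) (λ y → ⟦ w y x ⟧) with w x x | anti x x
... | false | _ = sym (ℕₚ.+-assoc (sumₗ L (λ y → ⟦ w x y ⟧)) _ _)
... | true | s≤s ()

arcs-within≤tri : {A : Set} (w : A → A → Bool) → Antisymmetric w → ∀ L → arcs-within w L ≤ tri (length L)
arcs-within≤tri w anti [] = z≤n
arcs-within≤tri w anti (x ∷ L) = subst (_≤ tri (suc (length L))) (sym (arcs-within-∷ w anti x L))
  (ℕₚ.+-mono-≤ (sumₗ≤length L (anti x)) (arcs-within≤tri w anti L))

-- Equality in `arcs-within≤tri` must hold row by row. This is the extremal case of a set that
-- reverses all its pairs.
arcs-within-tight : {A : Set} (w : A → A → Bool) → Antisymmetric w → ∀ L → tri (length L) ≤ arcs-within w L →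
  AllPairs (λ x y → 1 ≤ ⟦ w x y ⟧ + ⟦ w y x ⟧) L
arcs-within-tight w anti [] t = []
arcs-within-tight w anti (x ∷ L) t
  with +-tight (sumₗ≤length L (anti x)) (arcs-within≤tri w anti L) (subst (tri (suc (length L)) ≤_) (arcs-within-∷ w anti x L) t)
... | p , q = sumₗ-tight L (anti x) p ∷ arcs-within-tight w anti L q

AllPairs-∈ : {A : Set} {P : A → A → Set} → (∀ {x y} → P x y → P y x) → ∀ {L} → AllPairs P L →
  ∀ {x y} → x ∈ L → y ∈ L → x ≢ y → P x y
AllPairs-∈ sm (p ∷ ps) (here refl) (here refl) x≢y = ⊥-elim (x≢y refl)
AllPairs-∈ sm (p ∷ ps) (here refl) (there y∈) x≢y = All.lookup p y∈
AllPairs-∈ sm (p ∷ ps) (there x∈) (here refl) x≢y = sm (All.lookup p x∈)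
AllPairs-∈ sm (p ∷ ps) (there x∈) (there y∈) x≢y = AllPairs-∈ sm ps x∈ y∈ x≢y

tri-mono : ∀ {m n} → m ≤ n → tri m ≤ tri n
tri-mono {zero} _ = z≤n
tri-mono (s≤s p) = ℕₚ.+-mono-≤ p (tri-mono p)

-- The bound on `n` excludes `tri 0 = tri 1`.
tri-strict : ∀ {m n} → 2 ≤ n → m ℕ.< n → tri m ℕ.< tri n
tri-strict {m} {suc (suc n)} (s≤s (s≤s _)) (s≤s p) = ℕₚ.≤-trans (s≤s (tri-mono p)) (s≤s (ℕₚ.m≤n+m (tri (suc n)) n))

Tournament : ∀ {m} → Digraph m → Set
Tournament T = ∀ i j → i ≢ j → T i j ≡ true ⊎ T j i ≡ true

-- A ranking orients a pair from the larger value to the smaller, as scores do.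
disagreements : ∀ {m} → Digraph m → (Fin m → ℕ) → ℕ
disagreements T s = sum< (λ i j → ⟦ T i j xor (s j <ᵇ s i) ⟧)

part : ∀ m q → Fin (m * q) → Fin m
part m q u = proj₁ (Fin.remQuot {m} q u)

part-combine : ∀ {m q} (i : Fin m) (a : Fin q) → part m q (combine i a) ≡ i
part-combine i a = cong proj₁ (Finₚ.remQuot-combine i a)

blowup : ∀ {m} q → Digraph m → Digraph (m * q)
blowup {m} q T u v = T (part m q u) (part m q v)

-- Ordering by part index counts each pair once, which is the antisymmetry behind the bound `tri k`
-- for one set, and leaves out the pairs within a part.
reversed : ∀ {m} q → Digraph m → Digraph (m * q) → Fin (m * q) → Fin (m * q) → Bool
reversed {m} q T R u v = (part m q u <?ᶠ part m q v) ∧ (blowup q T u v xor R u v)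

sum-transversal-pairs : ∀ m q (W : Fin (m * q) → Fin (m * q) → ℕ) →
  sum< {m} (λ i j → sum (λ a → sum (λ b → W (combine i a) (combine j b))))
  ≡ sum (λ u → sum (λ v → ⟦ part m q u <?ᶠ part m q v ⟧ * W u v))
sum-transversal-pairs m q W = trans (sum<≡sum D) (trans (sum-cong row)
    (sym (sum-combine m (λ u → sum (λ v → ⟦ part m q u <?ᶠ part m q v ⟧ * W u v)))))
  where
  D : Fin m → Fin m → ℕ
  D i j = sum (λ a → sum (λ b → W (combine i a) (combine j b)))
  row : ∀ i → sum (λ j → ⟦ i <?ᶠ j ⟧ * D i j)
    ≡ sum (λ a → sum (λ v → ⟦ part m q (combine i a) <?ᶠ part m q v ⟧ * W (combine i a) v))
  row i = begin
    sum (λ j → ⟦ i <?ᶠ j ⟧ * D i j)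
      ≡⟨ sum-cong (λ j → sym (sum-*ˡ ⟦ i <?ᶠ j ⟧ (λ a → sum (λ b → W (combine i a) (combine j b))))) ⟩
    sum (λ j → sum (λ a → ⟦ i <?ᶠ j ⟧ * sum (λ b → W (combine i a) (combine j b))))
      ≡⟨ sum-swap (λ j a → ⟦ i <?ᶠ j ⟧ * sum (λ b → W (combine i a) (combine j b))) ⟩
    sum (λ a → sum (λ j → ⟦ i <?ᶠ j ⟧ * sum (λ b → W (combine i a) (combine j b))))
      ≡⟨ sum-cong (λ a → trans (sum-cong (λ j → cell a j)) (sym (sum-combine m (λ v → ⟦ part m q (combine i a) <?ᶠ part m q v ⟧ * W (combine i a) v)))) ⟩
    sum (λ a → sum (λ v → ⟦ part m q (combine i a) <?ᶠ part m q v ⟧ * W (combine i a) v)) ∎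
    where
    open Relation.Binary.PropositionalEquality.≡-Reasoning
    cell : ∀ a j → ⟦ i <?ᶠ j ⟧ * sum (λ b → W (combine i a) (combine j b))
      ≡ sum (λ b → ⟦ part m q (combine i a) <?ᶠ part m q (combine j b) ⟧ * W (combine i a) (combine j b))
    cell a j = trans (sym (sum-*ˡ ⟦ i <?ᶠ j ⟧ (λ b → W (combine i a) (combine j b))))
      (sum-cong λ b → cong₂ (λ x y → ⟦ x <?ᶠ y ⟧ * W (combine i a) (combine j b)) (sym (part-combine i a)) (sym (part-combine j b)))

blowup-total : ∀ {m} q {T : Digraph m} → Tournament T → ∀ Xs u v → part m q u ≢ part m q v →
  invertAll Xs (blowup q T) u v ≡ true ⊎ invertAll Xs (blowup q T) v u ≡ true
blowup-total {m} q {T} tour Xs u v ne rewrite invertAll-flip Xs (blowup q T) u v | invertAll-flip Xs (blowup q T) v u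
  | flip-sym Xs v u with flip Xs u v | tour (part m q u) (part m q v) ne
... | false | t = t
... | true | inj₁ t = inj₂ t
... | true | inj₂ t = inj₁ t

module _ where
  open ℕₚ.≤-Reasoning

  -- Every transversal has at least `d` reversed pairs because its scores form a ranking of `T`.
  -- Applied to a transversal with at most the average number, this bounds the average from below;
  -- the other side is a double count over the sets and the reversed pairs they contain.
  blowup-count : ∀ {m} q d B {T : Digraph m} → Tournament T →
    (∀ s → (∀ i → s i ℕ.< m) → d ≤ disagreements T s) →
    ∀ Xs → Acyclic (invertAll Xs (blowup (suc q) T)) →
    All (λ X → arcs-within (reversed (suc q) T (invertAll Xs (blowup (suc q) T))) (elems X) ≤ B) Xs →
    suc q * suc q * d ≤ length Xs * B
  blowup-count {m} q d B {T} tour far Xs ac small = begin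
    Q * Q * d ≤⟨ ℕₚ.*-monoʳ-≤ (Q * Q) d≤ ⟩
    Q * Q * sum< (λ i j → W (vtx i) (vtx j)) ≤⟨ proj₂ choice ⟩
    sum< {m} (λ i j → sum (λ a → sum (λ b → W (combine i a) (combine j b)))) ≡⟨ sum-transversal-pairs m Q W ⟩
    sum (λ u → sum (λ v → ⟦ part m Q u <?ᶠ part m Q v ⟧ * W u v)) ≤⟨ sum-mono (λ u → sum-mono (λ v → covered u v)) ⟩
    sum (λ u → sum (λ v → sumₗ Xs (λ X → ⟦ lookup X u ⟧ * ⟦ lookup X v ⟧ * ⟦ rev u v ⟧)))
      ≡⟨ sum-cong (λ u → sym (sumₗ-swap Xs (λ X v → ⟦ lookup X u ⟧ * ⟦ lookup X v ⟧ * ⟦ rev u v ⟧))) ⟩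
    sum (λ u → sumₗ Xs (λ X → sum (λ v → ⟦ lookup X u ⟧ * ⟦ lookup X v ⟧ * ⟦ rev u v ⟧)))
      ≡⟨ sumₗ-swap Xs (λ X u → sum (λ v → ⟦ lookup X u ⟧ * ⟦ lookup X v ⟧ * ⟦ rev u v ⟧)) ⟨
    sumₗ Xs (λ X → sum (λ u → sum (λ v → ⟦ lookup X u ⟧ * ⟦ lookup X v ⟧ * ⟦ rev u v ⟧)))
      ≡⟨ sumₗ-cong Xs (λ X → sum₂-elems X (λ u v → ⟦ rev u v ⟧)) ⟩
    sumₗ Xs (λ X → arcs-within rev (elems X)) ≤⟨ sumₗ-mono Xs (All.lookup small) ⟩
    sumₗ Xs (λ _ → B) ≡⟨ sumₗ-const Xs B ⟩
    length Xs * B ∎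
    where
    Q = suc q
    A = blowup Q T
    R = invertAll Xs A
    rev = reversed Q T R
    W : Fin (m * Q) → Fin (m * Q) → ℕ
    W u v = ⟦ A u v xor R u v ⟧
    choice = transversal (λ i j a b → W (combine i a) (combine j b))
    vtx : Fin m → Fin (m * Q)
    vtx i = combine i (proj₁ choice i)
    L = List.tabulate vtx
    vtx∈ : ∀ i → vtx i ∈ L
    vtx∈ = ∈ₚ.∈-tabulate⁺
    part-vtx : ∀ i → part m Q (vtx i) ≡ i
    part-vtx i = part-combine i (proj₁ choice i)
    tot : TotalOn R L
    tot x∈ y∈ x≢y with ∈ₚ.∈-tabulate⁻ x∈ | ∈ₚ.∈-tabulate⁻ y∈
    ... | i , refl | j , refl = blowup-total Q tour Xs (vtx i) (vtx j)
      λ eq → x≢y (cong vtx (trans (sym (part-vtx i)) (trans eq (part-vtx j))))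
    s : Fin m → ℕ
    s i = score R L (vtx i)
    d≤ : d ≤ sum< (λ i j → W (vtx i) (vtx j))
    d≤ = ℕₚ.≤-trans (far s (λ i → subst (s i ℕ.<_) (Listₚ.length-tabulate vtx) (score<length R L ac (vtx∈ i))))
      (ℕₚ.≤-reflexive (sum<-cong λ i j i<j → cong ⟦_⟧ (cong₂ _xor_ (cong₂ T (sym (part-vtx i)) (sym (part-vtx j)))
        (sym (score-represents R L ac tot (vtx∈ i) (vtx∈ j)
          λ eq → ℕₚ.<⇒≢ i<j (cong toℕ (trans (sym (part-vtx i)) (trans (cong (part m Q) eq) (part-vtx j)))))))))
    -- A pair whose direction changed lies in an odd number of the sets, hence in at least one.
    covered : ∀ u v → ⟦ part m Q u <?ᶠ part m Q v ⟧ * W u v ≤ sumₗ Xs (λ X → ⟦ lookup X u ⟧ * ⟦ lookup X v ⟧ * ⟦ rev u v ⟧)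
    covered u v with part m Q u <?ᶠ part m Q v
    ... | false = z≤n
    ... | true with A u v xor R u v in eq
    ... | false = z≤n
    ... | true = begin
      1 ≡⟨ cong ⟦_⟧ flipped ⟨
      ⟦ flip Xs u v ⟧ ≤⟨ flip≤ Xs u v ⟩
      sumₗ Xs (λ X → ⟦ lookup X u ⟧ * ⟦ lookup X v ⟧) ≡⟨ sumₗ-cong Xs (λ X → sym (ℕₚ.*-identityʳ _)) ⟩
      sumₗ Xs (λ X → ⟦ lookup X u ⟧ * ⟦ lookup X v ⟧ * 1) ∎
      where
      flipped : flip Xs u v ≡ true
      flipped with flip Xs u v | invertAll-flip Xs A u v
      ... | true | _ = refl
      ... | false | e rewrite e = ⊥-elim (true≢false (trans (sym eq) (Boolₚ.xor-same (A u v))))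

<ᵇ-antisym : ∀ m n → ⟦ m <ᵇ n ⟧ + ⟦ n <ᵇ m ⟧ ≤ 1
<ᵇ-antisym zero zero = z≤n
<ᵇ-antisym zero (suc n) = ℕₚ.≤-refl
<ᵇ-antisym (suc m) zero = ℕₚ.≤-refl
<ᵇ-antisym (suc m) (suc n) = <ᵇ-antisym m n

⟦∧⟧≤ : ∀ a b → ⟦ a ∧ b ⟧ ≤ ⟦ a ⟧
⟦∧⟧≤ true b = ⟦⟧≤1 b
⟦∧⟧≤ false b = z≤n

reversed-antisym : ∀ {m} q (T : Digraph m) R → Antisymmetric (reversed q T R)
reversed-antisym {m} q T R u v = ℕₚ.≤-trans (ℕₚ.+-mono-≤ (⟦∧⟧≤ (part m q u <?ᶠ part m q v) (blowup q T u v xor R u v)) (⟦∧⟧≤ (part m q v <?ᶠ part m q u) (blowup q T v u xor R v u)))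
  (<ᵇ-antisym (toℕ (part m q u)) (toℕ (part m q v)))

reversed-within≤ : ∀ {m} q k (T : Digraph m) R (X : Subset (m * q)) → ∣ X ∣ ≤ k → arcs-within (reversed q T R) (elems X) ≤ tri k
reversed-within≤ q k T R X le = ℕₚ.≤-trans (arcs-within≤tri (reversed q T R) (reversed-antisym q T R) (elems X))
  (tri-mono (subst (_≤ k) (sym (length-elems X)) le))

-- Lists as vertex sets, and transitive patterns

χ : ∀ {n} → List (Fin n) → Fin n → Bool
χ [] u = false
χ (x ∷ L) u = (x == u) ∨ χ L u

χ⇒∈ : ∀ {n} (L : List (Fin n)) {u} → χ L u ≡ true → u ∈ L
χ⇒∈ (x ∷ L) {u} e with x == u in eq
... | true = here (sym (==⇒≡ eq))
... | false = there (χ⇒∈ L e)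

χ-sum≤ : ∀ {n} (L : List (Fin n)) (F : Fin n → ℕ) → sum (λ u → ⟦ χ L u ⟧ * F u) ≤ sumₗ L F
χ-sum≤ {n} [] F = ℕₚ.≤-reflexive (sum-zero n λ _ → refl)
χ-sum≤ (x ∷ L) F = begin
  sum (λ u → ⟦ (x == u) ∨ χ L u ⟧ * F u)             ≤⟨ sum-mono (λ u → pointwise (x == u) (χ L u) (F u)) ⟩
  sum (λ u → ⟦ x == u ⟧ * F u + ⟦ χ L u ⟧ * F u)      ≡⟨ sum-+ (λ u → ⟦ x == u ⟧ * F u) (λ u → ⟦ χ L u ⟧ * F u) ⟩
  sum (λ u → ⟦ x == u ⟧ * F u) + sum (λ u → ⟦ χ L u ⟧ * F u) ≤⟨ ℕₚ.+-mono-≤ (ℕₚ.≤-reflexive (sum-δ x F)) (χ-sum≤ L F) ⟩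
  F x + sumₗ L F                                     ∎
  where
  open ℕₚ.≤-Reasoning
  pointwise : ∀ a b f → ⟦ a ∨ b ⟧ * f ≤ ⟦ a ⟧ * f + ⟦ b ⟧ * f
  pointwise true b f = ℕₚ.m≤m+n (1 * f) _
  pointwise false b f = ℕₚ.≤-refl

χ-sum≥ : ∀ {n} {L : List (Fin n)} → AllPairs _≢_ L → (F : Fin n → ℕ) → sumₗ L F ≤ sum (λ u → ⟦ χ L u ⟧ * F u)
χ-sum≥ [] F = z≤n
χ-sum≥ {L = x ∷ L} (x∉ ∷ uniq) F = begin
  F x + sumₗ L F                                     ≤⟨ ℕₚ.+-mono-≤ (ℕₚ.≤-reflexive (sym (sum-δ x F))) (χ-sum≥ uniq F) ⟩
  sum (λ u → ⟦ x == u ⟧ * F u) + sum (λ u → ⟦ χ L u ⟧ * F u) ≡⟨ sum-+ (λ u → ⟦ x == u ⟧ * F u) (λ u → ⟦ χ L u ⟧ * F u) ⟨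
  sum (λ u → ⟦ x == u ⟧ * F u + ⟦ χ L u ⟧ * F u)      ≤⟨ sum-mono pointwise ⟩
  sum (λ u → ⟦ (x == u) ∨ χ L u ⟧ * F u)             ∎
  where
  open ℕₚ.≤-Reasoning
  pointwise : ∀ u → ⟦ x == u ⟧ * F u + ⟦ χ L u ⟧ * F u ≤ ⟦ (x == u) ∨ χ L u ⟧ * F u
  pointwise u with x == u in eq | χ L u in eq'
  ... | false | _ = ℕₚ.≤-refl
  ... | true | false = ℕₚ.≤-reflexive (ℕₚ.+-identityʳ _)
  ... | true | true = ⊥-elim (All.lookup x∉ (χ⇒∈ L eq') (==⇒≡ eq))

χ-sum₂≥ : ∀ {n} {L : List (Fin n)} → AllPairs _≢_ L → (w : Fin n → Fin n → Bool) →
  arcs-within w L ≤ sum (λ u → sum (λ v → ⟦ w u v ∧ (χ L u ∧ χ L v) ⟧))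
χ-sum₂≥ {n} {L} uniq w = begin
  sumₗ L (λ x → sumₗ L (λ y → ⟦ w x y ⟧))  ≤⟨ sumₗ-mono L (λ {x} _ → χ-sum≥ uniq (λ y → ⟦ w x y ⟧)) ⟩
  sumₗ L (λ x → sum (λ v → ⟦ χ L v ⟧ * ⟦ w x v ⟧)) ≤⟨ χ-sum≥ uniq _ ⟩
  sum (λ u → ⟦ χ L u ⟧ * sum (λ v → ⟦ χ L v ⟧ * ⟦ w u v ⟧)) ≡⟨ sum-cong (λ u → sum-*ˡ ⟦ χ L u ⟧ (λ v → ⟦ χ L v ⟧ * ⟦ w u v ⟧)) ⟨
  sum (λ u → sum (λ v → ⟦ χ L u ⟧ * (⟦ χ L v ⟧ * ⟦ w u v ⟧))) ≡⟨ sum-cong (λ u → sum-cong (λ v → cell (χ L u) (χ L v) (w u v))) ⟩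
  sum (λ u → sum (λ v → ⟦ w u v ∧ (χ L u ∧ χ L v) ⟧)) ∎
  where
  open ℕₚ.≤-Reasoning
  cell : ∀ a b c → ⟦ a ⟧ * (⟦ b ⟧ * ⟦ c ⟧) ≡ ⟦ c ∧ (a ∧ b) ⟧
  cell false b c = cong ⟦_⟧ (sym (Boolₚ.∧-zeroʳ c))
  cell true false c = cong ⟦_⟧ (sym (Boolₚ.∧-zeroʳ c))
  cell true true true = refl
  cell true true false = refl

arcs-within≥tri : {A : Set} (w : A → A → Bool) → Antisymmetric w → ∀ {L} → AllPairs (λ x y → 1 ≤ ⟦ w x y ⟧ + ⟦ w y x ⟧) L →
  tri (length L) ≤ arcs-within w L
arcs-within≥tri w anti [] = z≤n
arcs-within≥tri w anti {x ∷ L} (p ∷ ps) = subst (tri (suc (length L)) ≤_) (sym (arcs-within-∷ w anti x L)) (ℕₚ.+-mono-≤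
  (subst (_≤ sumₗ L (λ y → ⟦ w x y ⟧ + ⟦ w y x ⟧)) (trans (sumₗ-const L 1) (ℕₚ.*-identityʳ _)) (sumₗ-mono L (All.lookup p)))
  (arcs-within≥tri w anti ps))

<?ᶠ-antisym : ∀ {n} → Antisymmetric (_<?ᶠ_ {n})
<?ᶠ-antisym i j = <ᵇ-antisym (toℕ i) (toℕ j)

<?ᶠ-total : ∀ {n} {i j : Fin n} → i ≢ j → 1 ≤ ⟦ i <?ᶠ j ⟧ + ⟦ j <?ᶠ i ⟧
<?ᶠ-total {i = i} {j} i≢j with ℕₚ.<-cmp (toℕ i) (toℕ j)
... | tri< i<j _ _ rewrite <ᵇ-true i<j = s≤s z≤n
... | tri≈ _ eq _ = ⊥-elim (i≢j (Finₚ.toℕ-injective eq))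
... | tri> _ _ j<i rewrite <ᵇ-true j<i = ℕₚ.m≤n+m 1 _

-- Vertices outside the list get the default 0; `Follows` guards against it with `mem`.
rank : ∀ {m k} → List (Fin m × Fin k) → Fin m → ℕ
rank [] i = 0
rank ((j , r) ∷ c) i = if j == i then toℕ r else rank c i

mem : ∀ {m k} → List (Fin m × Fin k) → Fin m → Bool
mem c = χ (List.map proj₁ c)

-- The pairs (vertex , rank) of c describe a transitive subtournament of T.
Follows : ∀ {m k} → Digraph m → List (Fin m × Fin k) → Set
Follows T c = ∀ i j → toℕ i ℕ.< toℕ j → mem c i ≡ true → mem c j ≡ true → T i j ≡ (rank c i <ᵇ rank c j)

DistinctVertices : ∀ {m k} → List (Fin m × Fin k) → Set
DistinctVertices = AllPairs (λ a b → proj₁ a ≢ proj₁ b)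

one-of : ∀ {a b} → 1 ≤ ⟦ a ⟧ + ⟦ b ⟧ → a ≡ true ⊎ b ≡ true
one-of {true} _ = inj₁ refl
one-of {false} {true} _ = inj₂ refl

∧-true : ∀ {a b} → a ∧ b ≡ true → a ≡ true × b ≡ true
∧-true {true} e = refl , e

module _ where
  private
    ranking : ∀ {n m k} (g : Fin n → Fin m) (ρ : Fin n → Fin k) (L : List (Fin n)) i →
      mem (List.map (λ x → g x , ρ x) L) i ≡ true →
      ∃ λ x → x ∈ L × g x ≡ i × rank (List.map (λ x → g x , ρ x) L) i ≡ toℕ (ρ x)
    ranking g ρ (x ∷ L) i e with g x == i in eq
    ... | true = x , here refl , ==⇒≡ eq , refl
    ... | false with ranking g ρ L i e
    ... | y , y∈ , p , r = y , there y∈ , p , r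

  -- If all pairs of `L` were reversed, `T` on their parts is opposite to the linear order that `R`
  -- induces on `L`, so the scores of `R` increase along the arcs of `T` and can serve as ranks.
  transitive-pattern : ∀ {m} q k {T : Digraph m} → Tournament T → ∀ Xs → Acyclic (invertAll Xs (blowup q T)) →
    ∀ L → length L ≡ suc k →
    let w = reversed q T (invertAll Xs (blowup q T)) in AllPairs (λ x y → 1 ≤ ⟦ w x y ⟧ + ⟦ w y x ⟧) L →
    ∃ λ (c : List (Fin m × Fin (suc k))) → length c ≡ suc k × DistinctVertices c × Follows T c
  transitive-pattern {m} q k {T} tour Xs ac L len good = c , trans (Listₚ.length-map _ L) len , distinct , follows
    where
    A = blowup q T
    R = invertAll Xs A
    w = reversed q T R
    s = score R L
    -- Scores on `L` are below `length L`, so the remainder changes nothing; it only lands in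
    -- `Fin (suc k)`.
    c = List.map (λ x → part m q x , s x DivMod.mod suc k) L
    apart : ∀ {x y} → 1 ≤ ⟦ w x y ⟧ + ⟦ w y x ⟧ → part m q x ≢ part m q y
    apart p eq with one-of p
    ... | inj₁ e = ℕₚ.<⇒≢ (<ᵇ-true⁻¹ (proj₁ (∧-true e))) (cong toℕ eq)
    ... | inj₂ e = ℕₚ.<⇒≢ (<ᵇ-true⁻¹ (proj₁ (∧-true e))) (cong toℕ (sym eq))
    distinct : DistinctVertices c
    distinct = AllPairsₚ.map⁺ (AllPairs.map apart good)
    good∈ : ∀ {x y} → x ∈ L → y ∈ L → x ≢ y → 1 ≤ ⟦ w x y ⟧ + ⟦ w y x ⟧
    good∈ = AllPairs-∈ (λ {x} {y} p → subst (1 ≤_) (ℕₚ.+-comm ⟦ w x y ⟧ ⟦ w y x ⟧) p) good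
    tot : TotalOn R L
    tot {x} {y} x∈ y∈ x≢y = blowup-total q tour Xs x y (apart (good∈ x∈ y∈ x≢y))
    mod-score : ∀ {x} → x ∈ L → toℕ (s x DivMod.mod suc k) ≡ s x
    mod-score {x} x∈ = trans (Finₚ.toℕ-fromℕ< _)
      (DivMod.m<n⇒m%n≡m (subst (s x ℕ.<_) len (score<length R L ac x∈)))
    follows : Follows T c
    follows i j i<j mi mj with ranking (part m q) (λ x → s x DivMod.mod suc k) L i mi
      | ranking (part m q) (λ x → s x DivMod.mod suc k) L j mj
    ... | x , x∈ , refl , rx | y , y∈ , refl , ry = trans (opposite (one-of (good∈ x∈ y∈ x≢y)))
        (cong₂ _<ᵇ_ (sym (trans rx (mod-score x∈))) (sym (trans ry (mod-score y∈))))
      where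
      x≢y : x ≢ y
      x≢y refl = ℕₚ.<-irrefl refl i<j
      opposite : w x y ≡ true ⊎ w y x ≡ true → A x y ≡ (s x <ᵇ s y)
      opposite (inj₂ e) = ⊥-elim (ℕₚ.<-asym i<j (<ᵇ-true⁻¹ (proj₁ (∧-true e))))
      opposite (inj₁ e) with A x y | R x y in xy | proj₂ (∧-true {part m q x <?ᶠ part m q y} e)
      ... | true | false | _ with tot x∈ y∈ x≢y
      ... | inj₁ xy' = ⊥-elim (true≢false (trans (sym xy') xy))
      ... | inj₂ yx = sym (<ᵇ-true (score-decreasing R L ac tot y∈ x∈ yx))
      opposite (inj₁ e) | true | true | ()
      opposite (inj₁ e) | false | false | ()
      opposite (inj₁ e) | false | true | _ = sym (<ᵇ-false (ℕₚ.<⇒≤ (score-decreasing R L ac tot x∈ y∈ xy)))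

-- Only a set of full size can attain `tri (suc k)`, and attaining it makes all its pairs reversed,
-- which yields a forbidden pattern.
reversed-within< : ∀ {m} q k {T : Digraph m} → 1 ≤ k → Tournament T →
  (∀ (c : List (Fin m × Fin (suc k))) → length c ≡ suc k → DistinctVertices c → ¬ Follows T c) →
  ∀ Xs → Acyclic (invertAll Xs (blowup q T)) → ∀ X → ∣ X ∣ ≤ suc k →
  arcs-within (reversed q T (invertAll Xs (blowup q T))) (elems X) ≤ tri (suc k) ∸ 1
reversed-within< q k {T} 1≤k tour avoid Xs ac X small with ℕₚ.m≤n⇒m<n∨m≡n (reversed-within≤ q (suc k) T (invertAll Xs (blowup q T)) X small)
... | inj₁ lt = ℕₚ.∸-monoˡ-≤ 1 lt
... | inj₂ eq with ℕₚ.m≤n⇒m<n∨m≡n small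
... | inj₁ lt = ⊥-elim (ℕₚ.<⇒≱ (tri-strict (s≤s 1≤k) lt)
    (subst (_≤ _) eq (reversed-within≤ q _ T (invertAll Xs (blowup q T)) X ℕₚ.≤-refl)))
... | inj₂ full with transitive-pattern q k tour Xs ac (elems X) (trans (length-elems X) full)
  (arcs-within-tight _ (reversed-antisym q T _) (elems X)
    (ℕₚ.≤-reflexive (trans (cong tri (trans (length-elems X) full)) (sym eq))))
... | c , len , distinct , follows = ⊥-elim (avoid c len distinct follows)

-- Random tournaments

prod : ∀ {n} → (Fin n → ℕ) → ℕ
prod {zero} f = 1
prod {suc n} f = f zero * prod (f ∘ suc)

-- Method of conditional expectations: each bit is chosen so as not to increase the weighted sum.
derandomize : ∀ {C : Set} L h (cs : List C) (W : C → ℕ) (φ : C → Fin L → Bool → ℕ) →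
  (∀ c p → φ c p false + φ c p true ≡ h + h) →
  ∃ λ (t : Fin L → Bool) → sumₗ cs (λ c → W c * prod (λ p → φ c p (t p))) ≤ sumₗ cs W * h ^ L
derandomize zero h cs W φ eq = (λ ()) , ℕₚ.≤-reflexive
  (trans (sumₗ-cong cs (λ c → ℕₚ.*-identityʳ (W c))) (sym (ℕₚ.*-identityʳ _)))
derandomize {C} (suc L) h cs W φ eq = t , (begin
  sumₗ cs (λ c → W c * (φ c zero b * prod (λ p → φ c (suc p) (t (suc p)))))
    ≡⟨ sumₗ-cong cs (λ c → sym (ℕₚ.*-assoc (W c) (φ c zero b) _)) ⟩
  sumₗ cs (λ c → W' b c * prod (λ p → φ c (suc p) (t (suc p)))) ≤⟨ proj₂ rest ⟩
  sumₗ cs (W' b) * h ^ L        ≤⟨ ℕₚ.*-monoˡ-≤ (h ^ L) (proj₂ choice) ⟩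
  sumₗ cs W * h * h ^ L         ≡⟨ ℕₚ.*-assoc (sumₗ cs W) h (h ^ L) ⟩
  sumₗ cs W * (h * h ^ L)       ∎)
  where
  open ℕₚ.≤-Reasoning
  W' : Bool → C → ℕ
  W' b c = W c * φ c zero b
  both : sumₗ cs (W' false) + sumₗ cs (W' true) ≡ sumₗ cs W * h + sumₗ cs W * h
  both = begin-equality
    sumₗ cs (W' false) + sumₗ cs (W' true) ≡⟨ sumₗ-+ cs (W' false) (W' true) ⟨
    sumₗ cs (λ c → W' false c + W' true c) ≡⟨ sumₗ-cong cs (λ c → trans (sym (ℕₚ.*-distribˡ-+ (W c) _ _))
      (trans (cong (W c *_) (eq c zero)) (ℕₚ.*-comm (W c) (h + h)))) ⟩
    sumₗ cs (λ c → (h + h) * W c) ≡⟨ sumₗ-*ˡ cs (h + h) W ⟩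
    (h + h) * sumₗ cs W ≡⟨ ℕₚ.*-comm (h + h) _ ⟩
    sumₗ cs W * (h + h) ≡⟨ ℕₚ.*-distribˡ-+ (sumₗ cs W) h h ⟩
    sumₗ cs W * h + sumₗ cs W * h ∎
  choice : ∃ λ b → sumₗ cs (W' b) ≤ sumₗ cs W * h
  choice with ℕₚ.≤-total (sumₗ cs (W' false)) (sumₗ cs W * h)
  ... | inj₁ le = false , le
  ... | inj₂ ge = true , ℕₚ.+-cancelˡ-≤ (sumₗ cs W * h) _ _
    (ℕₚ.≤-trans (ℕₚ.+-monoˡ-≤ _ ge) (ℕₚ.≤-reflexive both))
  b = proj₁ choice
  rest = derandomize L h cs (W' b) (λ c p → φ c (suc p)) (λ c p → eq c (suc p))
  t : Fin (suc L) → Bool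
  t zero = b
  t (suc p) = proj₁ rest p

-- Factors of an exponential moment: `hi` for agreement, `lo` for disagreement, `h` off the relevant
-- positions. With `hi + lo = h + h` a uniform bit multiplies the weight of any candidate by `h` on
-- average.
factor : (hi lo h : ℕ) → (relevant differs : Bool) → ℕ
factor hi lo h true true = lo
factor hi lo h true false = hi
factor hi lo h false _ = h

factor-sum : ∀ hi lo h rel tgt → hi + lo ≡ h + h → factor hi lo h rel (false xor tgt) + factor hi lo h rel (true xor tgt) ≡ h + h
factor-sum hi lo h true true eq = trans (ℕₚ.+-comm lo hi) eq
factor-sum hi lo h true false eq = eq
factor-sum hi lo h false tgt eq = refl

prod-factor : ∀ {L} hi lo h (rel x : Fin L → Bool) → prod (λ p → factor hi lo h (rel p) (x p))
  ≡ hi ^ sum (λ p → ⟦ rel p ∧ not (x p) ⟧) * lo ^ sum (λ p → ⟦ rel p ∧ x p ⟧) * h ^ sum (λ p → ⟦ not (rel p) ⟧)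
prod-factor {zero} hi lo h rel x = refl
prod-factor {suc L} hi lo h rel x = trans (cong (factor hi lo h (rel zero) (x zero) *_) (prod-factor hi lo h (rel ∘ suc) (x ∘ suc)))
  (step (rel zero) (x zero) (sum (λ p → ⟦ rel (suc p) ∧ not (x (suc p)) ⟧)) (sum (λ p → ⟦ rel (suc p) ∧ x (suc p) ⟧)) (sum (λ p → ⟦ not (rel (suc p)) ⟧)))
  where
  hi* : ∀ f a b c → f * (a * b * c) ≡ f * a * b * c
  hi* = solve-∀
  lo* : ∀ f a b c → f * (a * b * c) ≡ a * (f * b) * c
  lo* = solve-∀
  h* : ∀ f a b c → f * (a * b * c) ≡ a * b * (f * c)
  h* = solve-∀
  step : ∀ r y a b c → factor hi lo h r y * (hi ^ a * lo ^ b * h ^ c)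
    ≡ hi ^ (⟦ r ∧ not y ⟧ + a) * lo ^ (⟦ r ∧ y ⟧ + b) * h ^ (⟦ not r ⟧ + c)
  step true true a b c = lo* lo (hi ^ a) (lo ^ b) (h ^ c)
  step true false a b c = hi* hi (hi ^ a) (lo ^ b) (h ^ c)
  step false _ a b c = h* h (hi ^ a) (lo ^ b) (h ^ c)

relevant-split : ∀ {L} (rel x : Fin L → Bool) → sum (λ p → ⟦ rel p ∧ not (x p) ⟧) + sum (λ p → ⟦ rel p ∧ x p ⟧) ≡ sum (λ p → ⟦ rel p ⟧)
relevant-split rel x = trans (sym (sum-+ (λ p → ⟦ rel p ∧ not (x p) ⟧) _)) (sum-cong (λ p → cell (rel p) (x p)))
  where
  cell : ∀ a b → ⟦ a ∧ not b ⟧ + ⟦ a ∧ b ⟧ ≡ ⟦ a ⟧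
  cell true true = refl
  cell true false = refl
  cell false b = refl

relevant-total : ∀ {L} (rel : Fin L → Bool) → sum (λ p → ⟦ rel p ⟧) + sum (λ p → ⟦ not (rel p) ⟧) ≡ L
relevant-total {L} rel = trans (sym (sum-+ (λ p → ⟦ rel p ⟧) _))
  (trans (sum-cong (λ p → cell (rel p))) (trans (sum-const L 1) (ℕₚ.*-identityʳ L)))
  where
  cell : ∀ a → ⟦ a ⟧ + ⟦ not a ⟧ ≡ 1
  cell true = refl
  cell false = refl

^-distribʳ-* : ∀ n a b → (a * b) ^ n ≡ a ^ n * b ^ n
^-distribʳ-* zero a b = refl
^-distribʳ-* (suc n) a b = trans (cong (a * b *_) (^-distribʳ-* n a b)) (lem a b (a ^ n) (b ^ n))
  where
  lem : ∀ a b c d → a * b * (c * d) ≡ a * c * (b * d)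
  lem = solve-∀

-- Bernoulli's inequality (1 - 1/y)ⁿ ≥ 1 - n/y with y = z + 1 and n + r = y.
bernoulli⁻ : ∀ z n r → n + r ≡ suc z → suc z ^ n * r ≤ z ^ n * suc z
bernoulli⁻ z zero r refl = ℕₚ.≤-refl
bernoulli⁻ z (suc n) r eq = begin
  suc z * suc z ^ n * r       ≡⟨ lem₁ z (suc z ^ n) r ⟩
  suc z ^ n * (r + z * r)     ≤⟨ ℕₚ.*-monoʳ-≤ (suc z ^ n) (ℕₚ.+-monoˡ-≤ (z * r) r≤z) ⟩
  suc z ^ n * (z + z * r)     ≡⟨ lem₂ z (suc z ^ n) r ⟩
  z * (suc z ^ n * suc r)     ≤⟨ ℕₚ.*-monoʳ-≤ z (bernoulli⁻ z n (suc r) (trans (ℕₚ.+-suc n r) eq)) ⟩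
  z * (z ^ n * suc z)         ≡⟨ ℕₚ.*-assoc z (z ^ n) (suc z) ⟨
  z * z ^ n * suc z           ∎
  where
  open ℕₚ.≤-Reasoning
  r≤z : r ≤ z
  r≤z = subst (r ≤_) (ℕₚ.suc-injective eq) (ℕₚ.m≤n+m r n)
  lem₁ : ∀ z a r → suc z * a * r ≡ a * (r + z * r)
  lem₁ = solve-∀
  lem₂ : ∀ z a r → a * (z + z * r) ≡ z * (a * suc r)
  lem₂ = solve-∀

-- Bernoulli's inequality for `(1 + 1/a) ^ n`, multiplied by `a ^ suc n` to stay in ℕ.
bernoulli⁺ : ∀ a n → a ^ n * (a + n) ≤ suc a ^ n * a
bernoulli⁺ a zero = ℕₚ.≤-reflexive (cong (1 *_) (ℕₚ.+-identityʳ a))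
bernoulli⁺ a (suc n) = begin
  a * a ^ n * (a + suc n)          ≡⟨ lem₁ a (a ^ n) n ⟩
  a ^ n * (a * suc (a + n))        ≤⟨ ℕₚ.*-monoʳ-≤ (a ^ n) (ℕₚ.≤-trans (ℕₚ.m≤m+n _ n) (ℕₚ.≤-reflexive (lem₂ a n))) ⟩
  a ^ n * (suc a * (a + n))        ≡⟨ lem₃ a (a ^ n) n ⟩
  suc a * (a ^ n * (a + n))        ≤⟨ ℕₚ.*-monoʳ-≤ (suc a) (bernoulli⁺ a n) ⟩
  suc a * (suc a ^ n * a)          ≡⟨ ℕₚ.*-assoc (suc a) (suc a ^ n) a ⟨
  suc a * suc a ^ n * a            ∎
  where
  open ℕₚ.≤-Reasoning
  lem₁ : ∀ a b n → a * b * (a + suc n) ≡ b * (a * suc (a + n))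
  lem₁ = solve-∀
  lem₂ : ∀ a n → a * suc (a + n) + n ≡ suc a * (a + n)
  lem₂ = solve-∀
  lem₃ : ∀ a b n → b * (suc a * (a + n)) ≡ suc a * (b * (a + n))
  lem₃ = solve-∀

-- `bernoulli⁺` with exponent equal to the base. It lets `suc p` surplus agreements double the
-- weight of a ranking, so that an excess can be measured in powers of 2.
^-double : ∀ p → 2 * suc p ^ suc p ≤ suc (suc p) ^ suc p
^-double p = ℕₚ.*-cancelʳ-≤ _ _ (suc p) (subst (_≤ suc (suc p) ^ suc p * suc p) (lem (suc p ^ suc p) (suc p)) (bernoulli⁺ (suc p) (suc p)))
  where
  lem : ∀ a b → a * (b + b) ≡ 2 * a * b
  lem = solve-∀

-- With h = p + 1, z = h² - 1 and y = h² the claim is (1 - 1/h²)^(h-1) (1 + 1/h) ≥ 1.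
tilt : ∀ p → let y = suc (p * suc (suc p)) in y ^ p * suc p ≤ (p * suc (suc p)) ^ p * suc (suc p)
tilt p = ℕₚ.*-cancelʳ-≤ _ _ y (begin
  y ^ p * suc p * y                       ≤⟨ ℕₚ.m≤m+n _ (y ^ p) ⟩
  y ^ p * suc p * y + y ^ p               ≡⟨ lem₁ p (y ^ p) ⟩
  y ^ p * (p * p + p + 1) * suc (suc p)   ≤⟨ ℕₚ.*-monoˡ-≤ (suc (suc p)) (bernoulli⁻ z p (p * p + p + 1) (lem₂ p)) ⟩
  z ^ p * y * suc (suc p)                 ≡⟨ lem₃ (z ^ p) y (suc (suc p)) ⟩
  z ^ p * suc (suc p) * y                 ∎)
  where
  open ℕₚ.≤-Reasoning
  z = p * suc (suc p)
  y = suc z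
  lem₁ : ∀ p a → a * suc p * suc (p * suc (suc p)) + a ≡ a * (p * p + p + 1) * suc (suc p)
  lem₁ = solve-∀
  lem₂ : ∀ p → p + (p * p + p + 1) ≡ suc (p * suc (suc p))
  lem₂ = solve-∀
  lem₃ : ∀ a b c → a * b * c ≡ a * c * b
  lem₃ = solve-∀

-- The e-th power of `tilt`; when `d` falls short of `p * e`, the missing factors are supplied on
-- both sides by `z ≤ y`.
tilt-many : ∀ p e d → d ≤ p * e → let y = suc (p * suc (suc p)) in
  y ^ d * suc p ^ e ≤ (p * suc (suc p)) ^ d * suc (suc p) ^ e
tilt-many p e d d≤ = ℕₚ.*-cancelʳ-≤ _ _ (y ^ x) ⦃ ℕₚ.m^n≢0 y x ⦄ (begin
  y ^ d * suc p ^ e * y ^ x                ≡⟨ lem (y ^ d) (suc p ^ e) (y ^ x) ⟩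
  y ^ d * y ^ x * suc p ^ e                ≡⟨ cong (_* suc p ^ e) (power y) ⟩
  (y ^ p) ^ e * suc p ^ e                  ≡⟨ ^-distribʳ-* e (y ^ p) (suc p) ⟨
  (y ^ p * suc p) ^ e                      ≤⟨ ℕₚ.^-monoˡ-≤ e (tilt p) ⟩
  (z ^ p * suc (suc p)) ^ e                ≡⟨ ^-distribʳ-* e (z ^ p) (suc (suc p)) ⟩
  (z ^ p) ^ e * suc (suc p) ^ e            ≡⟨ cong (_* suc (suc p) ^ e) (power z) ⟨
  z ^ d * z ^ x * suc (suc p) ^ e          ≤⟨ ℕₚ.*-monoˡ-≤ (suc (suc p) ^ e) (ℕₚ.*-monoʳ-≤ (z ^ d) (ℕₚ.^-monoˡ-≤ x (ℕₚ.n≤1+n z))) ⟩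
  z ^ d * y ^ x * suc (suc p) ^ e          ≡⟨ lem (z ^ d) (suc (suc p) ^ e) (y ^ x) ⟨
  z ^ d * suc (suc p) ^ e * y ^ x          ∎)
  where
  open ℕₚ.≤-Reasoning
  z = p * suc (suc p)
  y = suc z
  x = p * e ∸ d
  power : ∀ b → b ^ d * b ^ x ≡ (b ^ p) ^ e
  power b = trans (sym (ℕₚ.^-distribˡ-+-* b d x)) (trans (cong (b ^_) (ℕₚ.m+[n∸m]≡n d≤)) (sym (ℕₚ.^-*-assoc b p e)))
  lem : ∀ a b c → a * b * c ≡ a * c * b
  lem = solve-∀

-- With h = p + 1, after division by `h ^ (g + d)`: `d` agreements paired with the `d` disagreements
-- lose `(1 - 1/h²) ^ d`, the next `e` agreements make up for it, each further `h` double the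
-- weight, and the last `f` can only increase it.
chernoff : ∀ p e x d f → d ≤ p * e → let g = d + (e + (suc p * x + f)) in
  2 ^ x * suc p ^ (g + d) ≤ suc (suc p) ^ g * p ^ d
chernoff p e x d f d≤ = begin
  2 ^ x * h ^ (g + d)                                       ≡⟨ cong (2 ^ x *_) expand ⟩
  2 ^ x * ((h * h) ^ d * h ^ e * ((h ^ h) ^ x * h ^ f))        ≡⟨ lem₁ (2 ^ x) ((h * h) ^ d * h ^ e) ((h ^ h) ^ x) (h ^ f) ⟩
  (h * h) ^ d * h ^ e * (2 ^ x * (h ^ h) ^ x * h ^ f)       ≡⟨ cong₂ (λ s t → s ^ d * h ^ e * (t * h ^ f)) (lem₂ p) (sym (^-distribʳ-* x 2 (h ^ h))) ⟩
  y ^ d * h ^ e * ((2 * h ^ h) ^ x * h ^ f)                 ≤⟨ ℕₚ.*-mono-≤ (tilt-many p e d d≤) (ℕₚ.*-mono-≤ (ℕₚ.^-monoˡ-≤ x (^-double p)) (ℕₚ.^-monoˡ-≤ f (ℕₚ.n≤1+n h))) ⟩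
  (p * suc h) ^ d * suc h ^ e * ((suc h ^ h) ^ x * suc h ^ f) ≡⟨ cong₂ (λ s t → s * suc h ^ e * (t * suc h ^ f)) (^-distribʳ-* d p (suc h)) (ℕₚ.^-*-assoc (suc h) h x) ⟩
  p ^ d * suc h ^ d * suc h ^ e * (suc h ^ (h * x) * suc h ^ f) ≡⟨ lem₃ (p ^ d) (suc h ^ d) (suc h ^ e) (suc h ^ (h * x)) (suc h ^ f) ⟩
  suc h ^ d * (suc h ^ e * (suc h ^ (h * x) * suc h ^ f)) * p ^ d ≡⟨ cong (_* p ^ d) (split (suc h)) ⟨
  suc h ^ g * p ^ d                                         ∎
  where
  open ℕₚ.≤-Reasoning
  h = suc p
  y = suc (p * suc (suc p))
  g = d + (e + (h * x + f))
  split : ∀ b → b ^ g ≡ b ^ d * (b ^ e * (b ^ (h * x) * b ^ f))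
  split b = trans (ℕₚ.^-distribˡ-+-* b d _) (cong (b ^ d *_) (trans (ℕₚ.^-distribˡ-+-* b e _) (cong (b ^ e *_) (ℕₚ.^-distribˡ-+-* b (h * x) f))))
  lem₀ : ∀ a b c d → a * (b * (c * d)) * a ≡ a * a * b * (c * d)
  lem₀ = solve-∀
  expand : h ^ (g + d) ≡ (h * h) ^ d * h ^ e * ((h ^ h) ^ x * h ^ f)
  expand = begin-equality
    h ^ (g + d) ≡⟨ ℕₚ.^-distribˡ-+-* h g d ⟩
    h ^ g * h ^ d ≡⟨ cong (_* h ^ d) (split h) ⟩
    h ^ d * (h ^ e * (h ^ (h * x) * h ^ f)) * h ^ d ≡⟨ lem₀ (h ^ d) (h ^ e) (h ^ (h * x)) (h ^ f) ⟩
    h ^ d * h ^ d * h ^ e * (h ^ (h * x) * h ^ f) ≡⟨ cong₂ (λ s t → s * h ^ e * (t * h ^ f)) (sym (^-distribʳ-* d h h)) (sym (ℕₚ.^-*-assoc h h x)) ⟩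
    (h * h) ^ d * h ^ e * ((h ^ h) ^ x * h ^ f) ∎
  lem₁ : ∀ a b c d → a * (b * (c * d)) ≡ b * (a * c * d)
  lem₁ = solve-∀
  lem₂ : ∀ p → suc p * suc p ≡ suc (p * suc (suc p))
  lem₂ = solve-∀
  lem₃ : ∀ a b c d e → a * b * c * (d * e) ≡ b * (c * (d * e)) * a
  lem₃ = solve-∀

-- Enumerations, and tournaments from bit strings

vecs : {A : Set} → List A → ∀ n → List (Vec A n)
vecs xs zero = [] ∷ []
vecs xs (suc n) = List.cartesianProductWith _∷_ xs (vecs xs n)

length-cartesianProductWith : {A B C : Set} (f : A → B → C) (xs : List A) (ys : List B) →
  length (List.cartesianProductWith f xs ys) ≡ length xs * length ys
length-cartesianProductWith f [] ys = refl
length-cartesianProductWith f (x ∷ xs) ys = trans (Listₚ.length-++ (List.map (f x) ys))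
  (cong₂ _+_ (Listₚ.length-map (f x) ys) (length-cartesianProductWith f xs ys))

length-vecs : {A : Set} (xs : List A) → ∀ n → length (vecs xs n) ≡ length xs ^ n
length-vecs xs zero = refl
length-vecs xs (suc n) = trans (length-cartesianProductWith Vec._∷_ xs (vecs xs n)) (cong (length xs *_) (length-vecs xs n))

∈-vecs : {A : Set} {xs : List A} → (∀ x → x ∈ xs) → ∀ {n} (v : Vec A n) → v ∈ vecs xs n
∈-vecs all [] = here refl
∈-vecs all (x ∷ v) = ∈ₚ.∈-cartesianProductWith⁺ _∷_ (all x) (∈-vecs all v)

fst snd : ∀ m → Fin (m * m) → Fin m
fst m p = proj₁ (Fin.remQuot {m} m p)
snd m p = proj₂ (Fin.remQuot {m} m p)

sum-positions : ∀ m (F : Fin m → Fin m → ℕ) → sum (λ p → F (fst m p) (snd m p)) ≡ sum (λ i → sum (F i))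
sum-positions m F = trans (sum-combine m (λ p → F (fst m p) (snd m p)))
  (sum-cong λ i → sum-cong λ j → cong (λ ij → F (proj₁ ij) (proj₂ ij)) (Finₚ.remQuot-combine i j))

orient : ∀ m → (Fin (m * m) → Bool) → Digraph m
orient m t i j = ((i <?ᶠ j) ∧ t (combine i j)) ∨ ((j <?ᶠ i) ∧ not (t (combine j i)))

orient-< : ∀ m (t : Fin (m * m) → Bool) {i j} → toℕ i ℕ.< toℕ j → orient m t i j ≡ t (combine i j)
orient-< m t {i} {j} i<j rewrite <ᵇ-true i<j | <ᵇ-false (ℕₚ.<⇒≤ i<j) = Boolₚ.∨-identityʳ _

orient-> : ∀ m (t : Fin (m * m) → Bool) {i j} → toℕ j ℕ.< toℕ i → orient m t i j ≡ not (t (combine j i))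
orient-> m t {i} {j} j<i rewrite <ᵇ-true j<i | <ᵇ-false (ℕₚ.<⇒≤ j<i) = refl

orient-oriented : ∀ m (t : Fin (m * m) → Bool) → Oriented (orient m t)
orient-oriented m t i j e with ℕₚ.<-cmp (toℕ i) (toℕ j)
... | tri< i<j _ _ = trans (orient-> m t i<j) (cong not (trans (sym (orient-< m t i<j)) e))
... | tri> _ _ j<i = trans (orient-< m t j<i) (Boolₚ.not-injective (trans (sym (orient-> m t j<i)) e))
... | tri≈ _ eq _ with Finₚ.toℕ-injective eq
... | refl rewrite <ᵇ-false (ℕₚ.≤-refl {toℕ i}) = refl

orient-tournament : ∀ m (t : Fin (m * m) → Bool) → Tournament (orient m t)
orient-tournament m t i j i≢j with ℕₚ.<-cmp (toℕ i) (toℕ j)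
... | tri≈ _ eq _ = ⊥-elim (i≢j (Finₚ.toℕ-injective eq))
... | tri< i<j _ _ rewrite orient-< m t i<j | orient-> m t i<j with t (combine i j)
... | true = inj₁ refl
... | false = inj₂ refl
orient-tournament m t i j i≢j | tri> _ _ j<i rewrite orient-< m t j<i | orient-> m t j<i with t (combine j i)
... | true = inj₂ refl
... | false = inj₁ refl

orient-position : ∀ m (t : Fin (m * m) → Bool) p → toℕ (fst m p) ℕ.< toℕ (snd m p) → orient m t (fst m p) (snd m p) ≡ t p
orient-position m t p lt = trans (orient-< m t lt) (cong t (Finₚ.combine-remQuot {m} m p))

⟦∧⟧-cong : ∀ {a x y} → (a ≡ true → x ≡ y) → ⟦ a ∧ x ⟧ ≡ ⟦ a ∧ y ⟧
⟦∧⟧-cong {true} eq = cong ⟦_⟧ (eq refl)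
⟦∧⟧-cong {false} eq = refl

sum-<-positions : ∀ m (t : Fin (m * m) → Bool) (y : Fin m → Fin m → Bool) →
  sum (λ p → ⟦ (fst m p <?ᶠ snd m p) ∧ (t p xor y (fst m p) (snd m p)) ⟧) ≡ sum< (λ i j → ⟦ orient m t i j xor y i j ⟧)
sum-<-positions m t y = begin
  sum (λ p → ⟦ (fst m p <?ᶠ snd m p) ∧ (t p xor y (fst m p) (snd m p)) ⟧)
    ≡⟨ sum-cong (λ p → ⟦∧⟧-cong λ e → cong (_xor y (fst m p) (snd m p)) (sym (orient-position m t p (<ᵇ-true⁻¹ e)))) ⟩
  sum (λ p → ⟦ (fst m p <?ᶠ snd m p) ∧ (orient m t (fst m p) (snd m p) xor y (fst m p) (snd m p)) ⟧)
    ≡⟨ sum-positions m (λ i j → ⟦ (i <?ᶠ j) ∧ (orient m t i j xor y i j) ⟧) ⟩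
  sum (λ i → sum (λ j → ⟦ (i <?ᶠ j) ∧ (orient m t i j xor y i j) ⟧))
    ≡⟨ sum-cong (λ i → sum-cong λ j → ⟦∧⟧ (i <?ᶠ j) (orient m t i j xor y i j)) ⟩
  sum (λ i → sum (λ j → ⟦ i <?ᶠ j ⟧ * ⟦ orient m t i j xor y i j ⟧)) ≡⟨ sum<≡sum (λ i j → ⟦ orient m t i j xor y i j ⟧) ⟨
  sum< (λ i j → ⟦ orient m t i j xor y i j ⟧) ∎
  where open Relation.Binary.PropositionalEquality.≡-Reasoning

sum-<-count : ∀ m → sum {m * m} (λ p → ⟦ fst m p <?ᶠ snd m p ⟧) ≡ tri m
sum-<-count m = trans (sum-positions m (λ i j → ⟦ i <?ᶠ j ⟧))
  (trans (sum-cong {m} (λ i → sum-cong {m} λ j → sym (ℕₚ.*-identityʳ ⟦ i <?ᶠ j ⟧)))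
    (trans (sym (sum<≡sum {m} (λ _ _ → 1))) (sum<-const m)))

sum-<-members : ∀ {m k} (c : List (Fin m × Fin k)) → DistinctVertices c →
  tri (length c) ≤ sum {m * m} (λ p → ⟦ (fst m p <?ᶠ snd m p) ∧ (mem c (fst m p) ∧ mem c (snd m p)) ⟧)
sum-<-members {m} c distinct = begin
  tri (length c)                           ≡⟨ cong tri (sym (Listₚ.length-map proj₁ c)) ⟩
  tri (length (List.map proj₁ c))          ≤⟨ arcs-within≥tri _<?ᶠ_ <?ᶠ-antisym (AllPairs.map <?ᶠ-total uniq) ⟩
  arcs-within _<?ᶠ_ (List.map proj₁ c)     ≤⟨ χ-sum₂≥ uniq _<?ᶠ_ ⟩
  sum (λ i → sum (λ j → ⟦ (i <?ᶠ j) ∧ (mem c i ∧ mem c j) ⟧)) ≡⟨ sum-positions m (λ i j → ⟦ (i <?ᶠ j) ∧ (mem c i ∧ mem c j) ⟧) ⟨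
  sum (λ p → ⟦ (fst m p <?ᶠ snd m p) ∧ (mem c (fst m p) ∧ mem c (snd m p)) ⟧) ∎
  where
  open ℕₚ.≤-Reasoning
  uniq : AllPairs _≢_ (List.map proj₁ c)
  uniq = AllPairsₚ.map⁺ distinct

-- Up to powers of `h`, no single weight exceeds the total `M`. `few` puts `M` below `2 ^ x`, the
-- weight of a ranking that agrees too often; `rare` puts it below `2 ^ tri n * m ^ m`, the weight
-- of a pattern that is followed; `tri≤` supplies the condition `d ≤ p * e` of `chernoff`.
module RandomTournament (m k p e x n : ℕ) (bs : List (List (Fin m × Fin k)))
  (tri≤ : tri m ≤ 2 * (p * e))
  (few : suc (length bs) * m ^ m ℕ.< 2 ^ x) (m^m>0 : 1 ≤ m ^ m)
  (rare : suc (length bs) ℕ.< 2 ^ tri n) where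
  open ℕₚ.≤-Reasoning

  h = suc p

  -- A ranking inj₁ s contributes an exponential moment of its agreements with T. A transitive pattern inj₂ c
  -- contributes 2 to the number of its pairs if T follows it, and 0 otherwise. The weights W make the
  -- patterns as expensive as all m ^ m rankings together.
  C : Set
  C = Vec (Fin m) m ⊎ List (Fin m × Fin k)

  hi lo : C → ℕ
  hi (inj₁ s) = suc h
  hi (inj₂ c) = h + h
  lo (inj₁ s) = p
  lo (inj₂ c) = 0

  rel tgt : C → Fin m → Fin m → Bool
  rel (inj₁ s) i j = i <?ᶠ j
  rel (inj₂ c) i j = (i <?ᶠ j) ∧ (mem c i ∧ mem c j)
  tgt (inj₁ s) i j = toℕ (lookup s j) <ᵇ toℕ (lookup s i)
  tgt (inj₂ c) i j = rank c i <ᵇ rank c j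

  W : C → ℕ
  W (inj₁ s) = 1
  W (inj₂ c) = m ^ m

  rankings : List (Vec (Fin m) m)
  rankings = vecs (allFin m) m

  cs : List C
  cs = List.map inj₁ rankings ++ List.map inj₂ bs

  φ : C → Fin (m * m) → Bool → ℕ
  φ c p bit = factor (hi c) (lo c) h (rel c (fst m p) (snd m p)) (bit xor tgt c (fst m p) (snd m p))

  hi+lo : ∀ c → hi c + lo c ≡ h + h
  hi+lo (inj₁ s) = cong suc (sym (ℕₚ.+-suc p p))
  hi+lo (inj₂ c) = ℕₚ.+-identityʳ (h + h)

  φ-sum : ∀ c p → φ c p false + φ c p true ≡ h + h
  φ-sum c p = factor-sum (hi c) (lo c) h (rel c (fst m p) (snd m p)) (tgt c (fst m p) (snd m p)) (hi+lo c)

  total : sumₗ cs W ≡ suc (length bs) * m ^ m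
  total = trans (sumₗ-++ (List.map inj₁ rankings) (List.map inj₂ bs) W) (cong₂ _+_
    (trans (sumₗ-map inj₁ rankings W) (trans (sumₗ-const rankings 1) (trans (ℕₚ.*-identityʳ _)
      (trans (length-vecs (allFin m) m) (cong (_^ m) (Listₚ.length-tabulate {n = m} id))))))
    (trans (sumₗ-map inj₂ bs W) (sumₗ-const bs (m ^ m))))

  M = suc (length bs) * m ^ m
  chosen = derandomize (m * m) h cs W φ φ-sum
  t = proj₁ chosen

  T : Digraph m
  T = orient m t

  agree differ other : C → ℕ
  agree c = sum (λ p → ⟦ rel c (fst m p) (snd m p) ∧ not (t p xor tgt c (fst m p) (snd m p)) ⟧)
  differ c = sum (λ p → ⟦ rel c (fst m p) (snd m p) ∧ (t p xor tgt c (fst m p) (snd m p)) ⟧)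
  other c = sum {m * m} (λ p → ⟦ not (rel c (fst m p) (snd m p)) ⟧)

  relevant : ∀ c → agree c + differ c ≡ sum {m * m} (λ p → ⟦ rel c (fst m p) (snd m p) ⟧)
  relevant c = relevant-split (λ p → rel c (fst m p) (snd m p)) (λ p → t p xor tgt c (fst m p) (snd m p))

  -- A single term is at most the whole sum, and the factors `h` of the irrelevant positions cancel.
  weight-bound : ∀ {c} → c ∈ cs → W c * (hi c ^ agree c * lo c ^ differ c) ≤ M * h ^ (agree c + differ c)
  weight-bound {c} c∈ = ℕₚ.*-cancelʳ-≤ _ _ (h ^ other c) ⦃ ℕₚ.m^n≢0 h (other c) ⦄ (begin
    W c * (hi c ^ agree c * lo c ^ differ c) * h ^ other c   ≡⟨ ℕₚ.*-assoc (W c) _ _ ⟩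
    W c * (hi c ^ agree c * lo c ^ differ c * h ^ other c)
      ≡⟨ cong (W c *_) (prod-factor (hi c) (lo c) h (λ p → rel c (fst m p) (snd m p)) (λ p → t p xor tgt c (fst m p) (snd m p))) ⟨
    W c * prod (λ p → φ c p (t p))                           ≤⟨ term≤sumₗ (λ c → W c * prod (λ p → φ c p (t p))) c∈ ⟩
    sumₗ cs (λ c → W c * prod (λ p → φ c p (t p)))           ≤⟨ proj₂ chosen ⟩
    sumₗ cs W * h ^ (m * m)                                  ≡⟨ cong₂ (λ a b → a * h ^ b) total (sym
      (trans (cong (_+ other c) (relevant c)) (relevant-total {m * m} (λ p → rel c (fst m p) (snd m p))))) ⟩
    M * h ^ (agree c + differ c + other c)                   ≡⟨ cong (M *_) (ℕₚ.^-distribˡ-+-* h (agree c + differ c) (other c)) ⟩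
    M * (h ^ (agree c + differ c) * h ^ other c)             ≡⟨ ℕₚ.*-assoc M _ _ ⟨
    M * h ^ (agree c + differ c) * h ^ other c               ∎)

  -- A ranking with too few disagreements would by `chernoff` have a normalised weight of at least
  -- `2 ^ x`, more than `M`.
  far : ∀ s → (∀ i → s i ℕ.< m) → tri m ≤ 2 * disagreements T s + (e + h * x)
  far s s< with ℕₚ.≤-total (tri m) (2 * disagreements T s + (e + h * x))
  ... | inj₁ le = le
  ... | inj₂ ge = ⊥-elim (ℕₚ.<⇒≱ few (ℕₚ.*-cancelʳ-≤ _ _ (h ^ (agree c + d)) ⦃ ℕₚ.m^n≢0 h (agree c + d) ⦄ (begin
    2 ^ x * h ^ (agree c + d)            ≡⟨ cong (λ g → 2 ^ x * h ^ (g + d)) g≡ ⟩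
    2 ^ x * h ^ (g + d)                  ≤⟨ chernoff p e x d f d≤ ⟩
    suc h ^ g * p ^ d                    ≡⟨ cong (λ g → suc h ^ g * p ^ d) g≡ ⟨
    suc h ^ agree c * p ^ d              ≡⟨ ℕₚ.*-identityˡ _ ⟨
    1 * (suc h ^ agree c * p ^ d)        ≤⟨ weight-bound (∈ₚ.∈-++⁺ˡ (∈ₚ.∈-map⁺ inj₁ (∈-vecs ∈ₚ.∈-allFin v))) ⟩
    M * h ^ (agree c + d)                ∎)))
    where
    v = Vec.tabulate (λ i → Fin.fromℕ< (s< i))
    c = inj₁ v
    d = differ c
    v≡ : ∀ i → toℕ (lookup v i) ≡ s i
    v≡ i = trans (cong toℕ (Vecₚ.lookup∘tabulate _ i)) (Finₚ.toℕ-fromℕ< (s< i))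
    d≡ : d ≡ disagreements T s
    d≡ = trans (sum-<-positions m t (tgt c)) (sum<-cong λ i j _ → cong (λ b → ⟦ T i j xor b ⟧) (cong₂ _<ᵇ_ (v≡ j) (v≡ i)))
    g+d : agree c + d ≡ tri m
    g+d = trans (relevant c) (sum-<-count m)
    d≤ : d ≤ p * e
    d≤ = ℕₚ.*-cancelˡ-≤ 2 (begin
      2 * d ≡⟨ cong (2 *_) d≡ ⟩
      2 * disagreements T s ≤⟨ ℕₚ.m≤m+n _ _ ⟩
      2 * disagreements T s + (e + h * x) ≤⟨ ge ⟩
      tri m ≤⟨ tri≤ ⟩
      2 * (p * e) ∎)
    base≤ : d + (e + h * x) ≤ agree c
    base≤ = ℕₚ.+-cancelʳ-≤ d _ _ (begin
      d + (e + h * x) + d ≡⟨ lem d (e + h * x) ⟩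
      2 * d + (e + h * x) ≡⟨ cong (λ z → 2 * z + (e + h * x)) d≡ ⟩
      2 * disagreements T s + (e + h * x) ≤⟨ ge ⟩
      tri m ≡⟨ g+d ⟨
      agree c + d ∎)
      where
      lem : ∀ d y → d + y + d ≡ 2 * d + y
      lem = solve-∀
    f = agree c ∸ (d + (e + h * x))
    g = d + (e + (h * x + f))
    g≡ : agree c ≡ g
    g≡ = trans (sym (ℕₚ.m+[n∸m]≡n base≤)) (lem d e (h * x) f)
      where
      lem : ∀ a b c f → a + (b + c) + f ≡ a + (b + (c + f))
      lem = solve-∀

  -- A followed pattern has no disagreements, so each of its at least `tri n` pairs doubles its
  -- weight, which then exceeds `M`.
  avoids : ∀ {c} → c ∈ bs → length c ≡ n → DistinctVertices c → ¬ Follows T c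
  avoids {c} c∈ len distinct follows = ℕₚ.<⇒≱ rare (ℕₚ.*-cancelʳ-≤ _ _ (m ^ m) ⦃ ℕ.>-nonZero m^m>0 ⦄
    (ℕₚ.*-cancelʳ-≤ _ _ (h ^ g) ⦃ ℕₚ.m^n≢0 h g ⦄ (begin
    2 ^ tri n * m ^ m * h ^ g           ≤⟨ ℕₚ.*-monoˡ-≤ (h ^ g) (ℕₚ.*-monoˡ-≤ (m ^ m) (ℕₚ.^-monoʳ-≤ 2 tri≤g)) ⟩
    2 ^ g * m ^ m * h ^ g               ≡⟨ lem (2 ^ g) (m ^ m) (h ^ g) ⟩
    m ^ m * (2 ^ g * h ^ g * 1)         ≡⟨ cong (λ z → m ^ m * (z * 1)) (sym (^-distribʳ-* g 2 h)) ⟩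
    m ^ m * ((2 * h) ^ g * 1)           ≡⟨ cong (λ z → m ^ m * ((h + z) ^ g * 1)) (ℕₚ.+-identityʳ h) ⟩
    -- `0 ^ 0` is 1: the vanishing factor for disagreements never occurs.
    m ^ m * ((h + h) ^ g * 0 ^ 0)       ≡⟨ cong (λ z → m ^ m * ((h + h) ^ g * 0 ^ z)) differ≡0 ⟨
    m ^ m * ((h + h) ^ g * 0 ^ differ (inj₂ c)) ≤⟨ weight-bound (∈ₚ.∈-++⁺ʳ (List.map inj₁ rankings) (∈ₚ.∈-map⁺ inj₂ c∈)) ⟩
    M * h ^ (g + differ (inj₂ c))       ≡⟨ cong (λ z → M * h ^ z) (trans (cong (g +_) differ≡0) (ℕₚ.+-identityʳ g)) ⟩
    M * h ^ g                           ∎)))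
    where
    g = agree (inj₂ c)
    differ≡0 : differ (inj₂ c) ≡ 0
    differ≡0 = sum-zero (m * m) cell
      where
      cell : ∀ p → ⟦ rel (inj₂ c) (fst m p) (snd m p) ∧ (t p xor tgt (inj₂ c) (fst m p) (snd m p)) ⟧ ≡ 0
      cell p with fst m p <?ᶠ snd m p in i<j | mem c (fst m p) in mi | mem c (snd m p) in mj
      ... | false | _ | _ = refl
      ... | true | false | _ = refl
      ... | true | true | false = refl
      ... | true | true | true rewrite sym (follows (fst m p) (snd m p) (<ᵇ-true⁻¹ i<j) mi mj)
        | orient-position m t p (<ᵇ-true⁻¹ i<j) = cong ⟦_⟧ (Boolₚ.xor-same (t p))
    tri≤g : tri n ≤ g
    tri≤g = subst₂ (λ a b → tri a ≤ b) len (trans (sym (relevant (inj₂ c))) (trans (cong (g +_) differ≡0) (ℕₚ.+-identityʳ g)))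
      (sum-<-members c distinct)
    lem : ∀ a b c → a * b * c ≡ b * (a * c * 1)
    lem = solve-∀

n<2^n : ∀ n → n ℕ.< 2 ^ n
n<2^n zero = s≤s z≤n
n<2^n (suc n) = begin-strict
  suc n             ≤⟨ n<2^n n ⟩
  2 ^ n             <⟨ ℕₚ.m<m+n (2 ^ n) (ℕₚ.m^n>0 2 n) ⟩
  2 ^ n + 2 ^ n     ≡⟨ cong (2 ^ n +_) (ℕₚ.+-identityʳ _) ⟨
  2 ^ suc n         ∎
  where open ℕₚ.≤-Reasoning

-- Parameters: U = 2ʲ is the precision and m = 2^(4j+8) = 4w² the number of vertices, with w = 8U².
module Parameters (j : ℕ) where
  open ℕₚ.≤-Reasoning

  U w r m e x : ℕ
  U = 2 ^ j
  w = 8 * (U * U)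
  r = 4 * j + 8
  m = 2 ^ r
  -- Chosen to make `U * e` equal to m²/4, so `e` is the fraction 1/U of the main term.
  e = 32 * (U * (w * w * w))
  -- `m ^ m` is `2 ^ (r * m)`, and the patterns may contribute a further factor `2 ^ (2 * (r * m))`;
  -- the 1 makes the inequality strict.
  x = 3 * (r * m) + 1

  U≥1 : 1 ≤ U
  U≥1 = ℕₚ.m^n>0 2 j

  m≡ : m ≡ 4 * (w * w)
  m≡ = begin-equality
    2 ^ (4 * j + 8)         ≡⟨ ℕₚ.^-distribˡ-+-* 2 (4 * j) 8 ⟩
    2 ^ (4 * j) * 256       ≡⟨ cong (λ z → 2 ^ z * 256) (ℕₚ.*-comm 4 j) ⟩
    2 ^ (j * 4) * 256       ≡⟨ cong (_* 256) (ℕₚ.^-*-assoc 2 j 4) ⟨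
    U ^ 4 * 256             ≡⟨ lem U ⟩
    4 * (w * w)             ∎
    where
    lem : ∀ U → U * (U * (U * (U * 1))) * 256 ≡ 4 * (8 * (U * U) * (8 * (U * U)))
    lem = solve-∀

  U*e : U * e ≡ 4 * (w * w * (w * w))
  U*e = lem U w
    where
    lem : ∀ U w → U * (32 * (U * (w * w * w))) ≡ 4 * (8 * (U * U) * w * (w * w))
    lem = solve-∀

  m*m : m * m ≡ 4 * (U * e)
  m*m = trans (cong₂ _*_ m≡ m≡) (trans (lem w) (cong (4 *_) (sym U*e)))
    where
    lem : ∀ w → 4 * (w * w) * (4 * (w * w)) ≡ 4 * (4 * (w * w * (w * w)))
    lem = solve-∀

  r≤w : r ≤ w
  r≤w = begin
    4 * j + 8              ≡⟨ lem j ⟩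
    4 * suc j + 4 * 1      ≤⟨ ℕₚ.+-mono-≤ (ℕₚ.*-monoʳ-≤ 4 (n<2^n j)) (ℕₚ.*-monoʳ-≤ 4 U≥1) ⟩
    4 * U + 4 * U          ≡⟨ lem′ U ⟩
    8 * (1 * U)            ≤⟨ ℕₚ.*-monoʳ-≤ 8 (ℕₚ.*-monoˡ-≤ U U≥1) ⟩
    8 * (U * U)            ∎
    where
    lem : ∀ j → 4 * j + 8 ≡ 4 * suc j + 4 * 1
    lem = solve-∀
    lem′ : ∀ U → 4 * U + 4 * U ≡ 8 * (1 * U)
    lem′ = solve-∀

  U≤m : U ≤ m
  U≤m = ℕₚ.^-monoʳ-≤ 2 (ℕₚ.≤-trans (ℕₚ.m≤n*m j 4) (ℕₚ.m≤m+n (4 * j) 8))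

  r*m≥1 : 1 ≤ r * m
  r*m≥1 = ℕₚ.*-mono-≤ (ℕₚ.≤-trans (s≤s z≤n) (ℕₚ.m≤n+m 8 (4 * j))) (ℕₚ.m^n>0 2 r)

  -- The union bound costs about U m log m, against `e` of order m²/U. It fits because `r`, the
  -- binary logarithm of m, is at most `w`, half the square root of m.
  h*x≤e : suc U * x ≤ e
  h*x≤e = begin
    suc U * (3 * (r * m) + 1)          ≤⟨ ℕₚ.*-mono-≤ (ℕₚ.+-monoˡ-≤ U U≥1) (ℕₚ.+-monoʳ-≤ (3 * (r * m)) r*m≥1) ⟩
    (U + U) * (3 * (r * m) + r * m)    ≡⟨ lem₁ U r m ⟩
    8 * (U * (r * m))                  ≤⟨ ℕₚ.*-monoʳ-≤ 8 (ℕₚ.*-monoʳ-≤ U (ℕₚ.*-monoˡ-≤ m r≤w)) ⟩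
    8 * (U * (w * m))                  ≡⟨ cong (λ z → 8 * (U * (w * z))) m≡ ⟩
    8 * (U * (w * (4 * (w * w))))      ≡⟨ lem₂ U w ⟩
    e                                  ∎
    where
    lem₁ : ∀ U r m → (U + U) * (3 * (r * m) + r * m) ≡ 8 * (U * (r * m))
    lem₁ = solve-∀
    lem₂ : ∀ U w → 8 * (U * (w * (4 * (w * w)))) ≡ 32 * (U * (w * w * w))
    lem₂ = solve-∀

  tri-m≤ : tri m ≤ 2 * (U * e)
  tri-m≤ = ℕₚ.*-cancelˡ-≤ 2 (begin
    2 * tri m                ≡⟨ cong (tri m +_) (ℕₚ.+-identityʳ (tri m)) ⟩
    tri m + tri m            ≤⟨ ℕₚ.m≤m+n _ m ⟩
    tri m + tri m + m        ≡⟨ tri-double m ⟩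
    m * m                    ≡⟨ m*m ⟩
    4 * (U * e)              ≡⟨ ℕₚ.*-assoc 2 2 (U * e) ⟩
    2 * (2 * (U * e))        ∎)

  -- `U * e` is the expected m²/4, the term `e` is a relative error 1/U, and `w * w` = m/4 is the
  -- diagonal that `tri m` lacks.
  Far : Digraph m → Set
  Far T = ∀ s → (∀ i → s i ℕ.< m) → U * e ≤ disagreements T s + (e + w * w)

  far-tournament : ∀ {k} n (bs : List (List (Fin m × Fin k))) →
    suc (length bs) ≤ 2 ^ (2 * (r * m)) → suc (length bs) ℕ.< 2 ^ tri n →
    ∃ λ T → Oriented T × Tournament T × Far T ×
      (∀ {c} → c ∈ bs → length c ≡ n → DistinctVertices c → ¬ Follows T c)
  far-tournament {k} n bs few rare = T , orient-oriented m t , orient-tournament m t , far′ , avoids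
    where
    few′ : suc (length bs) * m ^ m ℕ.< 2 ^ x
    few′ = begin-strict
      suc (length bs) * m ^ m            ≤⟨ ℕₚ.*-monoˡ-≤ (m ^ m) few ⟩
      2 ^ (2 * (r * m)) * m ^ m          ≡⟨ cong (2 ^ (2 * (r * m)) *_) (ℕₚ.^-*-assoc 2 r m) ⟩
      2 ^ (2 * (r * m)) * 2 ^ (r * m)    ≡⟨ ℕₚ.^-distribˡ-+-* 2 (2 * (r * m)) (r * m) ⟨
      2 ^ (2 * (r * m) + r * m)          <⟨ ℕₚ.^-monoʳ-< 2 (s≤s (s≤s z≤n)) (ℕₚ.≤-reflexive (lem (r * m))) ⟩
      2 ^ x                              ∎
      where
      lem : ∀ z → suc (2 * z + z) ≡ 3 * z + 1
      lem = solve-∀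
    m^m>0 : 1 ≤ m ^ m
    m^m>0 = ℕₚ.m^n>0 m ⦃ ℕₚ.m^n≢0 2 r ⦄ m
    open RandomTournament m k U e x n bs tri-m≤ few′ m^m>0 rare
    far′ : Far T
    far′ s s< = ℕₚ.*-cancelˡ-≤ 4 (begin
      4 * (U * e)                                      ≡⟨ m*m ⟨
      m * m                                            ≡⟨ tri-double m ⟨
      tri m + tri m + m                                ≤⟨ ℕₚ.+-monoˡ-≤ m (ℕₚ.+-mono-≤ bound bound) ⟩
      (2 * D + (e + e)) + (2 * D + (e + e)) + m        ≡⟨ cong ((2 * D + (e + e)) + (2 * D + (e + e)) +_) m≡ ⟩
      (2 * D + (e + e)) + (2 * D + (e + e)) + 4 * (w * w) ≡⟨ lem D e (w * w) ⟩
      4 * (D + (e + w * w))                            ∎)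
      where
      D = disagreements T s
      bound : tri m ≤ 2 * D + (e + e)
      bound = ℕₚ.≤-trans (far s s<) (ℕₚ.+-monoʳ-≤ (2 * D) (ℕₚ.+-monoʳ-≤ e h*x≤e))
      lem : ∀ D e z → (2 * D + (e + e)) + (2 * D + (e + e)) + 4 * z ≡ 4 * (D + (e + z))
      lem = solve-∀

  module _ (k B : ℕ) (T : Digraph m) (or : Oriented T) (tour : Tournament T) (far : Far T)
    (small : ∀ q Xs → Acyclic (invertAll Xs (blowup q T)) → ∀ X → ∣ X ∣ ≤ k →
      arcs-within (reversed q T (invertAll Xs (blowup q T))) (elems X) ≤ B) where

    -- Four units of `n * n` are given away: two for the remainder, since U ρ ≤ U m ≤ n, and one
    -- each for the terms `e` and `w * w` of `Far`.
    blowup-arithmetic : ∀ Q ρ t → 1 ≤ Q → ρ ≤ m → U * m ≤ m * Q + ρ → Q * Q * (U * e ∸ (e + w * w)) ≤ t * B →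
      let n = m * Q + ρ in U * (n * n) ≤ U * (4 * B) * t + 4 * (n * n)
    blowup-arithmetic Q ρ t 1≤Q ρ≤m large le = begin
      U * (n * n)                             ≤⟨ ℕₚ.*-monoʳ-≤ U (ℕₚ.≤-trans (ℕₚ.m≤m+n (n * n) (ρ * ρ)) (ℕₚ.≤-reflexive (lem₁ (m * Q) ρ))) ⟩
      U * (N * N + 2 * (ρ * n))               ≡⟨ lem₂ U N ρ n ⟩
      U * (N * N) + 2 * (U * ρ * n)           ≤⟨ ℕₚ.+-mono-≤ main (ℕₚ.*-monoʳ-≤ 2 (ℕₚ.*-monoˡ-≤ n (ℕₚ.≤-trans (ℕₚ.*-monoʳ-≤ U ρ≤m) large))) ⟩
      U * (4 * B) * t + 2 * (N * N) + 2 * (n * n) ≤⟨ ℕₚ.+-monoˡ-≤ (2 * (n * n)) (ℕₚ.+-monoʳ-≤ (U * (4 * B) * t) (ℕₚ.*-monoʳ-≤ 2 (ℕₚ.*-mono-≤ N≤n N≤n))) ⟩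
      U * (4 * B) * t + 2 * (n * n) + 2 * (n * n) ≡⟨ lem₃ (U * (4 * B) * t) (n * n) ⟩
      U * (4 * B) * t + 4 * (n * n)           ∎
      where
      N = m * Q
      n = N + ρ
      N≤n : N ≤ n
      N≤n = ℕₚ.m≤m+n N ρ
      lem₁ : ∀ N ρ → (N + ρ) * (N + ρ) + ρ * ρ ≡ N * N + 2 * (ρ * (N + ρ))
      lem₁ = solve-∀
      lem₂ : ∀ U N ρ n → U * (N * N + 2 * (ρ * n)) ≡ U * (N * N) + 2 * (U * ρ * n)
      lem₂ = solve-∀
      lem₃ : ∀ a b → a + 2 * b + 2 * b ≡ a + 4 * b
      lem₃ = solve-∀
      N*N : N * N ≡ Q * Q * (m * m)
      N*N = lem m Q
        where
        lem : ∀ m Q → m * Q * (m * Q) ≡ Q * Q * (m * m)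
        lem = solve-∀
      full : Q * Q * (U * e) ≤ t * B + Q * Q * (e + w * w)
      full = begin
        Q * Q * (U * e)                                        ≤⟨ ℕₚ.*-monoʳ-≤ (Q * Q) (ℕₚ.m≤n+m∸n (U * e) (e + w * w)) ⟩
        Q * Q * ((e + w * w) + (U * e ∸ (e + w * w)))          ≡⟨ ℕₚ.*-distribˡ-+ (Q * Q) (e + w * w) _ ⟩
        Q * Q * (e + w * w) + Q * Q * (U * e ∸ (e + w * w))    ≤⟨ ℕₚ.+-monoʳ-≤ _ le ⟩
        Q * Q * (e + w * w) + t * B                            ≡⟨ ℕₚ.+-comm _ (t * B) ⟩
        t * B + Q * Q * (e + w * w)                            ∎
      main : U * (N * N) ≤ U * (4 * B) * t + 2 * (N * N)
      main = begin
        U * (N * N)                                            ≡⟨ cong (U *_) (trans N*N (cong (Q * Q *_) m*m)) ⟩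
        U * (Q * Q * (4 * (U * e)))                            ≡⟨ lem₄ U Q (U * e) ⟩
        4 * U * (Q * Q * (U * e))                              ≤⟨ ℕₚ.*-monoʳ-≤ (4 * U) full ⟩
        4 * U * (t * B + Q * Q * (e + w * w))                  ≡⟨ lem₅ U t B Q e w ⟩
        U * (4 * B) * t + (Q * Q * (4 * (U * e)) + Q * Q * (U * (4 * (w * w))))
          ≡⟨ cong₂ (λ a b → U * (4 * B) * t + (Q * Q * a + Q * Q * (U * b))) (sym m*m) (sym m≡) ⟩
        U * (4 * B) * t + (Q * Q * (m * m) + Q * Q * (U * m))  ≤⟨ ℕₚ.+-monoʳ-≤ (U * (4 * B) * t) (ℕₚ.+-monoʳ-≤ _ (ℕₚ.*-monoʳ-≤ (Q * Q) (ℕₚ.*-monoˡ-≤ m U≤m))) ⟩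
        U * (4 * B) * t + (Q * Q * (m * m) + Q * Q * (m * m))  ≡⟨ cong (λ z → U * (4 * B) * t + (z + z)) (sym N*N) ⟩
        U * (4 * B) * t + (N * N + N * N)                      ≡⟨ cong (λ z → U * (4 * B) * t + (N * N + z)) (sym (ℕₚ.+-identityʳ (N * N))) ⟩
        U * (4 * B) * t + 2 * (N * N)                          ∎
        where
        lem₄ : ∀ U Q z → U * (Q * Q * (4 * z)) ≡ 4 * U * (Q * Q * z)
        lem₄ = solve-∀
        lem₅ : ∀ U t B Q e w → 4 * U * (t * B + Q * Q * (e + w * w)) ≡
          U * (4 * B) * t + (Q * Q * (4 * (U * e)) + Q * Q * (U * (4 * (w * w))))
        lem₅ = solve-∀

    blowup-forces : ∀ n → U * m ≤ n → Forces k n (λ t → U * (n * n) ≤ U * (4 * B) * t + 4 * (n * n))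
    blowup-forces n large = go (n DivMod./ m) (n DivMod.% m) (ℕₚ.<⇒≤ (DivMod.m%n<n n m))
      (trans (DivMod.m≡m%n+[m/n]*n n m) (trans (ℕₚ.+-comm (n DivMod.% m) _) (cong (_+ n DivMod.% m) (ℕₚ.*-comm (n DivMod./ m) m))))
      (DivMod.m≥n⇒m/n>0 (ℕₚ.≤-trans (ℕₚ.m≤n*m m U ⦃ ℕₚ.m^n≢0 2 j ⦄) large))
      where
      instance
        m≢0 : NonZero m
        m≢0 = ℕₚ.m^n≢0 2 r
      go : ∀ Q ρ → ρ ≤ m → n ≡ m * Q + ρ → 1 ≤ Q → Forces k n (λ t → U * (n * n) ≤ U * (4 * B) * t + 4 * (n * n))
      go (suc q) ρ ρ≤m refl 1≤Q = Forces-pad ρ (λ t → U * (n * n) ≤ U * (4 * B) * t + 4 * (n * n)) (blowup (suc q) T , (λ u v → or (part m (suc q) u) (part m (suc q) v)) ,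
        λ Xs (sizes , ac) → blowup-arithmetic (suc q) ρ (length Xs) 1≤Q ρ≤m large
          (blowup-count q (U * e ∸ (e + w * w)) B tour
            (λ s s< → ℕₚ.m≤n+o⇒m∸n≤o (U * e) (e + w * w) (ℕₚ.≤-trans (far s s<) (ℕₚ.≤-reflexive (ℕₚ.+-comm _ (e + w * w)))))
            Xs ac (All.map (λ {X} → small (suc q) Xs ac X) sizes)))

-- Lower bounds over ℕ, for every k and for large k

dyadic-bracket : ∀ k → 256 ≤ k → ∃ λ ℓ → 8 ≤ ℓ × 2 ^ ℓ ≤ k × k ℕ.< 2 ^ suc ℓ
dyadic-bracket k 256≤k = subst (λ k → ∃ λ ℓ → 8 ≤ ℓ × 2 ^ ℓ ≤ k × k ℕ.< 2 ^ suc ℓ) (ℕₚ.m∸n+n≡m 256≤k) (go (k ∸ 256))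
  where
  go : ∀ i → ∃ λ ℓ → 8 ≤ ℓ × 2 ^ ℓ ≤ i + 256 × i + 256 ℕ.< 2 ^ suc ℓ
  go zero = 8 , ℕₚ.≤-refl , ℕₚ.≤-refl , ℕₚ.m<m+n 256 {256} (s≤s z≤n)
  go (suc i) with go i
  ... | ℓ , 8≤ℓ , lo , hi with ℕₚ.m≤n⇒m<n∨m≡n hi
  ... | inj₁ hi′ = ℓ , 8≤ℓ , ℕₚ.m≤n⇒m≤1+n lo , hi′
  ... | inj₂ eq = suc ℓ , ℕₚ.m≤n⇒m≤1+n 8≤ℓ , ℕₚ.≤-reflexive (sym eq) ,
    subst (λ z → suc (i + 256) ℕ.< z + (z + 0)) eq (ℕₚ.m<m+n (suc (i + 256)) (s≤s z≤n))

-- Origin of the threshold 256: 18 · 8 + 61 = 205 is below 2⁸, whereas exponent 7 fails.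
linear≤2^ : ∀ i → 18 * (8 + i) + 61 ≤ 2 ^ (8 + i)
linear≤2^ zero = ℕₚ.m≤m+n 205 51
linear≤2^ (suc i) = begin
  18 * (8 + suc i) + 61               ≡⟨ lem i ⟩
  18 * (8 + i) + 61 + 18 * 1          ≤⟨ ℕₚ.+-mono-≤ (linear≤2^ i) (ℕₚ.≤-trans (ℕₚ.≤-trans (ℕₚ.m≤m+n 18 187) (ℕₚ.+-monoˡ-≤ 61 (ℕₚ.*-monoʳ-≤ 18 (ℕₚ.m≤m+n 8 i)))) (linear≤2^ i)) ⟩
  2 ^ (8 + i) + 2 ^ (8 + i)           ≡⟨ cong (2 ^ (8 + i) +_) (ℕₚ.+-identityʳ (2 ^ (8 + i))) ⟨
  2 ^ (8 + suc i)                     ∎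
  where
  open ℕₚ.≤-Reasoning
  lem : ∀ i → 18 * (8 + suc i) + 61 ≡ 18 * (8 + i) + 61 + 18 * 1
  lem = solve-∀

module _ where
  open ℕₚ.≤-Reasoning

  forces-basic : ∀ k j → let open Parameters j in
    ∀ n → U * m ≤ n → Forces k n (λ t → U * (n * n) ≤ U * (4 * tri k) * t + 4 * (n * n))
  -- With an empty list of patterns the condition is `1 < 2 ^ tri n`, and 2 is the least order that
  -- meets it.
  forces-basic k j = conclude (far-tournament {1} 2 [] (ℕₚ.m^n>0 2 (2 * (r * m))) (s≤s (s≤s z≤n)))
    where
    open Parameters j
    conclude : ∀ {P : Digraph m → Set} → (∃ λ T → Oriented T × Tournament T × Far T × P T) →
      ∀ n → U * m ≤ n → Forces k n (λ t → U * (n * n) ≤ U * (4 * tri k) * t + 4 * (n * n))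
    conclude (T , or , tour , far , _) = blowup-forces k (tri k) T or tour far
      λ q Xs _ X → reversed-within≤ q k T (invertAll Xs (blowup q T)) X

  ∈-toList-vecs : ∀ {A : Set} {xs : List A} → (∀ x → x ∈ xs) → ∀ {n} (c : List A) → length c ≡ n → c ∈ List.map Vec.toList (vecs xs n)
  ∈-toList-vecs {xs = xs} all {n} c refl = subst (_∈ List.map Vec.toList (vecs xs n)) (Vecₚ.toList∘fromList c) (∈ₚ.∈-map⁺ Vec.toList (∈-vecs all (Vec.fromList c)))

  square-bound : ∀ k → tri k ≤ k * k
  square-bound k = subst (tri k ≤_) (tri-double k) (ℕₚ.≤-trans (ℕₚ.m≤m+n (tri k) (tri k)) (ℕₚ.m≤m+n _ k))

  -- The number of patterns is at most `2 ^ ((9 * L + 20) * k)`; the quadratic `tri k` overtakes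
  -- this exponent once k is a large multiple of L.
  tri-large : ∀ k L → 18 * L + 43 ≤ k → (9 * L + 20) * k + 2 ≤ tri k
  tri-large k L le = ℕₚ.*-cancelˡ-≤ 2 (ℕₚ.+-cancelʳ-≤ k _ _ (begin
    2 * ((9 * L + 20) * k + 2) + k                ≡⟨ lem₁ L k ⟩
    2 * ((9 * L + 20) * k) + k + 2 * 2            ≤⟨ ℕₚ.+-monoʳ-≤ (2 * ((9 * L + 20) * k) + k) (ℕₚ.*-monoʳ-≤ 2 (ℕₚ.≤-trans (ℕₚ.≤-trans (s≤s (s≤s z≤n)) (ℕₚ.m≤n+m 43 (18 * L))) le)) ⟩
    2 * ((9 * L + 20) * k) + k + 2 * k            ≡⟨ lem₂ L k ⟩
    (18 * L + 43) * k                             ≤⟨ ℕₚ.*-monoˡ-≤ k le ⟩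
    k * k                                         ≡⟨ tri-double k ⟨
    tri k + tri k + k                             ≡⟨ cong (λ z → tri k + z + k) (ℕₚ.+-identityʳ (tri k)) ⟨
    2 * tri k + k                                 ∎))
    where
    lem₁ : ∀ L k → 2 * ((9 * L + 20) * k + 2) + k ≡ 2 * ((9 * L + 20) * k) + k + 2 * 2
    lem₁ = solve-∀
    lem₂ : ∀ L k → 2 * ((9 * L + 20) * k) + k + 2 * k ≡ (18 * L + 43) * k
    lem₂ = solve-∀

  -- Relative to 1/(4B) the loss is 4/U ≤ 1/(2(B + 1)), which is half of the gap down to 1/(4(B +
  -- 1)); the other half is kept.
  improve : ∀ U B n² t → 8 * suc B ≤ U → U * n² ≤ U * (4 * B) * t + 4 * n² → (2 * B + 1) * n² ≤ 8 * B * suc B * t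
  improve U B n² t U≥ le = ℕₚ.*-cancelˡ-≤ 4 (ℕₚ.+-cancelʳ-≤ (4 * n²) _ _ (ℕₚ.*-cancelˡ-≤ U ⦃ ℕ.>-nonZero (ℕₚ.≤-trans (s≤s z≤n) U≥) ⦄ (begin
    U * (4 * ((2 * B + 1) * n²) + 4 * n²)                      ≡⟨ lem₁ U B n² ⟩
    8 * suc B * (U * n²)                                       ≤⟨ ℕₚ.*-monoʳ-≤ (8 * suc B) le ⟩
    8 * suc B * (U * (4 * B) * t + 4 * n²)                     ≡⟨ lem₂ U B t n² ⟩
    U * (4 * (8 * B * suc B * t)) + 8 * suc B * (4 * n²)       ≤⟨ ℕₚ.+-monoʳ-≤ (U * (4 * (8 * B * suc B * t))) (ℕₚ.*-monoˡ-≤ (4 * n²) U≥) ⟩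
    U * (4 * (8 * B * suc B * t)) + U * (4 * n²)               ≡⟨ ℕₚ.*-distribˡ-+ U _ _ ⟨
    U * (4 * (8 * B * suc B * t) + 4 * n²)                     ∎)))
    where
    lem₁ : ∀ U B s → U * (4 * ((2 * B + 1) * s) + 4 * s) ≡ 8 * suc B * (U * s)
    lem₁ = solve-∀
    lem₂ : ∀ U B t s → 8 * suc B * (U * (4 * B) * t + 4 * s) ≡ U * (4 * (8 * B * suc B * t)) + 8 * suc B * (4 * s)
    lem₂ = solve-∀

  -- Since m is polynomial in k, some far tournament on m vertices has no transitive subtournament of order k.
  forces-improved′ : ∀ k-1 L j → let k = suc k-1 in j ≡ 2 * L + 3 → 18 * L + 43 ≤ k → k ≤ 2 ^ L → ∃ λ N → ∀ n → N ≤ n →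
    let B = tri k ∸ 1 in Forces k n (λ t → (2 * B + 1) * (n * n) ≤ 8 * B * suc B * t)
  forces-improved′ k-1 L j j≡ k-large k≤2^L = conclude (far-tournament k bs few rare)
    where
    k = suc k-1
    open Parameters j
    B = tri k ∸ 1
    pairs = List.cartesianProduct (allFin m) (allFin k)
    -- Lists with repeated vertices are enumerated as well; the count `(m * k) ^ k` is still small
    -- enough.
    bs = List.map Vec.toList (vecs pairs k)
    r≡ : r ≡ 8 * L + 20
    r≡ = trans (cong (λ z → 4 * z + 8) j≡) (lem L)
      where
      lem : ∀ L → 4 * (2 * L + 3) + 8 ≡ 8 * L + 20
      lem = solve-∀
    r+L : r + L ≡ 9 * L + 20
    r+L = trans (cong (_+ L) r≡) (lem L)
      where
      lem : ∀ L → 8 * L + 20 + L ≡ 9 * L + 20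
      lem = solve-∀
    L<r : suc L ≤ r
    L<r = subst (suc L ≤_) (sym r≡) (ℕₚ.≤-trans (ℕₚ.≤-reflexive (ℕₚ.+-comm 1 L)) (ℕₚ.+-mono-≤ (ℕₚ.m≤n*m L 8) (s≤s z≤n)))
    k≤m : k ≤ m
    k≤m = ℕₚ.≤-trans k≤2^L (ℕₚ.^-monoʳ-≤ 2 (ℕₚ.<⇒≤ L<r))
    length-bs : suc (length bs) ≤ 2 ^ ((r + L) * k + 1)
    length-bs = begin
      suc (length bs)                       ≡⟨ cong suc (trans (Listₚ.length-map Vec.toList (vecs pairs k)) (trans (length-vecs pairs k)
        (cong (_^ k) (trans (length-cartesianProductWith _,_ (allFin m) (allFin k)) (cong₂ _*_ (Listₚ.length-tabulate {n = m} id) (Listₚ.length-tabulate {n = k} id)))))) ⟩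
      1 + (m * k) ^ k                       ≤⟨ ℕₚ.+-mono-≤ (ℕₚ.m^n>0 2 ((r + L) * k)) (ℕₚ.^-monoˡ-≤ k (ℕₚ.*-monoʳ-≤ m k≤2^L)) ⟩
      2 ^ ((r + L) * k) + (2 ^ r * 2 ^ L) ^ k ≡⟨ cong (λ z → 2 ^ ((r + L) * k) + z ^ k) (ℕₚ.^-distribˡ-+-* 2 r L) ⟨
      2 ^ ((r + L) * k) + (2 ^ (r + L)) ^ k ≡⟨ cong (2 ^ ((r + L) * k) +_) (trans (ℕₚ.^-*-assoc 2 (r + L) k) (sym (ℕₚ.+-identityʳ _))) ⟩
      2 ^ suc ((r + L) * k)                 ≡⟨ cong (2 ^_) (ℕₚ.+-comm 1 ((r + L) * k)) ⟩
      2 ^ ((r + L) * k + 1)                 ∎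
    few : suc (length bs) ≤ 2 ^ (2 * (r * m))
    few = ℕₚ.≤-trans length-bs (ℕₚ.^-monoʳ-≤ 2 (begin
      (r + L) * k + 1          ≤⟨ ℕₚ.+-mono-≤ (ℕₚ.*-monoʳ-≤ (r + L) k≤m) (ℕₚ.m^n>0 2 r) ⟩
      (r + L) * m + m          ≡⟨ lem r L m ⟩
      r * m + suc L * m        ≤⟨ ℕₚ.+-monoʳ-≤ (r * m) (ℕₚ.*-monoˡ-≤ m L<r) ⟩
      r * m + r * m            ≡⟨ cong (r * m +_) (ℕₚ.+-identityʳ (r * m)) ⟨
      2 * (r * m)              ∎))
      where
      lem : ∀ r L m → (r + L) * m + m ≡ r * m + suc L * m
      lem = solve-∀
    rare : suc (length bs) ℕ.< 2 ^ tri k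
    rare = ℕₚ.≤-<-trans length-bs (ℕₚ.^-monoʳ-< 2 (s≤s (s≤s z≤n)) (begin-strict
      (r + L) * k + 1          <⟨ ℕₚ.≤-reflexive (lem ((r + L) * k)) ⟩
      (r + L) * k + 2          ≡⟨ cong (λ z → z * k + 2) r+L ⟩
      (9 * L + 20) * k + 2     ≤⟨ tri-large k L k-large ⟩
      tri k                    ∎))
      where
      lem : ∀ z → suc (z + 1) ≡ z + 2
      lem = solve-∀
    tri≥1 : 1 ≤ tri k
    tri≥1 = ℕₚ.≤-trans (ℕₚ.≤-trans (s≤s z≤n) (ℕₚ.m≤n+m 2 _)) (tri-large k L k-large)
    -- From j = 2L + 3 and k ≤ 2^L: U = 8 · 4^L ≥ 8k².
    U-large : 8 * suc B ≤ U
    U-large = begin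
      8 * suc B                ≡⟨ cong (8 *_) (ℕₚ.m+[n∸m]≡n tri≥1) ⟩
      8 * tri k                ≤⟨ ℕₚ.*-monoʳ-≤ 8 (ℕₚ.≤-trans (square-bound k) (ℕₚ.*-mono-≤ k≤2^L k≤2^L)) ⟩
      8 * (2 ^ L * 2 ^ L)      ≡⟨ ℕₚ.*-comm 8 (2 ^ L * 2 ^ L) ⟩
      2 ^ L * 2 ^ L * 8        ≡⟨ cong (_* 8) (trans (cong (λ z → 2 ^ L * 2 ^ z) (sym (ℕₚ.+-identityʳ L))) (sym (ℕₚ.^-distribˡ-+-* 2 L (L + 0)))) ⟩
      2 ^ (2 * L) * 8          ≡⟨ ℕₚ.^-distribˡ-+-* 2 (2 * L) 3 ⟨
      2 ^ (2 * L + 3)         ≡⟨ cong (2 ^_) j≡ ⟨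
      U                        ∎
    conclude : (∃ λ T → Oriented T × Tournament T × Far T × (∀ {c} → c ∈ bs → length c ≡ k → DistinctVertices c → ¬ Follows T c)) →
      ∃ λ N → ∀ n → N ≤ n → Forces k n (λ t → (2 * B + 1) * (n * n) ≤ 8 * B * suc B * t)
    conclude (T , or , tour , far , avoid) = U * m , λ n large →
      let A , orA , lb = blowup-forces k B T or tour far
            (λ q Xs ac X → reversed-within< q k-1 (ℕₚ.≤-pred (ℕₚ.≤-trans (ℕₚ.≤-trans (s≤s (s≤s z≤n)) (ℕₚ.m≤n+m 43 (18 * L))) k-large)) tour
              (λ c len → avoid (∈-toList-vecs (λ (i , r) → ∈ₚ.∈-cartesianProduct⁺ (∈ₚ.∈-allFin i) (∈ₚ.∈-allFin r)) c len) len) Xs ac X)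
            n large
      in A , orA , λ Xs dec → improve U B (n * n) (length Xs) U-large (lb Xs dec)

  forces-improved : ∀ k → 256 ≤ k → ∃ λ N → ∀ n → N ≤ n →
    let B = tri k ∸ 1 in Forces k n (λ t → (2 * B + 1) * (n * n) ≤ 8 * B * suc B * t)
  forces-improved k@(suc k-1) 256≤k = conclude (dyadic-bracket k 256≤k)
    where
    lem : ∀ ℓ → 18 * suc ℓ + 43 ≡ 18 * ℓ + 61
    lem = solve-∀
    conclude : (∃ λ ℓ → 8 ≤ ℓ × 2 ^ ℓ ≤ k × k ℕ.< 2 ^ suc ℓ) → ∃ λ N → ∀ n → N ≤ n →
      let B = tri k ∸ 1 in Forces k n (λ t → (2 * B + 1) * (n * n) ≤ 8 * B * suc B * t)
    conclude (ℓ , 8≤ℓ , lo , hi) = forces-improved′ k-1 (suc ℓ) (2 * suc ℓ + 3) refl (begin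
      18 * suc ℓ + 43          ≡⟨ lem ℓ ⟩
      18 * ℓ + 61              ≡⟨ cong (λ z → 18 * z + 61) (ℕₚ.m+[n∸m]≡n 8≤ℓ) ⟨
      18 * (8 + (ℓ ∸ 8)) + 61  ≤⟨ linear≤2^ (ℓ ∸ 8) ⟩
      2 ^ (8 + (ℓ ∸ 8))        ≡⟨ cong (2 ^_) (ℕₚ.m+[n∸m]≡n 8≤ℓ) ⟩
      2 ^ ℓ                    ≤⟨ lo ⟩
      k                        ∎)
      (ℕₚ.<⇒≤ hi)

-- Bicliques and monochromatic cliques

AllPairs-resp-⊆ : {A : Set} {P : A → A → Set} {K L : List A} → K ⊆ L → AllPairs P L → AllPairs P K
AllPairs-resp-⊆ [] [] = []
AllPairs-resp-⊆ (_ ∷ʳ s) (_ ∷ ps) = AllPairs-resp-⊆ s ps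
AllPairs-resp-⊆ (refl ∷ s) (p ∷ ps) = All-resp-⊆ s p ∷ AllPairs-resp-⊆ s ps

record Separation {A : Set} (p : A → Bool) (L : List A) : Set where
  field
    trues falses : List A
    trues⊆ : trues ⊆ L
    falses⊆ : falses ⊆ L
    true-all : All (λ x → p x ≡ true) trues
    false-all : All (λ x → p x ≡ false) falses
    sum-separate : ∀ F → sumₗ L F ≡ sumₗ trues F + sumₗ falses F

  length-separate : length L ≡ length trues + length falses
  length-separate = trans (count L) (trans (sum-separate (λ _ → 1)) (cong₂ _+_ (sym (count trues)) (sym (count falses))))
    where
    count : ∀ K → length K ≡ sumₗ K (λ _ → 1)
    count K = sym (trans (sumₗ-const K 1) (ℕₚ.*-identityʳ _))

separate : {A : Set} (p : A → Bool) (L : List A) → Separation p L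
separate p [] = record { trues = [] ; falses = [] ; trues⊆ = [] ; falses⊆ = [] ; true-all = [] ; false-all = [] ; sum-separate = λ F → refl }
separate p (x ∷ L) with p x in eq | separate p L
... | true | rest = record
  { trues = x ∷ trues ; falses = falses ; trues⊆ = refl ∷ trues⊆ ; falses⊆ = x ∷ʳ falses⊆
  ; true-all = eq ∷ true-all ; false-all = false-all
  ; sum-separate = λ F → trans (cong (F x +_) (sum-separate F)) (sym (ℕₚ.+-assoc (F x) _ _)) }
  where open Separation rest
... | false | rest = record
  { trues = trues ; falses = x ∷ falses ; trues⊆ = x ∷ʳ trues⊆ ; falses⊆ = refl ∷ falses⊆
  ; true-all = true-all ; false-all = eq ∷ false-all
  ; sum-separate = λ F → trans (cong (F x +_) (sum-separate F)) (lem (F x) (sumₗ trues F) _) }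
  where
  open Separation rest
  lem : ∀ a b c → a + (b + c) ≡ b + (a + c)
  lem = solve-∀

shrink : {A : Set} (n : ℕ) (L : List A) → n ≤ length L → ∃ λ K → K ⊆ L × length K ≡ n
shrink zero L _ = [] , Sublist.minimum L , refl
shrink (suc n) (x ∷ L) (s≤s le) with shrink n L le
... | K , sub , len = x ∷ K , refl ∷ sub , cong suc len

Biclique : {A B : Set} → (A → B → Bool) → List A → List B → Set
Biclique h As Bs = ∀ {x y} → x ∈ As → y ∈ Bs → h x y ≡ true

-- Kővári–Sós–Turán, by induction on the columns: the rows split according to their entry in the first column.
biclique-or-sparse : {A B : Set} (h : A → B → Bool) (a b : ℕ) (cols : List A) (rows : List B) →
  (∃ λ As → ∃ λ Bs → As ⊆ cols × Bs ⊆ rows × length As ≡ a × length Bs ≡ b × Biclique h As Bs)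
  ⊎ sumₗ rows (λ y → sumₗ cols (λ x → ⟦ h x y ⟧)) ≤ a * length rows + b * length cols * 2 ^ length cols
biclique-or-sparse h zero b cols rows with ℕₚ.≤-total b (length rows)
... | inj₁ le with shrink b rows le
... | Bs , sub , len = inj₁ ([] , Bs , Sublist.minimum cols , sub , refl , len , λ ())
biclique-or-sparse h zero b cols rows | inj₂ ge = inj₂ (begin
  sumₗ rows (λ y → sumₗ cols (λ x → ⟦ h x y ⟧)) ≤⟨ sumₗ-mono rows (λ {y} _ → sumₗ≤length cols (λ x → ⟦⟧≤1 (h x y))) ⟩
  sumₗ rows (λ y → length cols)                 ≡⟨ sumₗ-const rows (length cols) ⟩
  length rows * length cols                     ≤⟨ ℕₚ.*-monoˡ-≤ (length cols) ge ⟩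
  b * length cols                               ≤⟨ ℕₚ.m≤m*n _ (2 ^ length cols) ⦃ ℕₚ.m^n≢0 2 (length cols) ⦄ ⟩
  b * length cols * 2 ^ length cols             ∎)
  where open ℕₚ.≤-Reasoning
biclique-or-sparse h (suc a) b [] rows = inj₂ (ℕₚ.≤-trans (ℕₚ.≤-reflexive (trans (sumₗ-const rows 0) (ℕₚ.*-zeroʳ (length rows)))) z≤n)
biclique-or-sparse h (suc a) b (c ∷ cols) rows = decide (biclique-or-sparse h a b cols trues) (biclique-or-sparse h (suc a) b cols falses)
  where
  open Separation (separate (h c) rows)
  open ℕₚ.≤-Reasoning
  G : _ → ℕ
  G y = sumₗ cols (λ x → ⟦ h x y ⟧)
  Bound : ℕ → List _ → List _ → Set
  Bound a cols rows = sumₗ rows (λ y → sumₗ cols (λ x → ⟦ h x y ⟧)) ≤ a * length rows + b * length cols * 2 ^ length cols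
  Found : ℕ → List _ → List _ → Set
  Found a cols rows = ∃ λ As → ∃ λ Bs → As ⊆ cols × Bs ⊆ rows × length As ≡ a × length Bs ≡ b × Biclique h As Bs
  decide : Found a cols trues ⊎ Bound a cols trues → Found (suc a) cols falses ⊎ Bound (suc a) cols falses →
    Found (suc a) (c ∷ cols) rows ⊎ Bound (suc a) (c ∷ cols) rows
  decide (inj₁ (As , Bs , As⊆ , Bs⊆ , lenA , lenB , full)) _ = inj₁ (c ∷ As , Bs , refl ∷ As⊆ , ⊆-trans Bs⊆ trues⊆ , cong suc lenA , lenB ,
    λ { (here refl) y∈ → All.lookup (All-resp-⊆ Bs⊆ true-all) y∈ ; (there x∈) y∈ → full x∈ y∈ })
  decide (inj₂ _) (inj₁ (As , Bs , As⊆ , Bs⊆ , lenA , lenB , full)) = inj₁ (As , Bs , c ∷ʳ As⊆ , ⊆-trans Bs⊆ falses⊆ , lenA , lenB , full)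
  decide (inj₂ le₁) (inj₂ le₀) = inj₂ (begin
    sumₗ rows (λ y → ⟦ h c y ⟧ + G y)                            ≡⟨ sumₗ-+ rows (λ y → ⟦ h c y ⟧) G ⟩
    sumₗ rows (λ y → ⟦ h c y ⟧) + sumₗ rows G                    ≡⟨ cong₂ _+_ (sum-separate (λ y → ⟦ h c y ⟧)) (sum-separate G) ⟩
    sumₗ trues (λ y → ⟦ h c y ⟧) + sumₗ falses (λ y → ⟦ h c y ⟧) + (sumₗ trues G + sumₗ falses G)
      ≤⟨ ℕₚ.+-mono-≤ (ℕₚ.+-mono-≤ (sumₗ≤length trues (λ y → ⟦⟧≤1 (h c y))) zeros) (ℕₚ.+-mono-≤ le₁ le₀) ⟩
    -- A row of `trues` pays one for column `c`, which raises its coefficient from `a` to `suc a`;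
    -- the two error terms add up to a doubled power of 2.
    length trues + 0 + ((a * length trues + b * M * E) + (suc a * length falses + b * M * E)) ≡⟨ lem a b (length trues) (length falses) M E ⟩
    suc a * (length trues + length falses) + b * M * (2 * E)     ≤⟨ ℕₚ.+-mono-≤ (ℕₚ.≤-reflexive (cong (suc a *_) (sym length-separate)))
      (ℕₚ.*-monoˡ-≤ (2 * E) (ℕₚ.*-monoʳ-≤ b (ℕₚ.n≤1+n M))) ⟩
    suc a * length rows + b * suc M * (2 * E)                    ∎)
    where
    M = length cols
    E = 2 ^ length cols
    zeros : sumₗ falses (λ y → ⟦ h c y ⟧) ≤ 0
    zeros = ℕₚ.≤-trans (sumₗ-mono falses (λ y∈ → ℕₚ.≤-reflexive (cong ⟦_⟧ (All.lookup false-all y∈))))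
      (ℕₚ.≤-reflexive (trans (sumₗ-const falses 0) (ℕₚ.*-zeroʳ (length falses))))
    lem : ∀ a b t f M E → t + 0 + ((a * t + b * M * E) + (suc a * f + b * M * E)) ≡ suc a * (t + f) + b * M * (2 * E)
    lem = solve-∀

Monochromatic : {A : Set} → (A → A → Bool) → Bool → ℕ → List A → Set
Monochromatic c colour s L = ∃ λ S → S ⊆ L × length S ≡ s × AllPairs (λ x y → c x y ≡ colour) S

-- The usual recursion: split the rest by its colour to the first vertex and continue in the side
-- that has half of it. Pairs are read in list order, so `c` may be asymmetric.
ramsey : {A : Set} (c : A → A → Bool) (s t : ℕ) (L : List A) → 2 ^ (s + t) ≤ length L →
  Monochromatic c true s L ⊎ Monochromatic c false t L
ramsey c zero t L large = inj₁ ([] , Sublist.minimum L , refl , [])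
ramsey c (suc s) zero L large = inj₂ ([] , Sublist.minimum L , refl , [])
ramsey c (suc s) (suc t) [] large = ⊥-elim (ℕₚ.<⇒≱ (ℕₚ.m^n>0 2 (suc s + suc t)) large)
ramsey c (suc s) (suc t) (x ∷ L) large = decide (ℕₚ.≤-total (2 ^ (s + suc t)) (length trues))
  where
  open Separation (separate (c x) L)
  E = 2 ^ (s + suc t)
  red : Monochromatic c true s trues ⊎ Monochromatic c false (suc t) trues → Monochromatic c true (suc s) (x ∷ L) ⊎ Monochromatic c false (suc t) (x ∷ L)
  red (inj₁ (S , sub , len , mono)) = inj₁ (x ∷ S , refl ∷ ⊆-trans sub trues⊆ , cong suc len , All-resp-⊆ sub true-all ∷ mono)
  red (inj₂ (S , sub , len , mono)) = inj₂ (S , x ∷ʳ ⊆-trans sub trues⊆ , len , mono)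
  blue : Monochromatic c true (suc s) falses ⊎ Monochromatic c false t falses → Monochromatic c true (suc s) (x ∷ L) ⊎ Monochromatic c false (suc t) (x ∷ L)
  blue (inj₁ (S , sub , len , mono)) = inj₁ (S , x ∷ʳ ⊆-trans sub falses⊆ , len , mono)
  blue (inj₂ (S , sub , len , mono)) = inj₂ (x ∷ S , refl ∷ ⊆-trans sub falses⊆ , cong suc len , All-resp-⊆ sub false-all ∷ mono)
  decide : E ≤ length trues ⊎ length trues ≤ E → Monochromatic c true (suc s) (x ∷ L) ⊎ Monochromatic c false (suc t) (x ∷ L)
  decide (inj₁ le) = red (ramsey c s (suc t) trues le)
  -- The vertex `x` takes one of the `2 * E` places, so `falses` is sure to have `E` elements only
  -- when `trues` has strictly fewer; equality goes to the red side.
  decide (inj₂ ge) with ℕₚ.m≤n⇒m<n∨m≡n ge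
  ... | inj₂ eq = red (ramsey c s (suc t) trues (ℕₚ.≤-reflexive (sym eq)))
  ... | inj₁ lt = blue (ramsey c (suc s) t falses (subst (λ z → 2 ^ z ≤ length falses) (ℕₚ.+-suc s t)
    (ℕₚ.+-cancelˡ-≤ E _ _ (ℕₚ.≤-trans (ℕₚ.≤-reflexive (cong (E +_) (sym (ℕₚ.+-identityʳ E))))
      (ℕₚ.≤-trans large (subst (λ z → suc z ≤ E + length falses) (sym length-separate) (ℕₚ.+-monoˡ-≤ (length falses) lt)))))))

-- Removing cliques from the set of pairs to be reversed

Relation : ℕ → Set
Relation n = Fin n → Fin n → Bool

count : ∀ {n} → Relation n → Relation n → ℕ
count w τ = sum (λ u → sum (λ v → ⟦ w u v ∧ τ u v ⟧))

clique : ∀ {n} → List (Fin n) → Relation n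
clique L u v = χ L u ∧ χ L v

setOf : ∀ {n} → List (Fin n) → Subset n
setOf L = Vec.tabulate (χ L)

∣setOf∣≤ : ∀ {n} (L : List (Fin n)) → ∣ setOf L ∣ ≤ length L
∣setOf∣≤ L = begin
  ∣ setOf L ∣                         ≡⟨ ∣∣≡sum (setOf L) ⟩
  sum (λ u → ⟦ lookup (setOf L) u ⟧)  ≡⟨ sum-cong (λ u → trans (cong ⟦_⟧ (Vecₚ.lookup∘tabulate (χ L) u)) (sym (ℕₚ.*-identityʳ _))) ⟩
  sum (λ u → ⟦ χ L u ⟧ * 1)           ≤⟨ χ-sum≤ L (λ _ → 1) ⟩
  sumₗ L (λ _ → 1)                    ≡⟨ trans (sumₗ-const L 1) (ℕₚ.*-identityʳ _) ⟩
  length L                            ∎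
  where open ℕₚ.≤-Reasoning

flip-setOf : ∀ {n} (L : List (Fin n)) Xs u v → flip (setOf L ∷ Xs) u v ≡ clique L u v xor flip Xs u v
flip-setOf L Xs u v = cong₂ (λ a b → (a ∧ b) xor flip Xs u v) (Vecₚ.lookup∘tabulate (χ L) u) (Vecₚ.lookup∘tabulate (χ L) v)

Contains : ∀ {n} → Relation n → Relation n → List (Fin n) → Set
Contains w τ L = ∀ {u v} → w u v ≡ true → u ∈ L → v ∈ L → τ u v ≡ true

-- Exclusive or mirrors the inversion of `L` exactly; under `Contains` it amounts to deletion on the
-- pairs that `w` selects.
_⊖_ : ∀ {n} → Relation n → List (Fin n) → Relation n
(τ ⊖ L) u v = τ u v xor clique L u v

count-⊖ : ∀ {n} (w τ : Relation n) L → Contains w τ L → count w (τ ⊖ L) + count w (clique L) ≡ count w τ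
count-⊖ w τ L inside = trans (sym (sum-+ (λ u → sum (λ v → ⟦ w u v ∧ (τ ⊖ L) u v ⟧)) (λ u → sum (λ v → ⟦ w u v ∧ clique L u v ⟧))))
  (sum-cong λ u → trans (sym (sum-+ (λ v → ⟦ w u v ∧ (τ ⊖ L) u v ⟧) (λ v → ⟦ w u v ∧ clique L u v ⟧))) (sum-cong (cell u)))
  where
  cell : ∀ u v → ⟦ w u v ∧ (τ u v xor clique L u v) ⟧ + ⟦ w u v ∧ clique L u v ⟧ ≡ ⟦ w u v ∧ τ u v ⟧
  cell u v with w u v in wuv | χ L u in eu | χ L v in ev
  ... | false | _ | _ = refl
  ... | true | false | _ = trans (ℕₚ.+-identityʳ _) (cong ⟦_⟧ (Boolₚ.xor-identityʳ (τ u v)))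
  ... | true | true | false = trans (ℕₚ.+-identityʳ _) (cong ⟦_⟧ (Boolₚ.xor-identityʳ (τ u v)))
  ... | true | true | true rewrite inside wuv (χ⇒∈ L eu) (χ⇒∈ L ev) = refl

⊖-flip : ∀ {n} (τ τ′ : Relation n) L Xs → (∀ u v → (τ ⊖ L) u v ≡ τ′ u v xor flip Xs u v) →
  ∀ u v → τ u v ≡ τ′ u v xor flip (setOf L ∷ Xs) u v
⊖-flip τ τ′ L Xs eq u v rewrite flip-setOf L Xs u v = cell (τ u v) (clique L u v) (τ′ u v) (flip Xs u v) (eq u v)
  where
  cell : ∀ t c t′ f → t xor c ≡ t′ xor f → t ≡ t′ xor (c xor f)
  cell true true true true _ = refl
  cell true true false false _ = refl
  cell true false true false _ = refl
  cell true false false true _ = refl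
  cell false true true false _ = refl
  cell false true false true _ = refl
  cell false false true true _ = refl
  cell false false false false _ = refl

-- `splits` is an exact parity identity on all pairs, so reductions for different `w` can be
-- chained. `progress` charges each set at least `ρ` of the pairs selected by `w`, which bounds the
-- number of sets.
record Reduction {n : ℕ} (k ρ : ℕ) (w τ : Relation n) (Good : Relation n → Set) : Set where
  field
    family : List (Subset n)
    small : All (λ X → ∣ X ∣ ≤ k) family
    residue : Relation n
    splits : ∀ u v → τ u v ≡ residue u v xor flip family u v
    good : Good residue
    progress : ρ * length family + count w residue ≤ count w τ

record Removable {n : ℕ} (k ρ : ℕ) (w τ : Relation n) : Set where
  field
    vertices : List (Fin n)
    few : length vertices ≤ k
    distinct : AllPairs _≢_ vertices
    inside : Contains w τ vertices
    many : ρ ≤ arcs-within w vertices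

remove-progress : ∀ {n k ρ} {w τ : Relation n} (R : Removable k ρ w τ) → let open Removable R in
  ρ + count w (τ ⊖ vertices) ≤ count w τ
remove-progress {w = w} {τ} R = ℕₚ.≤-trans (ℕₚ.+-monoˡ-≤ _ (ℕₚ.≤-trans many (χ-sum₂≥ distinct w)))
  (ℕₚ.≤-reflexive (trans (ℕₚ.+-comm _ (count w (τ ⊖ vertices))) (count-⊖ w τ vertices inside)))
  where open Removable R

-- Each removal lowers `count w τ` by at least `ρ ≥ 1`, so this count serves as fuel.
greedy : ∀ {n k ρ} {w : Relation n} {Good : Relation n → Set} → 1 ≤ ρ →
  (∀ τ → Good τ ⊎ Removable k ρ w τ) → ∀ τ → Reduction k ρ w τ Good
greedy {n} {k} {ρ} {w} {Good} ρ≥1 step τ = go (count w τ) τ ℕₚ.≤-refl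
  where
  go : ∀ fuel τ → count w τ ≤ fuel → Reduction k ρ w τ Good
  go fuel τ le with step τ
  go fuel τ le | inj₁ good = record { family = [] ; small = [] ; residue = τ ; splits = λ u v → sym (Boolₚ.xor-identityʳ (τ u v))
    ; good = good ; progress = ℕₚ.≤-reflexive (cong (_+ count w τ) (ℕₚ.*-zeroʳ ρ)) }
  go zero τ le | inj₂ R = ⊥-elim (ℕₚ.<⇒≱ ρ≥1 (ℕₚ.≤-trans (ℕₚ.m≤m+n ρ _) (ℕₚ.≤-trans (remove-progress R) le)))
  go (suc fuel) τ le | inj₂ R = record
    { family = setOf vertices ∷ family rest
    ; small = ℕₚ.≤-trans (∣setOf∣≤ vertices) few ∷ small rest
    ; residue = residue rest
    ; splits = ⊖-flip τ (residue rest) vertices (family rest) (splits rest)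
    ; good = good rest
    ; progress = begin
        ρ * suc (length (family rest)) + count w (residue rest)    ≡⟨ cong (_+ count w (residue rest)) (ℕₚ.*-suc ρ _) ⟩
        ρ + ρ * length (family rest) + count w (residue rest)      ≡⟨ ℕₚ.+-assoc ρ _ _ ⟩
        ρ + (ρ * length (family rest) + count w (residue rest))    ≤⟨ ℕₚ.+-monoʳ-≤ ρ (progress rest) ⟩
        ρ + count w (τ ⊖ vertices)                                 ≤⟨ remove-progress R ⟩
        count w τ                                                  ∎
    }
    where
    open ℕₚ.≤-Reasoning
    open Removable R
    open Reduction
    rest = go fuel (τ ⊖ vertices) (ℕₚ.≤-pred (ℕₚ.≤-trans (ℕₚ.+-monoˡ-≤ _ ρ≥1) (ℕₚ.≤-trans (remove-progress R) le)))

arc≤arcs-within : ∀ {A : Set} (w : A → A → Bool) {L x y} → x ∈ L → y ∈ L → ⟦ w x y ⟧ ≤ arcs-within w L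
arc≤arcs-within w {L} {x} {y} x∈ y∈ = ℕₚ.≤-trans (term≤sumₗ (λ y → ⟦ w x y ⟧) y∈) (term≤sumₗ (λ x → sumₗ L (λ y → ⟦ w x y ⟧)) x∈)

all-or : ∀ {n} {P : Fin n → Set} {Q : Set} → (∀ i → P i ⊎ Q) → (∀ i → P i) ⊎ Q
all-or {zero} f = inj₁ λ ()
all-or {suc n} f with f zero | all-or (f ∘ suc)
... | inj₂ q | _ = inj₂ q
... | inj₁ _ | inj₂ q = inj₂ q
... | inj₁ p | inj₁ ps = inj₁ λ { zero → p ; (suc i) → ps i }

Empty< : ∀ {n} → Relation n → Set
Empty< τ = ∀ u v → toℕ u ℕ.< toℕ v → τ u v ≡ false

single-removable : ∀ {n k} → 2 ≤ k → (τ : Relation n) {u v : Fin n} → toℕ u ℕ.< toℕ v → τ u v ≡ true → Removable k 1 _<?ᶠ_ τ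
single-removable {n} 2≤k τ {u} {v} u<v t = record
  { vertices = u ∷ v ∷ []
  ; few = 2≤k
  ; distinct = ((λ eq → ℕₚ.<⇒≢ u<v (cong toℕ eq)) ∷ []) ∷ [] ∷ []
  ; inside = inside
  ; many = subst (_≤ arcs-within _<?ᶠ_ (u ∷ v ∷ [])) (cong ⟦_⟧ (<ᵇ-true u<v)) (arc≤arcs-within _<?ᶠ_ {u ∷ v ∷ []} (here refl) (there (here refl)))
  }
  where
  inside : Contains _<?ᶠ_ τ (u ∷ v ∷ [])
  inside e (here refl) (here refl) = ⊥-elim (ℕₚ.<-irrefl refl (<ᵇ-true⁻¹ {toℕ u} e))
  inside e (here refl) (there (here refl)) = t
  inside e (there (here refl)) (here refl) = ⊥-elim (ℕₚ.<-asym u<v (<ᵇ-true⁻¹ e))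
  inside e (there (here refl)) (there (here refl)) = ⊥-elim (ℕₚ.<-irrefl refl (<ᵇ-true⁻¹ {toℕ v} e))

singles : ∀ {n k} → 2 ≤ k → (τ : Relation n) → Reduction k 1 _<?ᶠ_ τ Empty<
singles {n} {k} 2≤k = greedy ℕₚ.≤-refl step
  where
  step : ∀ τ → Empty< τ ⊎ Removable k 1 _<?ᶠ_ τ
  step τ = all-or λ u → all-or λ v → pair u v
    where
    pair : ∀ u v → (toℕ u ℕ.< toℕ v → τ u v ≡ false) ⊎ Removable k 1 _<?ᶠ_ τ
    pair u v with u <?ᶠ v in u<v | τ u v in t
    ... | false | _ = inj₁ λ lt → ⊥-elim (true≢false (trans (sym (<ᵇ-true lt)) u<v))
    ... | true | false = inj₁ λ _ → refl
    ... | true | true = inj₂ (single-removable 2≤k τ (<ᵇ-true⁻¹ u<v) t)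

acyclic-if-monotone : ∀ {n} {A : Digraph n} (f : Fin n → ℕ) → (∀ {u v} → A u v ≡ true → f u ℕ.< f v) → Acyclic A
acyclic-if-monotone {A = A} f mono v w = ℕₚ.<-irrefl refl (rise w)
  where
  rise : ∀ {u v} → Walk A u v → f u ℕ.< f v
  rise (arc e) = mono e
  rise (e ∷ʷ w) = ℕₚ.<-trans (mono e) (rise w)

-- Meant for u < v. The second colour is the exact complement of the first instead of `A u v`, so
-- nonadjacent pairs also have exactly one colour; reversing such a pair changes nothing.
backward : ∀ {n} → Digraph n → Bool → Relation n
backward A true u v = A v u
backward A false u v = not (A v u)

module _ {n : ℕ} {A : Digraph n} (or : Oriented A) (Xs : List (Subset n)) where
  private
    no-loop : ∀ u → invertAll Xs A u u ≢ true
    no-loop u e = true≢false (trans (sym loop) (or u u loop))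
      where
      loop : A u u ≡ true
      loop = trans (sym (trans (invertAll-flip Xs A u u) (Boolₚ.if-eta (flip Xs u u)))) e

    orientations : ∀ u v f → (if f then A v u else A u v) ≡ true → f ≡ A v u × f ≡ not (A u v)
    orientations u v true e = sym e , sym (cong not (or v u e))
    orientations u v false e = sym (or u v e) , sym (cong not e)

  -- With the first colour all remaining arcs go up, with the second all go down.
  decycle : ∀ colour → (∀ u v → toℕ u ℕ.< toℕ v → backward A colour u v ≡ flip Xs u v) → Acyclic (invertAll Xs A)
  decycle true eq = acyclic-if-monotone toℕ up
    where
    up : ∀ {u v} → invertAll Xs A u v ≡ true → toℕ u ℕ.< toℕ v
    up {u} {v} e with ℕₚ.<-cmp (toℕ u) (toℕ v)
    ... | tri< lt _ _ = lt
    ... | tri≈ _ same _ with Finₚ.toℕ-injective same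
    ... | refl = ⊥-elim (no-loop u e)
    up {u} {v} e | tri> _ _ gt = ⊥-elim (Boolₚ.not-¬ {A u v} {A u v} refl (trans (trans (eq v u gt) (flip-sym Xs v u))
      (proj₂ (orientations u v (flip Xs u v) (trans (sym (invertAll-flip Xs A u v)) e)))))
  decycle false eq = acyclic-if-monotone (λ u → n ∸ toℕ u) λ {u} {v} e → ℕₚ.∸-monoʳ-< (down e) (ℕₚ.<⇒≤ (Finₚ.toℕ<n u))
    where
    down : ∀ {u v} → invertAll Xs A u v ≡ true → toℕ v ℕ.< toℕ u
    down {u} {v} e with ℕₚ.<-cmp (toℕ u) (toℕ v)
    ... | tri> _ _ gt = gt
    ... | tri≈ _ same _ with Finₚ.toℕ-injective same
    ... | refl = ⊥-elim (no-loop u e)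
    down {u} {v} e | tri< lt _ _ = ⊥-elim (Boolₚ.not-¬ {A v u} {A v u} refl
      (trans (sym (proj₁ (orientations u v (flip Xs u v) (trans (sym (invertAll-flip Xs A u v)) e)))) (sym (eq u v lt))))

open Reduction
open Removable

-- Bicliques between clusters

part-mono : ∀ Q N {u v : Fin (Q * N)} → toℕ (part Q N u) ℕ.< toℕ (part Q N v) → toℕ u ℕ.< toℕ v
part-mono Q N {u} {v} lt = subst₂ ℕ._<_ (cong toℕ (Finₚ.combine-remQuot {Q} N u)) (cong toℕ (Finₚ.combine-remQuot {Q} N v))
  (Finₚ.combine-monoˡ-< (proj₂ (Fin.remQuot {Q} N u)) (proj₂ (Fin.remQuot {Q} N v)) lt)

between : ∀ Q N → Relation (Q * N)
between Q N u v = part Q N u <?ᶠ part Q N v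

sum<-bounded : ∀ {n} {D : Fin n → Fin n → ℕ} c → (∀ i j → toℕ i ℕ.< toℕ j → D i j ≤ c) → sum< D ≤ n * n * c
sum<-bounded {zero} c le = z≤n
sum<-bounded {suc n} {D} c le = begin
  sum (D zero ∘ suc) + sum< (λ i j → D (suc i) (suc j)) ≤⟨ ℕₚ.+-mono-≤
    (ℕₚ.≤-trans (sum-mono (λ j → le zero (suc j) (s≤s z≤n))) (ℕₚ.≤-reflexive (sum-const n c)))
    (sum<-bounded c (λ i j p → le (suc i) (suc j) (s≤s p))) ⟩
  n * c + n * n * c                                     ≤⟨ ℕₚ.m≤m+n _ (suc n * c) ⟩
  n * c + n * n * c + suc n * c                         ≡⟨ lem n c ⟩
  suc n * suc n * c                                     ∎
  where
  open ℕₚ.≤-Reasoning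
  lem : ∀ n c → n * c + n * n * c + suc n * c ≡ suc n * suc n * c
  lem = solve-∀

count-between : ∀ Q N (τ : Relation (Q * N)) →
  count (between Q N) τ ≡ sum< {Q} (λ i j → sum {N} (λ a → sum {N} (λ b → ⟦ τ (combine i a) (combine j b) ⟧)))
count-between Q N τ = trans (sum-cong λ u → sum-cong λ v → ⟦∧⟧ (between Q N u v) (τ u v))
  (sym (sum-transversal-pairs Q N (λ u v → ⟦ τ u v ⟧)))

-- The columns of a cluster come in `P` groups of `M` because the error of `biclique-or-sparse` is
-- exponential in the number of columns. With P = 2^M and a + b = k the threshold becomes kN, a
-- fraction k/M of the MN pairs between a group and a cluster.
module _ (Q P M k a b : ℕ) (a≥1 : 1 ≤ a) (b≥1 : 1 ≤ b) (a+b≤k : a + b ≤ k) where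
  private
    N = P * M
    w = between Q N
    threshold = a * N + b * M * 2 ^ M
    col : Fin Q → Fin P → Fin M → Fin (Q * N)
    col i p x = combine i (combine p x)
    row : Fin Q → Fin N → Fin (Q * N)
    row = combine
    Sparse : Relation (Q * N) → Set
    Sparse τ = count w τ ≤ Q * Q * (P * threshold)

    w-true : ∀ {u v i j} → part Q N u ≡ i → part Q N v ≡ j → toℕ i ℕ.< toℕ j → w u v ≡ true
    w-true refl refl lt = <ᵇ-true lt

    w-< : ∀ {u v i j} → part Q N u ≡ i → part Q N v ≡ j → w u v ≡ true → toℕ i ℕ.< toℕ j
    w-< refl refl e = <ᵇ-true⁻¹ e

    biclique-removable : ∀ τ i j p → toℕ i ℕ.< toℕ j → ∀ As Bs →
      As ⊆ List.tabulate (col i p) → Bs ⊆ List.tabulate (row j) → length As ≡ a → length Bs ≡ b → Biclique τ As Bs →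
      Removable k (a * b) w τ
    biclique-removable τ i j p i<j As Bs As⊆ Bs⊆ lenA lenB full = record
      { vertices = As ++ Bs
      ; few = ℕₚ.≤-trans (ℕₚ.≤-reflexive (trans (Listₚ.length-++ As) (cong₂ _+_ lenA lenB))) a+b≤k
      ; distinct = AllPairsₚ.++⁺
          (AllPairs-resp-⊆ As⊆ (AllPairsₚ.tabulate⁺ λ {x} {y} x≢y eq →
            x≢y (proj₂ (Finₚ.combine-injective p x p y (proj₂ (Finₚ.combine-injective i (combine p x) i (combine p y) eq))))))
          (AllPairs-resp-⊆ Bs⊆ (AllPairsₚ.tabulate⁺ λ {x} {y} x≢y eq → x≢y (proj₂ (Finₚ.combine-injective j x j y eq))))
          (All.tabulate λ x∈ → All.tabulate λ y∈ eq → ℕₚ.<⇒≢ i<j (cong toℕ (trans (sym (partA x∈)) (trans (cong (part Q N) eq) (partB y∈)))))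
      ; inside = contained
      ; many = begin
          a * b                                                     ≡⟨ cong₂ _*_ (sym lenA) (sym lenB) ⟩
          length As * length Bs                                     ≡⟨ sumₗ-const As (length Bs) ⟨
          sumₗ As (λ x → length Bs)                                 ≤⟨ sumₗ-mono As (λ x∈ → begin
            length Bs                                                 ≡⟨ trans (sumₗ-const Bs 1) (ℕₚ.*-identityʳ _) ⟨
            sumₗ Bs (λ _ → 1)                                         ≤⟨ sumₗ-mono Bs (λ y∈ → ℕₚ.≤-reflexive (sym (cong ⟦_⟧ (w-true (partA x∈) (partB y∈) i<j)))) ⟩
            sumₗ Bs (λ y → ⟦ w _ y ⟧)                                 ≤⟨ ℕₚ.m≤n+m _ _ ⟩
            sumₗ As (λ y → ⟦ w _ y ⟧) + sumₗ Bs (λ y → ⟦ w _ y ⟧)     ≡⟨ sumₗ-++ As Bs (λ y → ⟦ w _ y ⟧) ⟨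
            sumₗ (As ++ Bs) (λ y → ⟦ w _ y ⟧)                         ∎) ⟩
          sumₗ As (λ x → sumₗ (As ++ Bs) (λ y → ⟦ w x y ⟧))         ≤⟨ ℕₚ.m≤m+n _ _ ⟩
          sumₗ As (λ x → sumₗ (As ++ Bs) (λ y → ⟦ w x y ⟧)) + sumₗ Bs (λ x → sumₗ (As ++ Bs) (λ y → ⟦ w x y ⟧))
            ≡⟨ sumₗ-++ As Bs (λ x → sumₗ (As ++ Bs) (λ y → ⟦ w x y ⟧)) ⟨
          arcs-within w (As ++ Bs)                                  ∎
      }
      where
      open ℕₚ.≤-Reasoning
      partA : ∀ {u} → u ∈ As → part Q N u ≡ i
      partA u∈ with ∈ₚ.∈-tabulate⁻ (Sublist.lookup As⊆ u∈)
      ... | x , refl = part-combine i (combine p x)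
      partB : ∀ {u} → u ∈ Bs → part Q N u ≡ j
      partB u∈ with ∈ₚ.∈-tabulate⁻ (Sublist.lookup Bs⊆ u∈)
      ... | y , refl = part-combine j y
      contained : Contains w τ (As ++ Bs)
      contained e u∈ v∈ with ∈ₚ.∈-++⁻ As u∈ | ∈ₚ.∈-++⁻ As v∈
      ... | inj₁ ua | inj₁ va = ⊥-elim (ℕₚ.<-irrefl refl (w-< (partA ua) (partA va) e))
      ... | inj₁ ua | inj₂ vb = full ua vb
      ... | inj₂ ub | inj₁ va = ⊥-elim (ℕₚ.<-asym i<j (w-< (partB ub) (partA va) e))
      ... | inj₂ ub | inj₂ vb = ⊥-elim (ℕₚ.<-irrefl refl (w-< (partB ub) (partB vb) e))

    sparse-or-biclique : ∀ τ → Sparse τ ⊎ Removable k (a * b) w τ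
    sparse-or-biclique τ = [ inj₁ ∘ bounded , inj₂ ]′ (all-or λ i → all-or λ j → all-or λ p → search i j p)
      where
      open ℕₚ.≤-Reasoning
      S : Fin Q → Fin Q → Fin P → ℕ
      S i j p = sum (λ x → sum (λ y → ⟦ τ (col i p x) (row j y) ⟧))
      search : ∀ i j p → (toℕ i ℕ.< toℕ j → S i j p ≤ threshold) ⊎ Removable k (a * b) w τ
      search i j p with toℕ i ℕ.<? toℕ j
      ... | no i≮j = inj₁ λ i<j → ⊥-elim (i≮j i<j)
      ... | yes i<j with biclique-or-sparse τ a b (List.tabulate (col i p)) (List.tabulate (row j))
      ... | inj₁ (As , Bs , As⊆ , Bs⊆ , lenA , lenB , full) = inj₂ (biclique-removable τ i j p i<j As Bs As⊆ Bs⊆ lenA lenB full)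
      ... | inj₂ le = inj₁ λ _ → subst₂ _≤_ left right le
        where
        left : sumₗ (List.tabulate (row j)) (λ y → sumₗ (List.tabulate (col i p)) (λ x → ⟦ τ x y ⟧)) ≡ S i j p
        left = trans (sumₗ-tabulate N (row j) (λ y → sumₗ (List.tabulate (col i p)) (λ x → ⟦ τ x y ⟧)))
          (trans (sum-cong λ y → sumₗ-tabulate M (col i p) (λ x → ⟦ τ x (row j y) ⟧)) (sum-swap (λ y x → ⟦ τ (col i p x) (row j y) ⟧)))
        right : a * length (List.tabulate (row j)) + b * length (List.tabulate (col i p)) * 2 ^ length (List.tabulate (col i p)) ≡ threshold
        right rewrite Listₚ.length-tabulate (row j) | Listₚ.length-tabulate (col i p) = refl
      bounded : (∀ i j p → toℕ i ℕ.< toℕ j → S i j p ≤ threshold) → Sparse τ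
      bounded le = begin
        count w τ                                                                 ≡⟨ count-between Q N τ ⟩
        sum< {Q} (λ i j → sum {N} (λ x → sum {N} (λ y → ⟦ τ (combine i x) (combine j y) ⟧)))  ≤⟨ sum<-bounded (P * threshold) (λ i j i<j → begin
          sum (λ x → sum (λ y → ⟦ τ (combine i x) (combine j y) ⟧))                 ≡⟨ sum-combine P (λ x → sum (λ y → ⟦ τ (combine i x) (combine j y) ⟧)) ⟩
          sum (λ p → S i j p)                                                      ≤⟨ sum-mono (λ p → le i j p i<j) ⟩
          sum {P} (λ p → threshold)                                                ≡⟨ sum-const P threshold ⟩
          P * threshold                                                            ∎) ⟩
        Q * Q * (P * threshold)                                                   ∎

  bicliques : ∀ τ → Reduction k (a * b) (between Q (P * M)) τ
    (λ τ → count (between Q (P * M)) τ ≤ Q * Q * (P * (a * (P * M) + b * M * 2 ^ M)))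
  bicliques = greedy (ℕₚ.*-mono-≤ a≥1 b≥1) sparse-or-biclique

count-clique≤ : ∀ {n} (w : Relation n) L → count w (clique L) ≤ length L * length L
count-clique≤ w L = begin
  count w (clique L)                                      ≤⟨ sum-mono (λ u → sum-mono (λ v → cell (w u v) (χ L u) (χ L v))) ⟩
  sum (λ u → sum (λ v → ⟦ χ L u ⟧ * (⟦ χ L v ⟧ * 1)))     ≡⟨ sum-cong (λ u → sum-*ˡ ⟦ χ L u ⟧ (λ v → ⟦ χ L v ⟧ * 1)) ⟩
  sum (λ u → ⟦ χ L u ⟧ * sum (λ v → ⟦ χ L v ⟧ * 1))       ≤⟨ χ-sum≤ L _ ⟩
  sumₗ L (λ _ → sum (λ v → ⟦ χ L v ⟧ * 1))                ≡⟨ sumₗ-const L _ ⟩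
  length L * sum (λ v → ⟦ χ L v ⟧ * 1)                    ≤⟨ ℕₚ.*-monoʳ-≤ (length L) (χ-sum≤ L (λ _ → 1)) ⟩
  length L * sumₗ L (λ _ → 1)                             ≡⟨ cong (length L *_) (trans (sumₗ-const L 1) (ℕₚ.*-identityʳ _)) ⟩
  length L * length L                                     ∎
  where
  open ℕₚ.≤-Reasoning
  cell : ∀ c a b → ⟦ c ∧ (a ∧ b) ⟧ ≤ ⟦ a ⟧ * (⟦ b ⟧ * 1)
  cell false a b = z≤n
  cell true true true = ℕₚ.≤-refl
  cell true true false = z≤n
  cell true false b = z≤n

extend : ∀ {n k ρ w} {τ : Relation n} {Good Good′ : Relation n → Set} (red : Reduction k ρ w τ Good) (R : Removable k ρ w (residue red)) →
  Good′ (residue red ⊖ vertices R) → Reduction k ρ w τ Good′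
extend {k = k} {ρ} {w} {τ} red R good′ = record
  { family = setOf L ∷ family red
  ; small = ℕₚ.≤-trans (∣setOf∣≤ L) (few R) ∷ small red
  ; residue = residue red ⊖ L
  ; splits = λ u v → trans (splits red u v) (trans (cell (residue red u v) (clique L u v) (flip (family red) u v))
      (cong (((residue red) ⊖ L) u v xor_) (sym (flip-setOf L (family red) u v))))
  ; good = good′
  ; progress = begin
      ρ * suc (length (family red)) + count w (residue red ⊖ L)      ≡⟨ lem ρ (length (family red)) _ ⟩
      ρ * length (family red) + (ρ + count w (residue red ⊖ L))      ≤⟨ ℕₚ.+-monoʳ-≤ (ρ * length (family red)) (remove-progress R) ⟩
      ρ * length (family red) + count w (residue red)                ≤⟨ progress red ⟩
      count w τ                                                      ∎
  }
  where
  open ℕₚ.≤-Reasoning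
  L = vertices R
  cell : ∀ r c f → r xor f ≡ (r xor c) xor (c xor f)
  cell true true f = refl
  cell true false f = refl
  cell false true f = sym (Boolₚ.not-involutive f)
  cell false false f = refl
  lem : ∀ ρ l c → ρ * suc l + c ≡ ρ * l + (ρ + c)
  lem = solve-∀

-- While fewer than (q + 1)² pairs are used there is a transversal of unused pairs, and Ramsey's theorem gives
-- a monochromatic clique in it.
module RamseyPacking (k q : ℕ) where
  R Q n : ℕ
  R = 2 ^ (k + k)
  Q = suc q
  n = R * Q

  Two : Set
  Two = Bool → Relation n

  unused : Two → Relation n
  unused τ u v = τ true u v ∨ τ false u v

  used : Two → ℕ
  used τ = count _<?ᶠ_ (λ u v → not (unused τ u v))

  -- The average transversal contains less than one used pair, so some transversal contains none.
  unused-transversal : ∀ τ → used τ ℕ.< Q * Q →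
    ∃ λ (f : Fin R → Fin Q) → ∀ i j → toℕ i ℕ.< toℕ j → unused τ (combine i (f i)) (combine j (f j)) ≡ true
  unused-transversal τ lt = f , λ i j i<j → all-unused i j i<j
    where
    W : Fin n → Fin n → ℕ
    W u v = ⟦ not (unused τ u v) ⟧
    choice = transversal {q} {R} (λ i j a b → W (combine i a) (combine j b))
    f = proj₁ choice
    Z : Fin R → Fin R → ℕ
    Z i j = W (combine i (f i)) (combine j (f j))
    open ℕₚ.≤-Reasoning
    bound : Q * Q * sum< Z ≤ used τ
    bound = begin
      Q * Q * sum< Z                                                          ≤⟨ proj₂ choice ⟩
      sum< {R} (λ i j → sum {Q} (λ a → sum {Q} (λ b → W (combine i a) (combine j b)))) ≡⟨ sum-transversal-pairs R Q W ⟩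
      sum (λ u → sum (λ v → ⟦ part R Q u <?ᶠ part R Q v ⟧ * W u v))           ≤⟨ sum-mono (λ u → sum-mono (λ v → cell u v)) ⟩
      used τ                                                                  ∎
      where
      cell : ∀ u v → ⟦ part R Q u <?ᶠ part R Q v ⟧ * W u v ≤ ⟦ (u <?ᶠ v) ∧ not (unused τ u v) ⟧
      cell u v with part R Q u <?ᶠ part R Q v in eq
      ... | false = z≤n
      ... | true rewrite <ᵇ-true (part-mono R Q {u} {v} (<ᵇ-true⁻¹ eq)) = ℕₚ.≤-reflexive (ℕₚ.+-identityʳ _)
    none : ∀ z → Q * Q * z ℕ.< Q * Q → z ≡ 0
    none zero _ = refl
    none (suc z) lt = ⊥-elim (ℕₚ.<⇒≱ lt (ℕₚ.m≤m*n (Q * Q) (suc z)))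
    all-unused : ∀ i j → toℕ i ℕ.< toℕ j → unused τ (combine i (f i)) (combine j (f j)) ≡ true
    all-unused i j i<j with unused τ (combine i (f i)) (combine j (f j)) | sum<≡0⇒ Z (none _ (ℕₚ.≤-<-trans bound lt)) i j i<j
    ... | true | _ = refl

  clique-removable : ∀ (τ : Relation n) (f : Fin R → Fin Q) (S : List (Fin R)) → length S ≡ k →
    AllPairs (λ i j → toℕ i ℕ.< toℕ j) S → AllPairs (λ i j → τ (combine i (f i)) (combine j (f j)) ≡ true) S →
    Σ (Removable k (tri k) _<?ᶠ_ τ) λ r → length (vertices r) ≡ k
  clique-removable τ f S len asc full = record
    { vertices = List.map vtx S
    ; few = ℕₚ.≤-reflexive len′
    ; distinct = distinct′
    -- The clique is listed in increasing order, but the two memberships may come either way; a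
    -- symmetric pair of implications covers both cases.
    ; inside = λ {u} {v} u<v u∈ v∈ → proj₁ (AllPairs-∈ {P = λ u v → (toℕ u ℕ.< toℕ v → τ u v ≡ true) × (toℕ v ℕ.< toℕ u → τ v u ≡ true)} (λ (p , q) → q , p) (AllPairsₚ.map⁺ both) u∈ v∈
        (λ eq → ℕₚ.<⇒≢ (<ᵇ-true⁻¹ {toℕ u} u<v) (cong toℕ eq))) (<ᵇ-true⁻¹ u<v)
    ; many = subst (λ z → tri z ≤ arcs-within _<?ᶠ_ (List.map vtx S)) len′
        (arcs-within≥tri _<?ᶠ_ <?ᶠ-antisym (AllPairs.map <?ᶠ-total distinct′))
    } , len′
    where
    vtx : Fin R → Fin n
    vtx i = combine i (f i)
    len′ : length (List.map vtx S) ≡ k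
    len′ = trans (Listₚ.length-map vtx S) len
    vtx-mono : ∀ {i j} → toℕ i ℕ.< toℕ j → toℕ (vtx i) ℕ.< toℕ (vtx j)
    vtx-mono {i} {j} = Finₚ.combine-monoˡ-< (f i) (f j)
    distinct′ : AllPairs _≢_ (List.map vtx S)
    distinct′ = AllPairsₚ.map⁺ (AllPairs.map (λ lt eq → ℕₚ.<⇒≢ (vtx-mono lt) (cong toℕ eq)) asc)
    both : AllPairs (λ i j → (toℕ (vtx i) ℕ.< toℕ (vtx j) → τ (vtx i) (vtx j) ≡ true) × (toℕ (vtx j) ℕ.< toℕ (vtx i) → τ (vtx j) (vtx i) ≡ true)) S
    both = AllPairs.map (λ (lt , t) → (λ _ → t) , λ gt → ⊥-elim (ℕₚ.<-asym (vtx-mono lt) gt)) (AllPairs.zip (asc , full))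

  monochromatic-removable : ∀ τ → used τ ℕ.< Q * Q →
    ∃ λ c → Σ (Removable k (tri k) _<?ᶠ_ (τ c)) λ r → length (vertices r) ≡ k
  monochromatic-removable τ lt with unused-transversal τ lt
  ... | f , free = decide (ramsey (λ i j → τ true (vtx i) (vtx j)) k k (allFin R) (ℕₚ.≤-reflexive (sym (Listₚ.length-tabulate {n = R} id))))
    where
    vtx : Fin R → Fin n
    vtx i = combine i (f i)
    asc : ∀ {S} → S ⊆ allFin R → AllPairs (λ i j → toℕ i ℕ.< toℕ j) S
    asc sub = AllPairs-resp-⊆ sub (AllPairsₚ.tabulate⁺-< λ lt → lt)
    decide : Monochromatic (λ i j → τ true (vtx i) (vtx j)) true k (allFin R) ⊎ Monochromatic (λ i j → τ true (vtx i) (vtx j)) false k (allFin R) →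
      ∃ λ c → Σ (Removable k (tri k) _<?ᶠ_ (τ c)) λ r → length (vertices r) ≡ k
    decide (inj₁ (S , sub , len , mono)) = true , clique-removable (τ true) f S len (asc sub) mono
    decide (inj₂ (S , sub , len , mono)) = false , clique-removable (τ false) f S len (asc sub)
      (AllPairs.map (λ { {i} {j} (lt , blue) → subst (λ z → z ∨ τ false (vtx i) (vtx j) ≡ true) blue (free i j lt) }) (AllPairs.zip (asc sub , mono)))

  -- The crude price `k * k` of a clique lets the number of cliques later be an exact quotient of
  -- squares.
  used-extend : ∀ (τ τ′ : Two) L → (∀ u v → ⟦ not (unused τ′ u v) ⟧ ≤ ⟦ not (unused τ u v) ⟧ + ⟦ clique L u v ⟧) →
    length L ≡ k → used τ′ ≤ used τ + k * k
  used-extend τ τ′ L le len = begin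
    used τ′                                                                 ≤⟨ sum-mono (λ u → sum-mono (λ v → cell (u <?ᶠ v) (le u v))) ⟩
    sum (λ u → sum (λ v → ⟦ (u <?ᶠ v) ∧ not (unused τ u v) ⟧ + ⟦ (u <?ᶠ v) ∧ clique L u v ⟧))
      ≡⟨ sum-cong (λ u → sum-+ (λ v → ⟦ (u <?ᶠ v) ∧ not (unused τ u v) ⟧) (λ v → ⟦ (u <?ᶠ v) ∧ clique L u v ⟧)) ⟩
    sum (λ u → sum (λ v → ⟦ (u <?ᶠ v) ∧ not (unused τ u v) ⟧) + sum (λ v → ⟦ (u <?ᶠ v) ∧ clique L u v ⟧))
      ≡⟨ sum-+ (λ u → sum (λ v → ⟦ (u <?ᶠ v) ∧ not (unused τ u v) ⟧)) (λ u → sum (λ v → ⟦ (u <?ᶠ v) ∧ clique L u v ⟧)) ⟩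
    used τ + count _<?ᶠ_ (clique L)                                         ≤⟨ ℕₚ.+-monoʳ-≤ (used τ) (count-clique≤ _<?ᶠ_ L) ⟩
    used τ + length L * length L                                            ≡⟨ cong (λ z → used τ + z * z) len ⟩
    used τ + k * k                                                          ∎
    where
    open ℕₚ.≤-Reasoning
    cell : ∀ w {a b c} → ⟦ a ⟧ ≤ ⟦ b ⟧ + ⟦ c ⟧ → ⟦ w ∧ a ⟧ ≤ ⟦ w ∧ b ⟧ + ⟦ w ∧ c ⟧
    cell true le = le
    cell false le = z≤n

  record Packing (τ : Two) (g : ℕ) : Set where
    field
      reduction : ∀ c → Reduction k (tri k) _<?ᶠ_ (τ c) (λ _ → ⊤)
      used≤ : used (λ c → residue (reduction c)) ≤ g * (k * k)
      total : length (family (reduction true)) + length (family (reduction false)) ≡ g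

  open Packing

  packing : ∀ τ → (∀ u v → unused τ u v ≡ true) → ∀ g → (∀ h → h ℕ.< g → h * (k * k) ℕ.< Q * Q) → Packing τ g
  packing τ full zero lt = record
    { reduction = λ c → record { family = [] ; small = [] ; residue = τ c ; splits = λ u v → sym (Boolₚ.xor-identityʳ (τ c u v))
      ; good = tt ; progress = ℕₚ.≤-reflexive (cong (_+ count _<?ᶠ_ (τ c)) (ℕₚ.*-zeroʳ (tri k))) }
    ; used≤ = ℕₚ.≤-reflexive (sum-zero n λ u → sum-zero n λ v → trans (cong (λ z → ⟦ (u <?ᶠ v) ∧ not z ⟧) (full u v)) (cong ⟦_⟧ (Boolₚ.∧-zeroʳ (u <?ᶠ v))))
    ; total = refl
    }
  packing τ full (suc g) lt = grow (monochromatic-removable (λ c → residue (red c)) (ℕₚ.≤-<-trans (used≤ before) (lt g ℕₚ.≤-refl)))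
    where
    before = packing τ full g (λ h h<g → lt h (ℕₚ.m<n⇒m<1+n h<g))
    red = reduction before
    old : Two
    old c = residue (red c)
    finish : ∀ (τ′ : Two) L → (∀ u v → ⟦ not (unused τ′ u v) ⟧ ≤ ⟦ not (unused old u v) ⟧ + ⟦ clique L u v ⟧) → length L ≡ k →
      used τ′ ≤ suc g * (k * k)
    finish τ′ L le len = ℕₚ.≤-trans (used-extend old τ′ L le len) (ℕₚ.≤-trans (ℕₚ.+-monoˡ-≤ (k * k) (used≤ before)) (ℕₚ.≤-reflexive (ℕₚ.+-comm (g * (k * k)) (k * k))))
    grow : (∃ λ c → Σ (Removable k (tri k) _<?ᶠ_ (old c)) λ r → length (vertices r) ≡ k) → Packing τ (suc g)
    grow (true , r , len) = record
      { reduction = red′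
      ; used≤ = finish (λ c → residue (red′ c)) (vertices r) (λ u v → cell (old true u v) (old false u v) (clique (vertices r) u v)) len
      ; total = cong suc (total before)
      }
      where
      red′ : ∀ c → Reduction k (tri k) _<?ᶠ_ (τ c) (λ _ → ⊤)
      red′ true = extend (red true) r tt
      red′ false = red false
      cell : ∀ a b c → ⟦ not ((a xor c) ∨ b) ⟧ ≤ ⟦ not (a ∨ b) ⟧ + ⟦ c ⟧
      cell a true c rewrite Boolₚ.∨-zeroʳ (a xor c) = z≤n
      cell a false true = ℕₚ.≤-trans (⟦⟧≤1 (not ((a xor true) ∨ false))) (ℕₚ.m≤n+m 1 _)
      cell a false false rewrite Boolₚ.xor-identityʳ a = ℕₚ.m≤m+n _ 0
    grow (false , r , len) = record
      { reduction = red′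
      ; used≤ = finish (λ c → residue (red′ c)) (vertices r) (λ u v → cell (old true u v) (old false u v) (clique (vertices r) u v)) len
      ; total = trans (ℕₚ.+-suc _ _) (cong suc (total before))
      }
      where
      red′ : ∀ c → Reduction k (tri k) _<?ᶠ_ (τ c) (λ _ → ⊤)
      red′ true = red true
      red′ false = extend (red false) r tt
      cell : ∀ a b c → ⟦ not (a ∨ (b xor c)) ⟧ ≤ ⟦ not (a ∨ b) ⟧ + ⟦ c ⟧
      cell true b c = z≤n
      cell false b true = ℕₚ.≤-trans (⟦⟧≤1 (not (b xor true))) (ℕₚ.m≤n+m 1 _)
      cell false b false rewrite Boolₚ.xor-identityʳ b = ℕₚ.m≤m+n _ 0

-- Assembly of the upper bound

same-part-count : ∀ Q N → sum {Q * N} (λ u → sum {Q * N} (λ v → ⟦ part Q N u == part Q N v ⟧)) ≡ Q * (N * N)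
same-part-count Q N = trans (sum-combine Q (λ u → sum {Q * N} (λ v → ⟦ part Q N u == part Q N v ⟧)))
  (trans (sum-cong {Q} (λ i → trans (sum-cong {N} (λ a → row i a)) (sum-const N N))) (sum-const Q (N * N)))
  where
  row : ∀ i (a : Fin N) → sum (λ v → ⟦ part Q N (combine i a) == part Q N v ⟧) ≡ N
  row i a = trans (sum-combine Q (λ v → ⟦ part Q N (combine i a) == part Q N v ⟧))
    (trans (sum-cong {Q} (λ j → trans (sum-cong {N} (λ b → cong₂ (λ (x y : Fin Q) → ⟦ x == y ⟧) (part-combine i a) (part-combine j b)))
      (trans (sum-const N ⟦ i == j ⟧) (ℕₚ.*-comm N _)))) (sum-δ i (λ _ → N)))

between≤< : ∀ Q N (τ : Relation (Q * N)) → count (between Q N) τ ≤ count _<?ᶠ_ τ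
between≤< Q N τ = sum-mono λ u → sum-mono (cell u)
  where
  cell : ∀ u v → ⟦ between Q N u v ∧ τ u v ⟧ ≤ ⟦ (u <?ᶠ v) ∧ τ u v ⟧
  cell u v with between Q N u v in eq
  ... | false = z≤n
  ... | true rewrite <ᵇ-true (part-mono Q N {u} {v} (<ᵇ-true⁻¹ eq)) = ℕₚ.≤-refl

<≤between : ∀ Q N (τ : Relation (Q * N)) → count _<?ᶠ_ τ ≤ count (between Q N) τ + Q * (N * N)
<≤between Q N τ = begin
  count _<?ᶠ_ τ                                              ≤⟨ sum-mono (λ u → sum-mono (cell u)) ⟩
  sum (λ u → sum (λ v → ⟦ between Q N u v ∧ τ u v ⟧ + ⟦ part Q N u == part Q N v ⟧))
    ≡⟨ sum-cong (λ u → sum-+ (λ v → ⟦ between Q N u v ∧ τ u v ⟧) (λ v → ⟦ part Q N u == part Q N v ⟧)) ⟩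
  sum (λ u → sum (λ v → ⟦ between Q N u v ∧ τ u v ⟧) + sum (λ v → ⟦ part Q N u == part Q N v ⟧))
    ≡⟨ sum-+ (λ u → sum (λ v → ⟦ between Q N u v ∧ τ u v ⟧)) (λ u → sum (λ v → ⟦ part Q N u == part Q N v ⟧)) ⟩
  count (between Q N) τ + sum {Q * N} (λ u → sum {Q * N} (λ v → ⟦ part Q N u == part Q N v ⟧)) ≡⟨ cong (count (between Q N) τ +_) (same-part-count Q N) ⟩
  count (between Q N) τ + Q * (N * N)                        ∎
  where
  open ℕₚ.≤-Reasoning
  cell : ∀ u v → ⟦ (u <?ᶠ v) ∧ τ u v ⟧ ≤ ⟦ between Q N u v ∧ τ u v ⟧ + ⟦ part Q N u == part Q N v ⟧
  cell u v with u <?ᶠ v in u<v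
  ... | false = z≤n
  ... | true with ℕₚ.<-cmp (toℕ (part Q N u)) (toℕ (part Q N v))
  ... | tri< lt _ _ rewrite <ᵇ-true lt = ℕₚ.m≤m+n _ _
  ... | tri> _ _ gt = ⊥-elim (ℕₚ.<-asym (<ᵇ-true⁻¹ {toℕ u} u<v) (part-mono Q N {v} {u} gt))
  ... | tri≈ _ same _ rewrite Finₚ.toℕ-injective same | ==-refl (part Q N v) = ℕₚ.≤-trans (⟦⟧≤1 (τ u v)) (ℕₚ.m≤n+m 1 _)

count-backward : ∀ {n} (A : Digraph n) → count _<?ᶠ_ (backward A true) + count _<?ᶠ_ (backward A false) ≡ tri n
count-backward {n} A = begin
  count _<?ᶠ_ (backward A true) + count _<?ᶠ_ (backward A false)
    ≡⟨ sum-+ (λ u → sum (λ v → ⟦ (u <?ᶠ v) ∧ A v u ⟧)) (λ u → sum (λ v → ⟦ (u <?ᶠ v) ∧ not (A v u) ⟧)) ⟨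
  sum (λ u → sum (λ v → ⟦ (u <?ᶠ v) ∧ A v u ⟧) + sum (λ v → ⟦ (u <?ᶠ v) ∧ not (A v u) ⟧))
    ≡⟨ sum-cong (λ u → trans (sym (sum-+ (λ v → ⟦ (u <?ᶠ v) ∧ A v u ⟧) (λ v → ⟦ (u <?ᶠ v) ∧ not (A v u) ⟧))) (sum-cong (λ v → cell (u <?ᶠ v) (A v u)))) ⟩
  sum {n} (λ u → sum {n} (λ v → ⟦ u <?ᶠ v ⟧ * 1))     ≡⟨ sum<≡sum {n} (λ _ _ → 1) ⟨
  sum< {n} (λ _ _ → 1)                        ≡⟨ sum<-const n ⟩
  tri n                                       ∎
  where
  open Relation.Binary.PropositionalEquality.≡-Reasoning
  cell : ∀ a b → ⟦ a ∧ b ⟧ + ⟦ a ∧ not b ⟧ ≡ ⟦ a ⟧ * 1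
  cell false b = refl
  cell true true = refl
  cell true false = refl

packing-at : ∀ k q {n} → n ≡ 2 ^ (k + k) * suc q → (τ : Bool → Relation n) → (∀ u v → τ true u v ∨ τ false u v ≡ true) →
  ∀ g → (∀ h → h ℕ.< g → h * (k * k) ℕ.< suc q * suc q) →
  Σ (∀ c → Reduction k (tri k) _<?ᶠ_ (τ c) (λ _ → ⊤)) λ red → length (family (red true)) + length (family (red false)) ≡ g
packing-at k q refl τ full g lt = RamseyPacking.Packing.reduction packed , RamseyPacking.Packing.total packed
  where
  packed = RamseyPacking.packing k q τ full g lt

module Construction (Q P M k a b : ℕ) (k≥2 : 2 ≤ k) (a≥1 : 1 ≤ a) (b≥1 : 1 ≤ b) (a+b≤k : a + b ≤ k) (gain : suc (a * b) ≤ tri k) where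
  N n leftover : ℕ
  N = P * M
  n = Q * N
  -- Sparse pairs between clusters, then pairs inside clusters, both bounded by counts of ordered
  -- pairs.
  leftover = Q * Q * (P * (a * N + b * M * 2 ^ M)) + Q * (N * N)

  record Realization (τ : Relation n) (g : ℕ) : Set where
    field
      sets : List (Subset n)
      sizes : All (λ X → ∣ X ∣ ≤ k) sets
      flips : ∀ u v → toℕ u ℕ.< toℕ v → τ u v ≡ flip sets u v
      cost : a * b * length sets + g ≤ count _<?ᶠ_ τ + a * b * leftover

  -- By `gain` a clique accounts for at least ab + 1 pairs, a biclique for ab, and every leftover
  -- pair may cost a whole set. Hence each of the cliques saves one unit against the rate ab.
  realize : ∀ τ (red : Reduction k (tri k) _<?ᶠ_ τ (λ _ → ⊤)) → Realization τ (length (family red))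
  realize τ red = record
    { sets = F₁ ++ (F₂ ++ F₃)
    ; sizes = Allₚ.++⁺ (small red) (Allₚ.++⁺ (small red₂) (small red₃))
    ; flips = λ u v u<v → trans (splits red u v) (trans (cong (_xor flip F₁ u v) (trans (splits red₂ u v) (cong (_xor flip F₂ u v)
        (trans (splits red₃ u v) (cong (_xor flip F₃ u v) (good red₃ u v u<v))))))
        (trans (cell (flip F₁ u v) (flip F₂ u v) (flip F₃ u v)) (sym (trans (flip-++ F₁ (F₂ ++ F₃) u v) (cong (flip F₁ u v xor_) (flip-++ F₂ F₃ u v))))))
    ; cost = begin
        ab * length (F₁ ++ (F₂ ++ F₃)) + g                                ≡⟨ cong (λ z → ab * z + g) (trans (Listₚ.length-++ F₁) (cong (g +_) (Listₚ.length-++ F₂))) ⟩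
        ab * (g + (length F₂ + length F₃)) + g                            ≡⟨ lem ab g (length F₂) (length F₃) ⟩
        suc ab * g + ab * length F₂ + ab * length F₃                      ≤⟨ ℕₚ.+-mono-≤ (ℕₚ.+-mono-≤ (ℕₚ.*-monoˡ-≤ g gain) F₂≤) (ℕₚ.*-monoʳ-≤ ab F₃≤) ⟩
        tri k * g + count _<?ᶠ_ (residue red) + ab * leftover             ≤⟨ ℕₚ.+-monoˡ-≤ (ab * leftover) (progress red) ⟩
        count _<?ᶠ_ τ + ab * leftover                                     ∎
    }
    where
    open ℕₚ.≤-Reasoning
    ab = a * b
    red₂ = bicliques Q P M k a b a≥1 b≥1 a+b≤k (residue red)
    red₃ = singles k≥2 (residue red₂)
    F₁ = family red
    F₂ = family red₂
    F₃ = family red₃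
    g = length F₁
    cell : ∀ x y z → (z xor y) xor x ≡ x xor (y xor z)
    cell x y z = trans (Boolₚ.xor-comm (z xor y) x) (cong (x xor_) (Boolₚ.xor-comm z y))
    lem : ∀ c g x y → c * (g + (x + y)) + g ≡ suc c * g + c * x + c * y
    lem = solve-∀
    F₂≤ : ab * length F₂ ≤ count _<?ᶠ_ (residue red)
    F₂≤ = ℕₚ.≤-trans (ℕₚ.m≤m+n _ _) (ℕₚ.≤-trans (progress red₂) (between≤< Q N (residue red)))
    F₃≤ : length F₃ ≤ leftover
    F₃≤ = begin
      length F₃                                       ≡⟨ ℕₚ.*-identityˡ _ ⟨
      1 * length F₃                                   ≤⟨ ℕₚ.m≤m+n _ _ ⟩
      1 * length F₃ + count _<?ᶠ_ (residue red₃)      ≤⟨ progress red₃ ⟩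
      count _<?ᶠ_ (residue red₂)                      ≤⟨ <≤between Q N (residue red₂) ⟩
      count (between Q N) (residue red₂) + Q * (N * N) ≤⟨ ℕₚ.+-monoˡ-≤ (Q * (N * N)) (good red₂) ⟩
      leftover                                        ∎

  -- The cheaper of the two linear orders costs at most the average.
  construct : ∀ q → n ≡ 2 ^ (k + k) * suc q → ∀ g → (∀ h → h ℕ.< g → h * (k * k) ℕ.< suc q * suc q) →
    Achieves k n (λ t → 2 * (a * b * t) + g ≤ tri n + 2 * (a * b * leftover))
  construct q n≡ g lt A or = choose (ℕₚ.≤-total (length (sets up)) (length (sets down)))
    where
    open Realization
    packed = packing-at k q n≡ (backward A) (λ u v → Boolₚ.∨-inverseʳ (A v u)) g lt
    up = realize (backward A true) (proj₁ packed true)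
    down = realize (backward A false) (proj₁ packed false)
    g₁ = length (family (proj₁ packed true))
    g₀ = length (family (proj₁ packed false))
    ab = a * b
    open ℕₚ.≤-Reasoning
    lem₁ : ∀ x y g₁ g₀ → x + y + (g₁ + g₀) ≡ x + g₁ + (y + g₀)
    lem₁ = solve-∀
    lem₂ : ∀ c d l → c + l + (d + l) ≡ c + d + 2 * l
    lem₂ = solve-∀
    cheap : ∀ t → t ≤ length (sets up) → t ≤ length (sets down) → 2 * (ab * t) + g ≤ tri n + 2 * (ab * leftover)
    cheap t le₁ le₀ = begin
      2 * (ab * t) + g                                   ≡⟨ cong₂ _+_ (cong (ab * t +_) (ℕₚ.+-identityʳ _)) (sym (proj₂ packed)) ⟩
      ab * t + ab * t + (g₁ + g₀)                        ≤⟨ ℕₚ.+-monoˡ-≤ (g₁ + g₀) (ℕₚ.+-mono-≤ (ℕₚ.*-monoʳ-≤ ab le₁) (ℕₚ.*-monoʳ-≤ ab le₀)) ⟩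
      ab * length (sets up) + ab * length (sets down) + (g₁ + g₀) ≡⟨ lem₁ (ab * length (sets up)) _ g₁ g₀ ⟩
      ab * length (sets up) + g₁ + (ab * length (sets down) + g₀) ≤⟨ ℕₚ.+-mono-≤ (cost up) (cost down) ⟩
      count _<?ᶠ_ (backward A true) + ab * leftover + (count _<?ᶠ_ (backward A false) + ab * leftover)
        ≡⟨ lem₂ (count _<?ᶠ_ (backward A true)) (count _<?ᶠ_ (backward A false)) (ab * leftover) ⟩
      count _<?ᶠ_ (backward A true) + count _<?ᶠ_ (backward A false) + 2 * (ab * leftover) ≡⟨ cong (_+ 2 * (ab * leftover)) (count-backward A) ⟩
      tri n + 2 * (ab * leftover)                        ∎
    choose : length (sets up) ≤ length (sets down) ⊎ length (sets down) ≤ length (sets up) →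
      Σ (List (Subset n)) λ Xs → Decycling k A Xs × (2 * (ab * length Xs) + g ≤ tri n + 2 * (ab * leftover))
    choose (inj₁ le) = sets up , (sizes up , decycle or (sets up) true (flips up)) , cheap (length (sets up)) ℕₚ.≤-refl le
    choose (inj₂ le) = sets down , (sizes down , decycle or (sets down) false (flips down)) , cheap (length (sets down)) le ℕₚ.≤-refl

parity : ∀ k → ∃ λ a → k ≡ a + a ⊎ k ≡ suc (a + a)
parity zero = 0 , inj₁ refl
parity (suc k) with parity k
... | a , inj₁ eq = a , inj₂ (cong suc eq)
... | a , inj₂ eq = suc a , inj₁ (cong suc (trans eq (sym (ℕₚ.+-suc a a))))

record Halves (k : ℕ) : Set where
  field
    a b : ℕ
    a+b : a + b ≡ k
    a≥1 : 1 ≤ a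
    b≥1 : 1 ≤ b
    half-square : ⌊ k * k /2⌋ ≡ 2 * (a * b)
    four : 4 * (a * b) ≤ k * k
    gain : suc (a * b) ≤ tri k

-- `gain` is what needs k ≥ 3: it is an equality, 1 · 2 + 1 = 3, at k = 3 and fails at k = 2.
halves : ∀ k → 3 ≤ k → Halves k
halves k 3≤k with parity k
... | suc (suc a) , inj₁ refl = record
  { a = 2 + a ; b = 2 + a ; a+b = refl ; a≥1 = s≤s z≤n ; b≥1 = s≤s z≤n
  ; half-square = trans (cong ⌊_/2⌋ (lem₁ (2 + a))) (sym (ℕₚ.n≡⌊n+n/2⌋ (2 * ((2 + a) * (2 + a)))))
  ; four = ℕₚ.≤-reflexive (lem₂ (2 + a))
  ; gain = ℕₚ.*-cancelˡ-≤ 2 (ℕₚ.+-cancelʳ-≤ k _ _ (ℕₚ.≤-trans (ℕₚ.m≤m+n _ (2 * (a * a) + 6 * a + 2))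
      (ℕₚ.≤-reflexive (trans (lem₃ a) (trans (sym (tri-double k)) (cong (λ z → tri k + z + k) (sym (ℕₚ.+-identityʳ (tri k)))))))))
  }
  where
  lem₁ : ∀ a → (a + a) * (a + a) ≡ 2 * (a * a) + 2 * (a * a)
  lem₁ = solve-∀
  lem₂ : ∀ a → 4 * (a * a) ≡ (a + a) * (a + a)
  lem₂ = solve-∀
  lem₃ : ∀ a → 2 * suc ((2 + a) * (2 + a)) + (2 + a + (2 + a)) + (2 * (a * a) + 6 * a + 2) ≡ (2 + a + (2 + a)) * (2 + a + (2 + a))
  lem₃ = solve-∀
... | suc a , inj₂ refl = record
  { a = suc a ; b = suc (suc a) ; a+b = ℕₚ.+-suc (suc a) (suc a) ; a≥1 = s≤s z≤n ; b≥1 = s≤s z≤n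
  ; half-square = trans (cong ⌊_/2⌋ (lem₁ a)) (sym (ℕₚ.n≡⌈n+n/2⌉ (2 * (suc a * suc (suc a)))))
  ; four = ℕₚ.≤-trans (ℕₚ.n≤1+n _) (ℕₚ.≤-reflexive (lem₂ a))
  ; gain = ℕₚ.*-cancelˡ-≤ 2 (ℕₚ.+-cancelʳ-≤ k _ _ (ℕₚ.≤-trans (ℕₚ.m≤m+n _ (2 * (a * a) + 4 * a))
      (ℕₚ.≤-reflexive (trans (lem₃ a) (trans (sym (tri-double k)) (cong (λ z → tri k + z + k) (sym (ℕₚ.+-identityʳ (tri k)))))))))
  }
  where
  lem₁ : ∀ a → suc (suc a + suc a) * suc (suc a + suc a) ≡ suc (2 * (suc a * suc (suc a)) + 2 * (suc a * suc (suc a)))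
  lem₁ = solve-∀
  lem₂ : ∀ a → suc (4 * (suc a * suc (suc a))) ≡ suc (suc a + suc a) * suc (suc a + suc a)
  lem₂ = solve-∀
  lem₃ : ∀ a → 2 * suc (suc a * suc (suc a)) + suc (suc a + suc a) + (2 * (a * a) + 4 * a) ≡ suc (suc a + suc a) * suc (suc a + suc a)
  lem₃ = solve-∀
halves .0 () | zero , inj₁ refl
halves .2 (s≤s (s≤s ())) | suc zero , inj₁ refl
halves .1 (s≤s ()) | zero , inj₂ refl

module _ where
  open ℕₚ.≤-Reasoning

  -- Sparse pairs have density about k/M and 4ab ≤ k², hence M = k³H; pairs inside clusters have
  -- density 1/Q, hence Q ≥ k²H. Each kind then contributes at most n²/H.
  leftover-small : ∀ k a b H Q P M → a + b ≡ k → 4 * (a * b) ≤ k * k → M ≡ k * k * k * H → k * k * H ≤ Q →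
    let N = P * M in H * (4 * (a * b * (Q * Q * (P * (a * N + b * M * P)) + Q * (N * N)))) ≤ 2 * (Q * N * (Q * N))
  leftover-small k a b H Q P M refl four M≡ large = begin
    H * (4 * (a * b * (Q * Q * (P * (a * (P * M) + b * M * P)) + Q * (P * M * (P * M))))) ≡⟨ lem₁ a b H Q P M ⟩
    4 * (a * b) * (H * (Q * Q * (P * (P * M * (a + b))) + Q * (P * M * (P * M)))) ≤⟨ ℕₚ.*-monoˡ-≤ _ four ⟩
    k * k * (H * (Q * Q * (P * (P * M * k)) + Q * (P * M * (P * M)))) ≡⟨ lem₂ k H Q P M ⟩
    k * k * k * H * (Q * Q * (P * (P * M))) + k * k * H * (Q * (P * M * (P * M))) ≤⟨ ℕₚ.+-mono-≤ (ℕₚ.≤-reflexive (cong (_* (Q * Q * (P * (P * M)))) (sym M≡))) (ℕₚ.*-monoˡ-≤ _ large) ⟩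
    M * (Q * Q * (P * (P * M))) + Q * (Q * (P * M * (P * M))) ≡⟨ lem₃ Q P M ⟩
    2 * (Q * (P * M) * (Q * (P * M))) ∎
    where
    lem₁ : ∀ a b H Q P M → H * (4 * (a * b * (Q * Q * (P * (a * (P * M) + b * M * P)) + Q * (P * M * (P * M)))))
      ≡ 4 * (a * b) * (H * (Q * Q * (P * (P * M * (a + b))) + Q * (P * M * (P * M))))
    lem₁ = solve-∀
    lem₂ : ∀ k H Q P M → k * k * (H * (Q * Q * (P * (P * M * k)) + Q * (P * M * (P * M))))
      ≡ k * k * k * H * (Q * Q * (P * (P * M))) + k * k * H * (Q * (P * M * (P * M)))
    lem₂ = solve-∀
    lem₃ : ∀ Q P M → M * (Q * Q * (P * (P * M))) + Q * (Q * (P * M * (P * M))) ≡ 2 * (Q * (P * M) * (Q * (P * M)))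
    lem₃ = solve-∀

  -- Divided by 4cEHm², this is the coefficient 1/(4c), minus 1/(2cE) for the cliques, plus an error
  -- 1/(2cH).
  scale : ∀ E H c t g m ℓ → 2 * (c * t) + g ≤ tri m + 2 * (c * ℓ) → H * (4 * (c * ℓ)) ≤ 2 * (m * m) → E * g ≡ m * m →
    E * (H * (4 * c)) * t + 2 * (H * (m * m)) ≤ E * (H * (m * m)) + 2 * (E * (m * m))
  scale E H c t g m ℓ main small E*g = begin
    E * (H * (4 * c)) * t + 2 * (H * (m * m))        ≡⟨ cong (λ z → E * (H * (4 * c)) * t + 2 * (H * z)) E*g ⟨
    E * (H * (4 * c)) * t + 2 * (H * (E * g))        ≡⟨ lem₁ E H c t g ⟩
    E * (H * (2 * (2 * (c * t) + g)))                ≤⟨ ℕₚ.*-monoʳ-≤ E (ℕₚ.*-monoʳ-≤ H (ℕₚ.*-monoʳ-≤ 2 main)) ⟩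
    E * (H * (2 * (tri m + 2 * (c * ℓ))))            ≡⟨ lem₂ E H (tri m) c ℓ ⟩
    E * (H * (tri m + tri m) + H * (4 * (c * ℓ)))    ≤⟨ ℕₚ.*-monoʳ-≤ E (ℕₚ.+-mono-≤ (ℕₚ.*-monoʳ-≤ H (subst (tri m + tri m ≤_) (tri-double m) (ℕₚ.m≤m+n _ m))) small) ⟩
    E * (H * (m * m) + 2 * (m * m))                  ≡⟨ lem₃ E H (m * m) ⟩
    E * (H * (m * m)) + 2 * (E * (m * m))            ∎
    where
    lem₁ : ∀ E H c t g → E * (H * (4 * c)) * t + 2 * (H * (E * g)) ≡ E * (H * (2 * (2 * (c * t) + g)))
    lem₁ = solve-∀
    lem₂ : ∀ E H x c ℓ → E * (H * (2 * (x + 2 * (c * ℓ)))) ≡ E * (H * (x + x) + H * (4 * (c * ℓ)))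
    lem₂ = solve-∀
    lem₃ : ∀ E H x → E * (H * x + 2 * x) ≡ E * (H * x) + 2 * (E * x)
    lem₃ = solve-∀

  -- As 3HZ ≤ n, rounding up multiplies the square by at most 1 + 1/H, and by at most 2 inside the
  -- error; the error grows from 2 to 1 + 2 · 2 units.
  unpad : ∀ E H c t n m Z → 1 ≤ H → n ≤ m → m ≤ n + Z → 3 * (H * Z) ≤ n →
    E * (H * (4 * c)) * t + 2 * (H * (m * m)) ≤ E * (H * (m * m)) + 2 * (E * (m * m)) →
    E * (H * (4 * c)) * t + 2 * (H * (n * n)) ≤ E * (H * (n * n)) + 5 * (E * (n * n))
  unpad E H c t n m Z H≥1 n≤m m≤ Z-small main = begin
    E * (H * (4 * c)) * t + 2 * (H * (n * n))        ≤⟨ ℕₚ.+-monoʳ-≤ (E * (H * (4 * c)) * t) (ℕₚ.*-monoʳ-≤ 2 (ℕₚ.*-monoʳ-≤ H (ℕₚ.*-mono-≤ n≤m n≤m))) ⟩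
    E * (H * (4 * c)) * t + 2 * (H * (m * m))        ≤⟨ main ⟩
    E * (H * (m * m)) + 2 * (E * (m * m))            ≤⟨ ℕₚ.+-mono-≤ (ℕₚ.*-monoʳ-≤ E H-square) (ℕₚ.*-monoʳ-≤ 2 (ℕₚ.*-monoʳ-≤ E square)) ⟩
    E * (H * (n * n) + n * n) + 2 * (E * (n * n + n * n)) ≡⟨ lem E H (n * n) ⟩
    E * (H * (n * n)) + 5 * (E * (n * n))            ∎
    where
    lem : ∀ E H x → E * (H * x + x) + 2 * (E * (x + x)) ≡ E * (H * x) + 5 * (E * x)
    lem = solve-∀
    H≢0 : NonZero H
    H≢0 = ℕ.>-nonZero H≥1
    HZ≤n : H * Z ≤ n
    HZ≤n = ℕₚ.≤-trans (ℕₚ.m≤n*m (H * Z) 3) Z-small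
    Z≤n : Z ≤ n
    Z≤n = ℕₚ.≤-trans (ℕₚ.m≤n*m Z H ⦃ H≢0 ⦄) HZ≤n
    m*m : m * m ≤ n * n + 3 * Z * n
    m*m = begin
      m * m                          ≤⟨ ℕₚ.*-mono-≤ m≤ m≤ ⟩
      (n + Z) * (n + Z)              ≡⟨ lem′ n Z ⟩
      n * n + 2 * Z * n + Z * Z      ≤⟨ ℕₚ.+-monoʳ-≤ (n * n + 2 * Z * n) (ℕₚ.*-monoʳ-≤ Z Z≤n) ⟩
      n * n + 2 * Z * n + Z * n      ≡⟨ lem″ n Z ⟩
      n * n + 3 * Z * n              ∎
      where
      lem′ : ∀ n Z → (n + Z) * (n + Z) ≡ n * n + 2 * Z * n + Z * Z
      lem′ = solve-∀
      lem″ : ∀ n Z → n * n + 2 * Z * n + Z * n ≡ n * n + 3 * Z * n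
      lem″ = solve-∀
    H-square : H * (m * m) ≤ H * (n * n) + n * n
    H-square = begin
      H * (m * m)                    ≤⟨ ℕₚ.*-monoʳ-≤ H m*m ⟩
      H * (n * n + 3 * Z * n)        ≡⟨ lem′ H n Z ⟩
      H * (n * n) + 3 * (H * Z) * n  ≤⟨ ℕₚ.+-monoʳ-≤ (H * (n * n)) (ℕₚ.*-monoˡ-≤ n Z-small) ⟩
      H * (n * n) + n * n            ∎
      where
      lem′ : ∀ H n Z → H * (n * n + 3 * Z * n) ≡ H * (n * n) + 3 * (H * Z) * n
      lem′ = solve-∀
    square : m * m ≤ n * n + n * n
    square = ℕₚ.≤-trans m*m (ℕₚ.+-monoʳ-≤ (n * n) (ℕₚ.*-monoˡ-≤ n (ℕₚ.≤-trans (ℕₚ.*-monoʳ-≤ 3 (ℕₚ.m≤n*m Z H ⦃ H≢0 ⦄)) Z-small)))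

  -- R is a Ramsey number; M and P are the subcluster size and the number of subclusters per cluster.
  module UpperParameters (k H : ℕ) (3≤k : 3 ≤ k) (H≥1 : 1 ≤ H) where
    open Halves (halves k 3≤k)

    R M P N Z E c : ℕ
    R = 2 ^ (k + k)
    M = k * k * k * H
    P = 2 ^ M
    N = P * M
    -- A multiple of `Z` can be cut both into `R` parts for the packing and into clusters of size
    -- `N`; the factor `k` makes the part size divisible by k, so that the number of cliques is its
    -- exact square quotient.
    Z = R * (k * N)
    -- Reciprocal density of the packing: `E` times the number of cliques is m².
    E = R * k * (R * k)
    c = a * b

    private
      k≥1 : 1 ≤ k
      k≥1 = ℕₚ.≤-trans (s≤s z≤n) 3≤k
      N≥1 : 1 ≤ N
      N≥1 = ℕₚ.*-mono-≤ (ℕₚ.m^n>0 2 M) (ℕₚ.*-mono-≤ (ℕₚ.*-mono-≤ (ℕₚ.*-mono-≤ k≥1 k≥1) k≥1) H≥1)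
      Z≥1 : 1 ≤ Z
      Z≥1 = ℕₚ.*-mono-≤ (ℕₚ.m^n>0 2 (k + k)) (ℕₚ.*-mono-≤ k≥1 N≥1)
      instance
        Z≢0 : NonZero Z
        Z≢0 = ℕ.>-nonZero Z≥1

    blocks : ∀ s → 1 ≤ s → k * H ≤ s → let m = R * (k * s) * N in
      Achieves k m (λ t → E * (H * (4 * c)) * t + 2 * (H * (m * m)) ≤ E * (H * (m * m)) + 2 * (E * (m * m)))
    blocks s s≥1 s-large A or = finish (construct (ℕ.pred (k * s * N)) n≡ g below A or)
      where
      Q = R * (k * s)
      g = s * N * (s * N)
      open Construction Q P M k a b (ℕₚ.≤-trans (ℕₚ.n≤1+n 2) 3≤k) a≥1 b≥1 (ℕₚ.≤-reflexive a+b) gain using (construct; leftover)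
      m = Q * N
      ksN≥1 : 1 ≤ k * s * N
      ksN≥1 = ℕₚ.*-mono-≤ (ℕₚ.*-mono-≤ k≥1 s≥1) N≥1
      suc-pred : suc (ℕ.pred (k * s * N)) ≡ k * s * N
      suc-pred = ℕₚ.suc-pred (k * s * N) ⦃ ℕ.>-nonZero ksN≥1 ⦄
      n≡ : m ≡ R * suc (ℕ.pred (k * s * N))
      n≡ = trans (ℕₚ.*-assoc R (k * s) N) (cong (R *_) (sym suc-pred))
      below : ∀ h → h ℕ.< g → h * (k * k) ℕ.< suc (ℕ.pred (k * s * N)) * suc (ℕ.pred (k * s * N))
      below h h<g = subst (h * (k * k) ℕ.<_) (trans (lem k s N) (cong₂ _*_ (sym suc-pred) (sym suc-pred)))
        (ℕₚ.*-monoˡ-< (k * k) ⦃ ℕ.>-nonZero (ℕₚ.*-mono-≤ k≥1 k≥1) ⦄ h<g)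
        where
        lem : ∀ k s N → s * N * (s * N) * (k * k) ≡ k * s * N * (k * s * N)
        lem = solve-∀
      Q-large : k * k * H ≤ Q
      Q-large = begin
        k * k * H       ≡⟨ ℕₚ.*-assoc k k H ⟩
        k * (k * H)     ≤⟨ ℕₚ.*-monoʳ-≤ k s-large ⟩
        k * s           ≤⟨ ℕₚ.m≤n*m (k * s) R ⦃ ℕₚ.m^n≢0 2 (k + k) ⦄ ⟩
        Q               ∎
      E*g : E * g ≡ m * m
      E*g = lem R k s N
        where
        lem : ∀ R k s N → R * k * (R * k) * (s * N * (s * N)) ≡ R * (k * s) * N * (R * (k * s) * N)
        lem = solve-∀
      finish : (Σ (List (Subset m)) λ Xs → Decycling k A Xs × (2 * (c * length Xs) + g ≤ tri m + 2 * (c * leftover))) →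
        Σ (List (Subset m)) λ Xs → Decycling k A Xs × (E * (H * (4 * c)) * length Xs + 2 * (H * (m * m)) ≤ E * (H * (m * m)) + 2 * (E * (m * m)))
      finish (Xs , dec , le) = Xs , dec , scale E H c (length Xs) g m leftover le
        (leftover-small k a b H Q P M a+b four refl Q-large) E*g

    -- The order is rounded up to a multiple of `Z`. In the threshold, `3 * (H * Z)` makes the
    -- rounding cheap and `k * H * Z` provides enough clusters.
    achieves : ∀ n → 3 * (H * Z) + k * H * Z ≤ n →
      Achieves k n (λ t → E * (H * (4 * c)) * t + 2 * (H * (n * n)) ≤ E * (H * (n * n)) + 5 * (E * (n * n)))
    achieves n large = Achieves-restrict (m ∸ n) (λ t → E * (H * (4 * c)) * t + 2 * (H * (n * n)) ≤ E * (H * (n * n)) + 5 * (E * (n * n))) padded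
      where
      s = suc (n DivMod./ Z)
      m = R * (k * s) * N
      m≡ : m ≡ s * Z
      m≡ = lem R k s N
        where
        lem : ∀ R k s N → R * (k * s) * N ≡ s * (R * (k * N))
        lem = solve-∀
      n≡ : n ≡ n DivMod.% Z + n DivMod./ Z * Z
      n≡ = DivMod.m≡m%n+[m/n]*n n Z
      n≤m : n ≤ m
      n≤m = begin
        n                                       ≡⟨ n≡ ⟩
        n DivMod.% Z + n DivMod./ Z * Z         ≤⟨ ℕₚ.+-monoˡ-≤ _ (ℕₚ.<⇒≤ (DivMod.m%n<n n Z)) ⟩
        s * Z                                   ≡⟨ m≡ ⟨
        m                                       ∎
      m≤n+Z : m ≤ n + Z
      m≤n+Z = begin
        m                                       ≡⟨ m≡ ⟩
        Z + n DivMod./ Z * Z                    ≡⟨ ℕₚ.+-comm Z _ ⟩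
        n DivMod./ Z * Z + Z                    ≤⟨ ℕₚ.+-monoˡ-≤ Z (subst (n DivMod./ Z * Z ≤_) (sym n≡) (ℕₚ.m≤n+m _ (n DivMod.% Z))) ⟩
        n + Z                                   ∎
      s-large : k * H ≤ s
      s-large = begin
        k * H                                   ≡⟨ DivMod.m*n/n≡m (k * H) Z ⟨
        k * H * Z DivMod./ Z                    ≤⟨ DivMod./-monoˡ-≤ Z (ℕₚ.≤-trans (ℕₚ.m≤n+m _ (3 * (H * Z))) large) ⟩
        n DivMod./ Z                            ≤⟨ ℕₚ.n≤1+n _ ⟩
        s                                       ∎
      padded : Achieves k (n + (m ∸ n)) (λ t → E * (H * (4 * c)) * t + 2 * (H * (n * n)) ≤ E * (H * (n * n)) + 5 * (E * (n * n)))
      padded = subst (λ v → Achieves k v (λ t → E * (H * (4 * c)) * t + 2 * (H * (n * n)) ≤ E * (H * (n * n)) + 5 * (E * (n * n))))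
        (sym (ℕₚ.m+[n∸m]≡n n≤m)) λ A or →
          let Xs , dec , le = blocks s (s≤s z≤n) s-large A or in
          Xs , dec , unpad E H c (length Xs) n m Z H≥1 n≤m m≤n+Z (ℕₚ.≤-trans (ℕₚ.m≤m+n _ (k * H * Z)) large) le

-- Passage to rational bounds

module _ where
  open ℚᵘₚ.≤-Reasoning

  toℚᵘ-fromℕ : ∀ m → ℚ.toℚᵘ (fromℕ m) ℚᵘ.≃ ℚᵘ.mkℚᵘ (ℤ.+ m) 0
  toℚᵘ-fromℕ m = ℚₚ.toℚᵘ-fromℚᵘ (ℚᵘ.mkℚᵘ (ℤ.+ m) 0)

  fromℕ-+ : ∀ a b → fromℕ (a + b) ≡ fromℕ a ℚ.+ fromℕ b
  fromℕ-+ a b = ℚₚ.toℚᵘ-injective (begin-equality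
    ℚ.toℚᵘ (fromℕ (a + b))                              ≃⟨ toℚᵘ-fromℕ (a + b) ⟩
    ℚᵘ.mkℚᵘ (ℤ.+ (a + b)) 0                             ≃⟨ ℚᵘ.*≡* (cong (ℤ._* ℤ.1ℤ) (sym (cong₂ ℤ._+_ (ℤₚ.*-identityʳ (ℤ.+ a)) (ℤₚ.*-identityʳ (ℤ.+ b))))) ⟩
    ℚᵘ.mkℚᵘ (ℤ.+ a) 0 ℚᵘ.+ ℚᵘ.mkℚᵘ (ℤ.+ b) 0            ≃⟨ ℚᵘₚ.+-cong (toℚᵘ-fromℕ a) (toℚᵘ-fromℕ b) ⟨
    ℚ.toℚᵘ (fromℕ a) ℚᵘ.+ ℚ.toℚᵘ (fromℕ b)              ≃⟨ ℚₚ.toℚᵘ-homo-+ (fromℕ a) (fromℕ b) ⟨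
    ℚ.toℚᵘ (fromℕ a ℚ.+ fromℕ b)                        ∎)

  fromℕ-* : ∀ a b → fromℕ (a * b) ≡ fromℕ a ℚ.* fromℕ b
  fromℕ-* a b = ℚₚ.toℚᵘ-injective (begin-equality
    ℚ.toℚᵘ (fromℕ (a * b))                              ≃⟨ toℚᵘ-fromℕ (a * b) ⟩
    ℚᵘ.mkℚᵘ (ℤ.+ (a * b)) 0                             ≃⟨ ℚᵘ.*≡* (cong (ℤ._* ℤ.1ℤ) (ℤₚ.pos-* a b)) ⟩
    ℚᵘ.mkℚᵘ (ℤ.+ a) 0 ℚᵘ.* ℚᵘ.mkℚᵘ (ℤ.+ b) 0            ≃⟨ ℚᵘₚ.*-cong (toℚᵘ-fromℕ a) (toℚᵘ-fromℕ b) ⟨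
    ℚ.toℚᵘ (fromℕ a) ℚᵘ.* ℚ.toℚᵘ (fromℕ b)              ≃⟨ ℚₚ.toℚᵘ-homo-* (fromℕ a) (fromℕ b) ⟨
    ℚ.toℚᵘ (fromℕ a ℚ.* fromℕ b)                        ∎)

  fromℕ-mono : ∀ {a b} → a ≤ b → fromℕ a ℚ.≤ fromℕ b
  fromℕ-mono {a} {b} a≤b = ℚₚ.toℚᵘ-cancel-≤ (begin
    ℚ.toℚᵘ (fromℕ a)        ≃⟨ toℚᵘ-fromℕ a ⟩
    ℚᵘ.mkℚᵘ (ℤ.+ a) 0       ≤⟨ ℚᵘ.*≤* (ℤₚ.*-monoʳ-≤-nonNeg ℤ.1ℤ (ℤ.+≤+ a≤b)) ⟩
    ℚᵘ.mkℚᵘ (ℤ.+ b) 0       ≃⟨ toℚᵘ-fromℕ b ⟨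
    ℚ.toℚᵘ (fromℕ b)        ∎)

  recip-inverse : ∀ d → 1 ≤ d → recip d ℚ.* fromℕ d ≡ ℚ.1ℚ
  recip-inverse (suc d) _ = ℚₚ.toℚᵘ-injective (begin-equality
    ℚ.toℚᵘ (recip (suc d) ℚ.* fromℕ (suc d))              ≃⟨ ℚₚ.toℚᵘ-homo-* (recip (suc d)) (fromℕ (suc d)) ⟩
    ℚ.toℚᵘ (recip (suc d)) ℚᵘ.* ℚ.toℚᵘ (fromℕ (suc d))    ≃⟨ ℚᵘₚ.*-cong (ℚₚ.toℚᵘ-fromℚᵘ (ℚᵘ.mkℚᵘ (ℤ.+ 1) d)) (toℚᵘ-fromℕ (suc d)) ⟩
    ℚᵘ.mkℚᵘ (ℤ.+ 1) d ℚᵘ.* ℚᵘ.mkℚᵘ (ℤ.+ suc d) 0          ≃⟨ ℚᵘ.*≡* (cong ℤ.+_ (lem d)) ⟩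
    ℚᵘ.1ℚᵘ                                                ∎)
    where
    lem : ∀ d → 1 * suc d * 1 ≡ 1 * (suc d * 1)
    lem = solve-∀

  -- The denominator of η serves, since the numerator is at least 1.
  archimedean : ∀ η → 0ℚ ℚ.< η → ∃ λ h → ℚ.1ℚ ℚ.≤ η ℚ.* fromℕ h
  archimedean η@(ℚ.mkℚ (ℤ.+ suc m) d _) η>0 = suc d , ℚₚ.toℚᵘ-cancel-≤ (begin
    ℚᵘ.1ℚᵘ                                                ≤⟨ ℚᵘ.*≤* (ℤ.+≤+ (subst₂ _≤_ (lem₁ d) (lem₂ m d) (ℕₚ.m≤m+n (suc d) (m * suc d)))) ⟩
    ℚᵘ.mkℚᵘ (ℤ.+ suc m) d ℚᵘ.* ℚᵘ.mkℚᵘ (ℤ.+ suc d) 0      ≃⟨ ℚᵘₚ.*-cong (ℚᵘₚ.≃-refl {ℚᵘ.mkℚᵘ (ℤ.+ suc m) d}) (toℚᵘ-fromℕ (suc d)) ⟨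
    ℚ.toℚᵘ η ℚᵘ.* ℚ.toℚᵘ (fromℕ (suc d))                  ≃⟨ ℚₚ.toℚᵘ-homo-* η (fromℕ (suc d)) ⟨
    ℚ.toℚᵘ (η ℚ.* fromℕ (suc d))                          ∎)
    where
    lem₁ : ∀ d → suc d ≡ 1 * (suc d * 1)
    lem₁ = solve-∀
    lem₂ : ∀ m d → suc d + m * suc d ≡ suc m * suc d * 1
    lem₂ = solve-∀
  archimedean (ℚ.mkℚ (ℤ.+ zero) d _) (ℚ.*<* (ℤ.+<+ ()))
  archimedean (ℚ.mkℚ ℤ.-[1+ m ] d _) (ℚ.*<* ())

recip-positive : ∀ {d} → 1 ≤ d → 0ℚ ℚ.< recip d
recip-positive {suc d} _ = ℚₚ.positive⁻¹ (recip (suc d)) ⦃ ℚₚ.normalize-pos 1 (suc d) ⦄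

recip-* : ∀ {d} m {K} → 1 ≤ d → K ≡ d * m → recip d ℚ.* fromℕ K ≡ fromℕ m
recip-* {d} m d≥1 refl = trans (cong (recip d ℚ.*_) (fromℕ-* d m)) (trans (sym (ℚₚ.*-assoc (recip d) (fromℕ d) (fromℕ m)))
  (trans (cong (ℚ._* fromℕ m) (recip-inverse d d≥1)) (ℚₚ.*-identityˡ (fromℕ m))))

fromℕ-nonNeg : ∀ m → ℚ.NonNegative (fromℕ m)
fromℕ-nonNeg m = ℚ.nonNegative (fromℕ-mono (z≤n {m}))

module _ where
  open ℚₚ.≤-Reasoning
  open +-*-Solver

  negligible : ∀ {η} h e K → 0ℚ ℚ.< η → ℚ.1ℚ ℚ.≤ η ℚ.* fromℕ h → e * h ≤ K → fromℕ e ℚ.≤ η ℚ.* fromℕ K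
  negligible {η} h e K η>0 h-large le = begin
    fromℕ e                              ≡⟨ ℚₚ.*-identityˡ (fromℕ e) ⟨
    ℚ.1ℚ ℚ.* fromℕ e                     ≤⟨ ℚₚ.*-monoʳ-≤-nonNeg (fromℕ e) ⦃ fromℕ-nonNeg e ⦄ h-large ⟩
    η ℚ.* fromℕ h ℚ.* fromℕ e            ≡⟨ trans (ℚₚ.*-assoc η _ _) (cong (η ℚ.*_) (trans (ℚₚ.*-comm (fromℕ h) (fromℕ e)) (sym (fromℕ-* e h)))) ⟩
    η ℚ.* fromℕ (e * h)                  ≤⟨ ℚₚ.*-monoˡ-≤-nonNeg η ⦃ ℚ.nonNegative (ℚₚ.<⇒≤ η>0) ⦄ (fromℕ-mono le) ⟩
    η ℚ.* fromℕ K                        ∎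

  +-cancelʳ-≤ : ∀ {x y} z → x ℚ.+ z ℚ.≤ y ℚ.+ z → x ℚ.≤ y
  +-cancelʳ-≤ {x} {y} z le = begin
    x                        ≡⟨ undo x z ⟩
    x ℚ.+ z ℚ.- z            ≤⟨ ℚₚ.+-monoˡ-≤ (ℚ.- z) le ⟩
    y ℚ.+ z ℚ.- z            ≡⟨ undo y z ⟨
    y                        ∎
    where
    undo : ∀ x z → x ≡ x ℚ.+ z ℚ.- z
    undo = solve 2 (λ x z → x := x :+ z :- z) refl

  fromℕ-linear : ∀ a b c d → fromℕ (a * b + c * d) ≡ fromℕ a ℚ.* fromℕ b ℚ.+ fromℕ c ℚ.* fromℕ d
  fromℕ-linear a b c d = trans (fromℕ-+ (a * b) (c * d)) (cong₂ ℚ._+_ (fromℕ-* a b) (fromℕ-* c d))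

  fromℕ-positive : ∀ {K} → 1 ≤ K → ℚ.Positive (fromℕ K)
  fromℕ-positive {K} K≥1 = ℚ.positive (ℚₚ.<-≤-trans (ℚₚ.positive⁻¹ ℚ.1ℚ) (fromℕ-mono K≥1))

  -- `K` is a common denominator: the integer inequality reads t/S ≥ p/K - e/K, and η absorbs e/K.
  lower-ratio : ∀ ρ η K p e S t → 1 ≤ K → ρ ℚ.* fromℕ K ≡ fromℕ p → fromℕ e ℚ.≤ η ℚ.* fromℕ K →
    p * S ≤ K * t + e * S → (ρ ℚ.- η) ℚ.* fromℕ S ℚ.≤ fromℕ t
  lower-ratio ρ η K p e S t K≥1 ρK e≤ le = ℚₚ.*-cancelʳ-≤-pos (fromℕ K) ⦃ fromℕ-positive K≥1 ⦄
    (+-cancelʳ-≤ (η ℚ.* κ ℚ.* σ) (begin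
      (ρ ℚ.- η) ℚ.* σ ℚ.* κ ℚ.+ η ℚ.* κ ℚ.* σ       ≡⟨ collect ρ η σ κ ⟩
      ρ ℚ.* κ ℚ.* σ                                 ≡⟨ cong (ℚ._* σ) ρK ⟩
      fromℕ p ℚ.* σ                                 ≡⟨ fromℕ-* p S ⟨
      fromℕ (p * S)                                 ≤⟨ fromℕ-mono le ⟩
      fromℕ (K * t + e * S)                         ≡⟨ fromℕ-linear K t e S ⟩
      κ ℚ.* fromℕ t ℚ.+ fromℕ e ℚ.* σ               ≤⟨ ℚₚ.+-mono-≤ (ℚₚ.≤-reflexive (ℚₚ.*-comm κ (fromℕ t))) (ℚₚ.*-monoʳ-≤-nonNeg σ ⦃ fromℕ-nonNeg S ⦄ e≤) ⟩
      fromℕ t ℚ.* κ ℚ.+ η ℚ.* κ ℚ.* σ               ∎))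
    where
    κ = fromℕ K
    σ = fromℕ S
    collect : ∀ ρ η σ κ → (ρ ℚ.- η) ℚ.* σ ℚ.* κ ℚ.+ η ℚ.* κ ℚ.* σ ≡ ρ ℚ.* κ ℚ.* σ
    collect = solve 4 (λ ρ η σ κ → (ρ :- η) :* σ :* κ :+ η :* κ :* σ := ρ :* κ :* σ) refl

  upper-ratio : ∀ ρ ε η K p x e S t → 1 ≤ K → ρ ℚ.* fromℕ K ≡ fromℕ p → ε ℚ.* fromℕ K ≡ fromℕ x → fromℕ e ℚ.≤ η ℚ.* fromℕ K →
    K * t + x * S ≤ p * S + e * S → fromℕ t ℚ.≤ (ρ ℚ.- ε ℚ.+ η) ℚ.* fromℕ S
  upper-ratio ρ ε η K p x e S t K≥1 ρK εK e≤ le = ℚₚ.*-cancelʳ-≤-pos (fromℕ K) ⦃ fromℕ-positive K≥1 ⦄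
    (+-cancelʳ-≤ (ε ℚ.* κ ℚ.* σ) (begin
      fromℕ t ℚ.* κ ℚ.+ ε ℚ.* κ ℚ.* σ               ≡⟨ cong₂ ℚ._+_ (ℚₚ.*-comm (fromℕ t) κ) (cong (ℚ._* σ) εK) ⟩
      κ ℚ.* fromℕ t ℚ.+ fromℕ x ℚ.* σ               ≡⟨ fromℕ-linear K t x S ⟨
      fromℕ (K * t + x * S)                         ≤⟨ fromℕ-mono le ⟩
      fromℕ (p * S + e * S)                         ≡⟨ fromℕ-linear p S e S ⟩
      fromℕ p ℚ.* σ ℚ.+ fromℕ e ℚ.* σ               ≤⟨ ℚₚ.+-mono-≤ (ℚₚ.≤-reflexive (cong (ℚ._* σ) (sym ρK))) (ℚₚ.*-monoʳ-≤-nonNeg σ ⦃ fromℕ-nonNeg S ⦄ e≤) ⟩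
      ρ ℚ.* κ ℚ.* σ ℚ.+ η ℚ.* κ ℚ.* σ               ≡⟨ collect ρ ε η σ κ ⟩
      (ρ ℚ.- ε ℚ.+ η) ℚ.* σ ℚ.* κ ℚ.+ ε ℚ.* κ ℚ.* σ ∎))
    where
    κ = fromℕ K
    σ = fromℕ S
    collect : ∀ ρ ε η σ κ → ρ ℚ.* κ ℚ.* σ ℚ.+ η ℚ.* κ ℚ.* σ ≡ (ρ ℚ.- ε ℚ.+ η) ℚ.* σ ℚ.* κ ℚ.+ ε ℚ.* κ ℚ.* σ
    collect = solve 5 (λ ρ ε η σ κ → ρ :* κ :* σ :+ η :* κ :* σ := (ρ :- ε :+ η) :* σ :* κ :+ ε :* κ :* σ) refl

-- Final bounds

lowerC-tri : ∀ k → 2 * k * (k ∸ 1) ≡ 4 * tri k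
lowerC-tri zero = refl
lowerC-tri (suc k) = ℕₚ.+-cancelʳ-≡ (2 * suc k) _ _ (trans (lem₁ k) (trans (cong (2 *_) (sym (tri-double (suc k)))) (lem₂ (tri (suc k)) (suc k))))
  where
  lem₁ : ∀ k → 2 * suc k * k + 2 * suc k ≡ 2 * (suc k * suc k)
  lem₁ = solve-∀
  lem₂ : ∀ t k → 2 * (t + t + k) ≡ 4 * t + 2 * k
  lem₂ = solve-∀

tri≥3 : ∀ {k} → 3 ≤ k → 3 ≤ tri k
tri≥3 = tri-mono

lower-basic : ∀ k → 3 ≤ k → ∀ η → 0ℚ ℚ.< η → ∃ λ N → ∀ n → N ≤ n → InvGe k n ((lowerC k ℚ.- η) ℚ.* sq n)
lower-basic k 3≤k η η>0 = from (archimedean η η>0)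
  where
  tri≥1 : 1 ≤ tri k
  tri≥1 = ℕₚ.≤-trans (s≤s z≤n) (tri≥3 3≤k)
  from : (∃ λ h → ℚ.1ℚ ℚ.≤ η ℚ.* fromℕ h) → ∃ λ N → ∀ n → N ≤ n → InvGe k n ((lowerC k ℚ.- η) ℚ.* sq n)
  from (h , h-large) = U * m , λ n large → let A , or , lb = forces-basic k j n large in
    A , or , λ Xs dec → lower-ratio (lowerC k) η K U 4 (n * n) (length Xs) K≥1 lowerC-K (negligible h 4 K η>0 h-large K-large) (lb Xs dec)
    where
    -- The error is 4/K with K ≥ U = 2^j > j, so this j brings it below η.
    j = 4 * h
    open Parameters j using (U; m; U≥1)
    K = U * (4 * tri k)
    K≥1 : 1 ≤ K
    K≥1 = ℕₚ.*-mono-≤ U≥1 (ℕₚ.*-mono-≤ (s≤s (z≤n {3})) tri≥1)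
    lowerC-K : lowerC k ℚ.* fromℕ K ≡ fromℕ U
    lowerC-K = recip-* U (subst (1 ≤_) (sym (lowerC-tri k)) (ℕₚ.*-mono-≤ (s≤s (z≤n {3})) tri≥1))
      (trans (ℕₚ.*-comm U (4 * tri k)) (cong (_* U) (sym (lowerC-tri k))))
    K-large : 4 * h ≤ K
    K-large = ℕₚ.≤-trans (ℕₚ.<⇒≤ (n<2^n j)) (ℕₚ.m≤m*n U (4 * tri k) ⦃ ℕ.>-nonZero (ℕₚ.*-mono-≤ (s≤s (z≤n {3})) tri≥1) ⦄)

lower-improved : ∀ k → 256 ≤ k → Σ ℚ λ δ → (0ℚ ℚ.< δ) ×
  ((η : ℚ) → 0ℚ ℚ.< η → Σ ℕ λ N → (n : ℕ) → N ≤ n → InvGe k n ((lowerC k ℚ.+ δ ℚ.- η) ℚ.* sq n))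
lower-improved k 256≤k = δ , recip-positive K≥1 , λ η η>0 → from η η>0 (archimedean η η>0) (forces-improved k 256≤k)
  where
  B = tri k ∸ 1
  K = 8 * B * suc B
  -- The half of the gap between 1/(4B) and 1/(4(B + 1)) that `improve` keeps.
  δ = recip K
  3≤tri : 3 ≤ tri k
  3≤tri = tri≥3 (ℕₚ.≤-trans (s≤s (s≤s (s≤s z≤n))) 256≤k)
  B≥1 : 1 ≤ B
  B≥1 = ℕₚ.∸-monoˡ-≤ 1 (ℕₚ.≤-trans (ℕₚ.n≤1+n 2) 3≤tri)
  K≥1 : 1 ≤ K
  K≥1 = ℕₚ.*-mono-≤ (ℕₚ.*-mono-≤ (s≤s (z≤n {7})) B≥1) (s≤s (z≤n {B}))
  lowerC≡ : 2 * k * (k ∸ 1) ≡ 4 * suc B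
  lowerC≡ = trans (lowerC-tri k) (cong (4 *_) (sym (ℕₚ.m+[n∸m]≡n (ℕₚ.≤-trans (s≤s z≤n) 3≤tri))))
  ratio : (lowerC k ℚ.+ δ) ℚ.* fromℕ K ≡ fromℕ (2 * B + 1)
  ratio = trans (ℚₚ.*-distribʳ-+ (fromℕ K) (lowerC k) δ) (trans (cong₂ ℚ._+_
    (recip-* (2 * B) (subst (1 ≤_) (sym lowerC≡) (s≤s z≤n)) (trans (lem B) (cong (_* (2 * B)) (sym lowerC≡))))
    (recip-* 1 K≥1 (sym (ℕₚ.*-identityʳ K)))) (sym (fromℕ-+ (2 * B) 1)))
    where
    lem : ∀ B → 8 * B * suc B ≡ 4 * suc B * (2 * B)
    lem = solve-∀
  from : ∀ η → 0ℚ ℚ.< η → (∃ λ h → ℚ.1ℚ ℚ.≤ η ℚ.* fromℕ h) →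
    (∃ λ N → ∀ n → N ≤ n → Forces k n (λ t → (2 * B + 1) * (n * n) ≤ K * t)) →
    ∃ λ N → ∀ n → N ≤ n → InvGe k n ((lowerC k ℚ.+ δ ℚ.- η) ℚ.* sq n)
  from η η>0 (h , h-large) (N , forces) = N , λ n large → let A , or , lb = forces n large in
    A , or , λ Xs dec → lower-ratio (lowerC k ℚ.+ δ) η K (2 * B + 1) 0 (n * n) (length Xs) K≥1 ratio (negligible h 0 K η>0 h-large z≤n)
      (ℕₚ.≤-trans (lb Xs dec) (ℕₚ.m≤m+n _ 0))

upper : ∀ k → 3 ≤ k → Σ ℚ λ ε → (0ℚ ℚ.< ε) ×
  ((η : ℚ) → 0ℚ ℚ.< η → Σ ℕ λ N → (n : ℕ) → N ≤ n → InvLe k n ((upperC k ℚ.- ε ℚ.+ η) ℚ.* sq n))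
upper k 3≤k = ε , recip-positive E*4c≥1 , λ η η>0 → from η η>0 (archimedean η η>0)
  where
  open Halves (halves k 3≤k)
  c = a * b
  E = 2 ^ (k + k) * k * (2 ^ (k + k) * k)
  4c≥1 : 1 ≤ 4 * c
  4c≥1 = ℕₚ.*-mono-≤ (s≤s (z≤n {3})) (ℕₚ.*-mono-≤ a≥1 b≥1)
  k≥1 : 1 ≤ k
  k≥1 = ℕₚ.≤-trans (s≤s z≤n) 3≤k
  E≥1 : 1 ≤ E
  E≥1 = ℕₚ.*-mono-≤ (ℕₚ.*-mono-≤ (ℕₚ.m^n>0 2 (k + k)) k≥1) (ℕₚ.*-mono-≤ (ℕₚ.m^n>0 2 (k + k)) k≥1)
  E*4c≥1 : 1 ≤ E * (4 * c)
  E*4c≥1 = ℕₚ.*-mono-≤ E≥1 4c≥1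
  -- Half of the gain 1/(2cE) in `scale`; `weaken` gives up the other half.
  ε = recip (E * (4 * c))
  from : ∀ η → 0ℚ ℚ.< η → (∃ λ h → ℚ.1ℚ ℚ.≤ η ℚ.* fromℕ h) →
    ∃ λ N → ∀ n → N ≤ n → InvLe k n ((upperC k ℚ.- ε ℚ.+ η) ℚ.* sq n)
  from η η>0 (h , h-large) = 3 * (H * Z) + k * H * Z , λ n large A or → let Xs , dec , le = achieves n large A or in
    Xs , dec , upper-ratio (upperC k) ε η K (E * H) H (5 * E) (n * n) (length Xs) K≥1 upperC-K (recip-* H E*4c≥1 (swap E H (4 * c)))
      (negligible h (5 * E) K η>0 h-large K-large) (weaken n (length Xs) le)
    where
    -- The error left by `unpad` is 5E/K = 5/(4cH), so H > 5h brings it below η.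
    H = suc (5 * h)
    open UpperParameters k H 3≤k (s≤s z≤n) using (Z; achieves)
    K = E * (H * (4 * c))
    K≥1 : 1 ≤ K
    K≥1 = ℕₚ.*-mono-≤ E≥1 (ℕₚ.*-mono-≤ (s≤s (z≤n {5 * h})) 4c≥1)
    swap : ∀ E H d → E * (H * d) ≡ E * d * H
    swap = solve-∀
    upperC≡ : 2 * ⌊ k * k /2⌋ ≡ 4 * c
    upperC≡ = trans (cong (2 *_) half-square) (sym (ℕₚ.*-assoc 2 2 c))
    upperC-K : upperC k ℚ.* fromℕ K ≡ fromℕ (E * H)
    upperC-K = recip-* (E * H) (subst (1 ≤_) (sym upperC≡) 4c≥1) (trans (lem E H (4 * c)) (cong (_* (E * H)) (sym upperC≡)))
      where
      lem : ∀ E H d → E * (H * d) ≡ d * (E * H)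
      lem = solve-∀
    K-large : 5 * E * h ≤ K
    K-large = begin
      5 * E * h              ≡⟨ lem E h ⟩
      E * (5 * h * 1)        ≤⟨ ℕₚ.*-monoʳ-≤ E (ℕₚ.*-mono-≤ (ℕₚ.n≤1+n (5 * h)) 4c≥1) ⟩
      K                      ∎
      where
      open ℕₚ.≤-Reasoning
      lem : ∀ E h → 5 * E * h ≡ E * (5 * h * 1)
      lem = solve-∀
    weaken : ∀ n t → K * t + 2 * (H * (n * n)) ≤ E * (H * (n * n)) + 5 * (E * (n * n)) → K * t + H * (n * n) ≤ E * H * (n * n) + 5 * E * (n * n)
    weaken n t le = ℕₚ.≤-trans (ℕₚ.+-monoʳ-≤ (K * t) (ℕₚ.m≤n*m (H * (n * n)) 2)) (ℕₚ.≤-trans le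
      (ℕₚ.≤-reflexive (sym (cong₂ _+_ (ℕₚ.*-assoc E H (n * n)) (ℕₚ.*-assoc 5 E (n * n))))))

theorem1p4 : ((k : ℕ) → 3 ≤ k →
    Σ ℚ λ ε → (0ℚ ℚ.< ε) ×
    ((η : ℚ) → 0ℚ ℚ.< η → Σ ℕ λ N → (n : ℕ) → N ≤ n →
    InvGe k n ((lowerC k ℚ.- η) ℚ.* sq n) ×
    InvLe k n ((upperC k ℚ.- ε ℚ.+ η) ℚ.* sq n)))
    ×
    (Σ ℕ λ k₀ → (k : ℕ) → k₀ ≤ k →
    Σ ℚ λ δ → (0ℚ ℚ.< δ) ×
    ((η : ℚ) → 0ℚ ℚ.< η → Σ ℕ λ N → (n : ℕ) → N ≤ n →
    InvGe k n ((lowerC k ℚ.+ δ ℚ.- η) ℚ.* sq n)))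
theorem1p4 = (λ k 3≤k → combine-bounds k (lower-basic k 3≤k) (upper k 3≤k)) , 256 , lower-improved
  where
  combine-bounds : ∀ k →
    (∀ η → 0ℚ ℚ.< η → ∃ λ N → ∀ n → N ≤ n → InvGe k n ((lowerC k ℚ.- η) ℚ.* sq n)) →
    (Σ ℚ λ ε → (0ℚ ℚ.< ε) × (∀ η → 0ℚ ℚ.< η → ∃ λ N → ∀ n → N ≤ n → InvLe k n ((upperC k ℚ.- ε ℚ.+ η) ℚ.* sq n))) →
    Σ ℚ λ ε → (0ℚ ℚ.< ε) × (∀ η → 0ℚ ℚ.< η → ∃ λ N → ∀ n → N ≤ n →
      InvGe k n ((lowerC k ℚ.- η) ℚ.* sq n) × InvLe k n ((upperC k ℚ.- ε ℚ.+ η) ℚ.* sq n))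
  combine-bounds k lower (ε , ε>0 , above) = ε , ε>0 , λ η η>0 →
    let N₁ , lo = lower η η>0
        N₂ , hi = above η η>0
    in N₁ + N₂ , λ n large → lo n (ℕₚ.≤-trans (ℕₚ.m≤m+n N₁ N₂) large) , hi n (ℕₚ.≤-trans (ℕₚ.m≤n+m N₂ N₁) large)
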